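{- Let $m\ge 0$ be an integer, and let $(G,\{a_1,\ldots,a_m\},b_1,b_2)$ be an $m$-rooted graph. Then either $(G,\{a_1,\ldots,a_m\},b_1,b_2)$ is feasible, or there exists an $\{a_1,\ldots,a_m,b_1,b_2\}$-collection $\mathcal{X}$ in $G$ such that (i) $|N(X)|\le m+1$ for all $X\in\mathcal{X}$, and (ii) $e(\mathcal{G}/\mathcal{X})\le (m+1)\,v(G/\mathcal{X})-m^2/2-3m/2-1$, where $\mathcal{G}=(G,\{a_1,\ldots,a_m\},b_1,b_2)$.
   Context: All graphs are finite and simple; $v(H)$ and $e(H)$ denote the numbers of vertices and edges of $H$. For $A\subseteq V(G)$, $N(A)=N_G(A)$ is the set of vertices outside $A$ adjacent to some vertex of $A$, and $N[A]=N(A)\cup A$. An $m$-rooted graph $(G,\{a_1,\ldots,a_m\},b_1,b_2)$ consists of a graph $G$ and distinct vertices $a_1,\ldots,a_m,b_1,b_2$ of $G$ ($m=0$ allowed, in which case the set of $a_i$ is empty). It is feasible if $G$ contains a $b_1$-$b_2$ path $P$ such that $\{a_1,\ldots,a_m\}$ is contained in a single component of $G-P$ (the graph obtained by deleting the vertices of $P$). For $S\subseteq V(G)$, an $S$-collection in $G$ is a family $\mathcal{X}$ of subsets of $V(G)\setminus S$ such that $N[X_1]\cap X_2=\emptyset$ for all distinct $X_1,X_2\in\mathcal{X}$. $G/\mathcal{X}$ denotes the graph obtained from $G$ by, for each $X\in\mathcal{X}$, deleting $X$ and adding edges making $N_G(X)$ a clique. For a rooted graph $\mathcal{G}=(G,\{a_1,\ldots,a_m\},b_1,b_2)$,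 $\mathcal{G}/\mathcal{X}$ denotes the graph obtained from $G/\mathcal{X}$ by adding an edge between every pair of distinct vertices of $\{a_1,\ldots,a_m,b_1,b_2\}$ except the pair $\{b_1,b_2\}$ (if not already present). -}

module Defs where

open import Data.Bool using (Bool; true; false; not; _∧_; _∨_; if_then_else_)
open import Data.Nat using (ℕ; zero; suc; _+_; _*_; _≤_; _<ᵇ_)
open import Data.Fin using (Fin; zero; suc; toℕ; fromℕ; inject₁; _≟_)
open import Data.Product using (Σ; ∃; _×_; _,_)
open import Data.Sum using (_⊎_)
open import Function using (_∘_)
open import Function.Definitions using (Injective)
open import Relation.Nullary using (¬_; does)
open import Relation.Binary.PropositionalEquality using (_≡_; _≢_)

VSet : ℕ → Set
VSet n = Fin n → Bool

_==_ : ∀ {n} → Fin n → Fin n → Bool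
i == j = does (i ≟ j)

anyᵇ : ∀ {k} → (Fin k → Bool) → Bool
anyᵇ {zero}  f = false
anyᵇ {suc k} f = f zero ∨ anyᵇ (f ∘ suc)

countᵇ : ∀ {k} → (Fin k → Bool) → ℕ
countᵇ {zero}  f = 0
countᵇ {suc k} f = (if f zero then 1 else 0) + countᵇ (f ∘ suc)

sumFin : ∀ {k} → (Fin k → ℕ) → ℕ
sumFin {zero}  f = 0
sumFin {suc k} f = f zero + sumFin (f ∘ suc)

record Graph (n : ℕ) : Set where
  field
    adj        : Fin n → Fin n → Bool
    adj-sym    : ∀ u v → adj u v ≡ adj v u
    adj-irrefl : ∀ u → adj u u ≡ false
open Graph public

Adj : ∀ {n} → Graph n → Fin n → Fin n → Set
Adj G u v = adj G u v ≡ true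

Nbd : ∀ {n} → Graph n → VSet n → VSet n
Nbd G X v = not (X v) ∧ anyᵇ (λ u → X u ∧ adj G u v)

CNbd : ∀ {n} → Graph n → VSet n → VSet n
CNbd G X v = X v ∨ Nbd G X v

record RootedGraph (m : ℕ) : Set where
  field
    n      : ℕ
    G      : Graph n
    a      : Fin m → Fin n
    b₁     : Fin n
    b₂     : Fin n
    a-inj  : Injective _≡_ _≡_ a
    a≢b₁   : ∀ i → a i ≢ b₁
    a≢b₂   : ∀ i → a i ≢ b₂
    b₁≢b₂  : b₁ ≢ b₂
open RootedGraph public

Roots : ∀ {m} (R : RootedGraph m) → VSet (n R)
Roots R v = anyᵇ (λ i → a R i == v) ∨ (v == b₁ R) ∨ (v == b₂ R)

data WalkAvoiding {n} (G : Graph n) (D : Fin n → Set) : Fin n → Fin n → Set where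
  [_]  : ∀ {u} → ¬ D u → WalkAvoiding G D u u
  _∷⟨_⟩_ : ∀ {u w v} → ¬ D u → Adj G u w → WalkAvoiding G D w v → WalkAvoiding G D u v

record Path {n} (G : Graph n) (s t : Fin n) : Set where
  field
    len   : ℕ
    vtx   : Fin (suc len) → Fin n
    inj   : Injective _≡_ _≡_ vtx
    start : vtx zero ≡ s
    end   : vtx (fromℕ len) ≡ t
    step  : ∀ (i : Fin len) → Adj G (vtx (inject₁ i)) (vtx (suc i))
open Path public

OnPath : ∀ {n} {G : Graph n} {s t : Fin n} → Path G s t → Fin n → Set
OnPath P v = ∃ λ i → vtx P i ≡ v

Feasible : ∀ {m} → RootedGraph m → Set
Feasible R = Σ (Path (G R) (b₁ R) (b₂ R)) λ P →
  ∀ i j → WalkAvoiding (G R) (OnPath P) (a R i) (a R j)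

record IsCollection {n} (G : Graph n) (S : VSet n) {k} (𝒳 : Fin k → VSet n) : Set where
  field
    avoid : ∀ i v → 𝒳 i v ≡ true → S v ≡ false
    sep   : ∀ i j → i ≢ j → ∀ v → CNbd G (𝒳 i) v ≡ true → 𝒳 j v ≡ false
open IsCollection public

Kept : ∀ {n k} → (Fin k → VSet n) → VSet n
Kept 𝒳 v = not (anyᵇ (λ i → 𝒳 i v))

-- adjacency of G/𝒳 (between kept vertices u ≠ v)
quotAdj : ∀ {n k} → Graph n → (Fin k → VSet n) → Fin n → Fin n → Bool
quotAdj G 𝒳 u v = adj G u v ∨ anyᵇ (λ i → Nbd G (𝒳 i) u ∧ Nbd G (𝒳 i) v)

rootedQuotAdj : ∀ {m k} (R : RootedGraph m) → (Fin k → VSet (n R)) → Fin (n R) → Fin (n R) → Bool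
rootedQuotAdj R 𝒳 u v =
  quotAdj (G R) 𝒳 u v ∨
  (Roots R u ∧ Roots R v ∧ not (u == v) ∧
   not ((u == b₁ R ∧ v == b₂ R) ∨ (u == b₂ R ∧ v == b₁ R)))

vQuot : ∀ {n k} → (Fin k → VSet n) → ℕ
vQuot 𝒳 = countᵇ (Kept 𝒳)

eRootedQuot : ∀ {m k} (R : RootedGraph m) → (Fin k → VSet (n R)) → ℕ
eRootedQuot R 𝒳 = sumFin λ u → countᵇ λ v →
  (toℕ u <ᵇ toℕ v) ∧ Kept 𝒳 u ∧ Kept 𝒳 v ∧ rootedQuotAdj R 𝒳 u v

-- Write k = m + 1, S for the set of roots, B = {b₁, b₂}, and ρ(X) for the number of edges meeting X. Suppose that
-- ρ(X) ≤ k |X| whenever X avoids S and |N(X)| < |S|. If the set U of non-roots has ρ(U) ≥ k |U| + 2, the rooted graph is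
-- feasible, by induction on |U|: contracting an edge either preserves the hypotheses or produces a set X violating
-- the first one. A minimal violator is rigid by induction (any choice of two vertices of N(X) can be joined by a
-- path that leaves the rest of N(X) linked, all inside X ∪ N(X)), and a Menger-type argument links S to it. So every
-- edge may be assumed to lie in k triangles; then a vertex of small degree has a dense neighbourhood, which is rigid too.
-- In general, rigid violators are eliminated one after the other, and they make up the collection 𝒳.
module Submission where

open import Defs
open import Data.Bool using (Bool; true; false; not; _∧_; _∨_)
open import Data.Bool.Properties using (∨-comm) renaming (_≟_ to _≟ᵇ_)
open import Data.Empty using (⊥; ⊥-elim)
open import Data.Fin using (Fin; zero; suc; _≟_; toℕ; fromℕ; inject₁)
open import Data.Fin.Properties using (all?; toℕ-injective)
open import Data.Fin.Subset.Properties using (anySubset?)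
open import Data.Nat using (ℕ; zero; suc; _+_; _*_; _≤_; _<_; _≤?_; _<?_; _<ᵇ_; z≤n; s≤s; s≤s⁻¹)
open import Data.Nat.Properties hiding (_≟_)
open import Data.Nat.Tactic.RingSolver using (solve-∀)
open import Data.Product using (Σ; ∃; _×_; _,_; proj₁; proj₂)
open import Data.Sum using (_⊎_; inj₁; inj₂; [_,_]′)
open import Data.Vec using (lookup; tabulate)
open import Data.Vec.Properties using (lookup∘tabulate)
open import Function using (_∘_; id)
open import Relation.Nullary using (¬_; Dec; yes; no; does)
open import Relation.Nullary.Decidable using (_→-dec_; _×-dec_; _⊎-dec_; ¬?; dec-true; dec-false)
open import Relation.Binary using (tri<; tri≈; tri>)
open import Relation.Binary.PropositionalEquality using (_≡_; _≢_; refl; sym; trans; cong; cong₂; subst)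

-- The obstacle is a contraction of `xy` that creates a violator `Z`. If y lies in `Z`, adding x
-- gives a rigid set of the original graph. Otherwise sparseness forces x and y into N(Z), and
-- |N(Z)| may be as large as |S|; for such a `Z` only one excess edge is known, where two are
-- wanted. If x and y have the same role, a solution in the contraction lifts. If they have
-- different roles, a common neighbour of x and y in `Z` supplies the second edge, because
-- contraction merges two edges there. If there is none, this absence is carried along as the
-- hypothesis `Bonus`, and the induction has to cover that case as well. A contraction that destroys
-- the bonus must then leave two excess edges, so some edges are only known to lie in one triangle
-- less, and the degree count near a vertex of small degree must tolerate that. The excess 2
-- reflects the edge b₁b₂, which is not added to 𝒢/𝒳: the roots span (m+1)(m+2)/2 edges, less one if
-- b₁b₂ is absent, and that edge is returned to the bound on ρ. If b₁b₂ is present, an excess of one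
-- edge suffices.

infix 4 _∈_ _∉_ _⊆_
infixr 6 _∩_
infixr 5 _∪_
infixl 6 _∖_

-- Vertex sets as Boolean predicates

_∈_ _∉_ : ∀ {n} → Fin n → VSet n → Set
v ∈ X = X v ≡ true
v ∉ X = X v ≡ false

_⊆_ : ∀ {n} → VSet n → VSet n → Set
X ⊆ Y = ∀ v → v ∈ X → v ∈ Y

_∪_ _∩_ _∖_ : ∀ {n} → VSet n → VSet n → VSet n
(X ∪ Y) v = X v ∨ Y v
(X ∩ Y) v = X v ∧ Y v
(X ∖ Y) v = X v ∧ not (Y v)

⁅_⁆ : ∀ {n} → Fin n → VSet n
⁅ x ⁆ v = v == x

∅ : ∀ {n} → VSet n
∅ _ = false

true≢false : ∀ {b} → b ≡ true → b ≡ false → ⊥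
true≢false refl ()

absurd : ∀ {A : Set} {b} → b ≡ true → b ≡ false → A
absurd p q = ⊥-elim (true≢false p q)

bool : ∀ b → b ≡ true ⊎ b ≡ false
bool true  = inj₁ refl
bool false = inj₂ refl

∉-intro : ∀ {b} → ¬ (b ≡ true) → b ≡ false
∉-intro {true}  ¬p = ⊥-elim (¬p refl)
∉-intro {false} ¬p = refl

∧-intro : ∀ {a b} → a ≡ true → b ≡ true → a ∧ b ≡ true
∧-intro refl refl = refl

∧-elim : ∀ a {b} → a ∧ b ≡ true → a ≡ true × b ≡ true
∧-elim true p = refl , p

∨-introˡ : ∀ {a b} → a ≡ true → a ∨ b ≡ true
∨-introˡ refl = refl

∨-introʳ : ∀ a {b} → b ≡ true → a ∨ b ≡ true
∨-introʳ true  p = refl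
∨-introʳ false p = p

∨-elim : ∀ a {b} → a ∨ b ≡ true → a ≡ true ⊎ b ≡ true
∨-elim true  p = inj₁ refl
∨-elim false p = inj₂ p

∨-false : ∀ {a b} → a ≡ false → b ≡ false → a ∨ b ≡ false
∨-false refl refl = refl

not-intro : ∀ {a} → a ≡ false → not a ≡ true
not-intro refl = refl

not-elim : ∀ a → not a ≡ true → a ≡ false
not-elim false p = refl

does⇒ : ∀ {P : Set} (P? : Dec P) → does P? ≡ true → P
does⇒ (yes p) _ = p

∖-intro : ∀ {n} (X Y : VSet n) {v} → v ∈ X → v ∉ Y → v ∈ X ∖ Y
∖-intro X Y p q = ∧-intro p (not-intro q)

∖-elim : ∀ {n} (X Y : VSet n) {v} → v ∈ X ∖ Y → v ∈ X × v ∉ Y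
∖-elim X Y {v} p with ∧-elim (X v) p
... | q , r = q , not-elim (Y v) r

==-intro : ∀ {n} {i j : Fin n} → i ≡ j → (i == j) ≡ true
==-intro {i = i} {j} p = dec-true (i ≟ j) p

==-elim : ∀ {n} (i j : Fin n) → (i == j) ≡ true → i ≡ j
==-elim i j = does⇒ (i ≟ j)

==-false : ∀ {n} {i j : Fin n} → i ≢ j → (i == j) ≡ false
==-false {i = i} {j} p = dec-false (i ≟ j) p

∈∉⇒≢ : ∀ {n} (X : VSet n) {u v} → u ∈ X → v ∉ X → u ≢ v
∈∉⇒≢ X p q refl = true≢false p q

any-intro : ∀ {k} (f : Fin k → Bool) i → f i ≡ true → anyᵇ f ≡ true
any-intro f zero    p = ∨-introˡ p
any-intro f (suc i) p = ∨-introʳ (f zero) (any-intro (f ∘ suc) i p)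

any-elim : ∀ {k} (f : Fin k → Bool) → anyᵇ f ≡ true → ∃ λ i → f i ≡ true
any-elim {suc k} f p with ∨-elim (f zero) p
... | inj₁ q = zero , q
... | inj₂ q with any-elim (f ∘ suc) q
...   | i , r = suc i , r

any-false : ∀ {k} (f : Fin k → Bool) → anyᵇ f ≡ false → ∀ i → f i ≡ false
any-false f p i = ∉-intro λ q → true≢false (any-intro f i q) p

∈-Nbd : ∀ {n} (G : Graph n) (X : VSet n) {u v} → v ∉ X → u ∈ X → Adj G u v → v ∈ Nbd G X
∈-Nbd G X {u} v∉X u∈X uv = ∧-intro (not-intro v∉X) (any-intro _ u (∧-intro u∈X uv))

Nbd-elim : ∀ {n} (G : Graph n) (X : VSet n) {v} → v ∈ Nbd G X → v ∉ X × ∃ λ u → u ∈ X × Adj G u v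
Nbd-elim G X {v} p with ∧-elim (not (X v)) p
... | q , r with any-elim _ r
...   | u , s = not-elim (X v) q , u , ∧-elim (X u) s

Adj-sym : ∀ {n} (G : Graph n) {u v} → Adj G u v → Adj G v u
Adj-sym G {u} {v} p = trans (adj-sym G v u) p

Adj-≢ : ∀ {n} (G : Graph n) {u v} → Adj G u v → u ≢ v
Adj-≢ G p refl = true≢false p (adj-irrefl G _)

-- Finite sums and cardinalities

𝟙 : Bool → ℕ
𝟙 true  = 1
𝟙 false = 0

𝟙≤1 : ∀ b → 𝟙 b ≤ 1
𝟙≤1 true  = ≤-refl
𝟙≤1 false = z≤n

𝟙-mono : ∀ {a b} → (a ≡ true → b ≡ true) → 𝟙 a ≤ 𝟙 b
𝟙-mono {false} f = z≤n
𝟙-mono {true}  f rewrite f refl = ≤-refl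

Σ-mono : ∀ {n} {f g : Fin n → ℕ} → (∀ i → f i ≤ g i) → sumFin f ≤ sumFin g
Σ-mono {zero}  h = z≤n
Σ-mono {suc n} h = +-mono-≤ (h zero) (Σ-mono (h ∘ suc))

Σ-cong : ∀ {n} {f g : Fin n → ℕ} → (∀ i → f i ≡ g i) → sumFin f ≡ sumFin g
Σ-cong {zero}  h = refl
Σ-cong {suc n} h = cong₂ _+_ (h zero) (Σ-cong (h ∘ suc))

+-swap : ∀ a b c d → (a + b) + (c + d) ≡ (a + c) + (b + d)
+-swap = solve-∀

Σ-+ : ∀ {n} (f g : Fin n → ℕ) → sumFin (λ i → f i + g i) ≡ sumFin f + sumFin g
Σ-+ {zero}  f g = refl
Σ-+ {suc n} f g = trans (cong (f zero + g zero +_) (Σ-+ (f ∘ suc) (g ∘ suc))) (+-swap (f zero) (g zero) _ _)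

Σ-0 : ∀ n → sumFin {n} (λ _ → 0) ≡ 0
Σ-0 zero    = refl
Σ-0 (suc n) = Σ-0 n

Σ-* : ∀ {n} k (f : Fin n → ℕ) → sumFin (λ i → k * f i) ≡ k * sumFin f
Σ-* {zero}  k f = sym (*-zeroʳ k)
Σ-* {suc n} k f = trans (cong (k * f zero +_) (Σ-* k (f ∘ suc))) (sym (*-distribˡ-+ k (f zero) _))

Σ-swap : ∀ {m n} (f : Fin m → Fin n → ℕ) → sumFin (λ i → sumFin (f i)) ≡ sumFin (λ j → sumFin λ i → f i j)
Σ-swap {zero} {n} f = sym (Σ-0 n)
Σ-swap {suc m} f = trans (cong (sumFin (f zero) +_) (Σ-swap (f ∘ suc)))
                         (sym (Σ-+ (f zero) (λ j → sumFin λ i → f (suc i) j)))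

Σ-single : ∀ {n} (x : Fin n) (g : Fin n → ℕ) → sumFin (λ v → 𝟙 (v == x) * g v) ≡ g x
Σ-single {suc n} zero g = trans (cong (g zero + 0 +_) (Σ-0 n)) (trans (+-identityʳ _) (+-identityʳ _))
Σ-single {suc n} (suc x) g = trans (Σ-cong λ v → cong (λ b → 𝟙 b * g (suc v)) (==-suc v x)) (Σ-single x (g ∘ suc))
  where
  ==-suc : ∀ {n} (u v : Fin n) → (suc u == suc v) ≡ (u == v)
  ==-suc u v with u ≟ v
  ... | yes p = refl
  ... | no  p = refl

# : ∀ {n} → VSet n → ℕ
# X = sumFin (𝟙 ∘ X)

countᵇ≡# : ∀ {n} (X : VSet n) → countᵇ X ≡ # X
countᵇ≡# {zero}  X = refl
countᵇ≡# {suc n} X with X zero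
... | true  = cong suc (countᵇ≡# (X ∘ suc))
... | false = countᵇ≡# (X ∘ suc)

#-mono : ∀ {n} (X Y : VSet n) → X ⊆ Y → # X ≤ # Y
#-mono X Y h = Σ-mono λ v → 𝟙-mono (h v)

#-cong : ∀ {n} {X Y : VSet n} → (∀ v → X v ≡ Y v) → # X ≡ # Y
#-cong h = Σ-cong λ v → cong 𝟙 (h v)

#-∅ : ∀ {n} {X : VSet n} → (∀ v → v ∉ X) → # X ≡ 0
#-∅ {n} h = trans (#-cong h) (Σ-0 n)

#-single : ∀ {n} (x : Fin n) → # ⁅ x ⁆ ≡ 1
#-single x = trans (Σ-cong λ v → sym (*1 (𝟙 (v == x)))) (Σ-single x (λ _ → 1))
  where
  *1 : ∀ a → a * 1 ≡ a
  *1 = solve-∀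

#-++ : ∀ {n} (X Y : VSet n) → sumFin (λ v → 𝟙 (X v) + 𝟙 (Y v)) ≡ # X + # Y
#-++ X Y = Σ-+ (𝟙 ∘ X) (𝟙 ∘ Y)

#-∪-≤ : ∀ {n} (X Y Z : VSet n) → (∀ v → v ∈ Z → v ∈ X ⊎ v ∈ Y) → # Z ≤ # X + # Y
#-∪-≤ X Y Z h = ≤-trans (Σ-mono pt) (≤-reflexive (#-++ X Y))
  where
  pt : ∀ v → 𝟙 (Z v) ≤ 𝟙 (X v) + 𝟙 (Y v)
  pt v with bool (Z v)
  ... | inj₂ q rewrite q = z≤n
  ... | inj₁ q with h v q
  ...   | inj₁ r rewrite q | r = s≤s z≤n
  ...   | inj₂ r rewrite q | r = m≤n+m 1 _

#-∪-≥ : ∀ {n} (X Y Z : VSet n) → X ⊆ Z → Y ⊆ Z → (∀ v → v ∈ X → v ∉ Y) → # X + # Y ≤ # Z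
#-∪-≥ X Y Z p q d = ≤-trans (≤-reflexive (sym (#-++ X Y))) (Σ-mono pt)
  where
  pt : ∀ v → 𝟙 (X v) + 𝟙 (Y v) ≤ 𝟙 (Z v)
  pt v with bool (X v)
  ... | inj₁ r rewrite r | d v r | p v r = ≤-refl
  ... | inj₂ r rewrite r = 𝟙-mono (q v)

#-∈ : ∀ {n} (X : VSet n) x → x ∈ X → 1 ≤ # X
#-∈ X x p = ≤-trans (≤-reflexive (sym (#-single x)))
  (#-mono ⁅ x ⁆ X λ v q → subst (_∈ X) (sym (==-elim v x q)) p)

#-< : ∀ {n} (X Y : VSet n) y → X ⊆ Y → y ∈ Y → y ∉ X → # X < # Y
#-< X Y y p y∈Y y∉X = ≤-trans (≤-reflexive (trans (+-comm 1 (# X)) (cong (# X +_) (sym (#-single y)))))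
  (#-∪-≥ X ⁅ y ⁆ Y p (λ v q → subst (_∈ Y) (sym (==-elim v y q)) y∈Y)
     (λ v q → ==-false {i = v} (∈∉⇒≢ X q y∉X)))

#-pos : ∀ {n} (X : VSet n) → 1 ≤ # X → ∃ λ v → v ∈ X
#-pos {suc n} X p with bool (X zero)
... | inj₁ q = zero , q
... | inj₂ q with #-pos (X ∘ suc) (subst (λ b → 1 ≤ 𝟙 b + # (X ∘ suc)) q p)
...   | v , r = suc v , r

#-⊆-≡ : ∀ {n} (X Y : VSet n) → X ⊆ Y → # Y ≤ # X → Y ⊆ X
#-⊆-≡ X Y p q v r with bool (X v)
... | inj₁ s = s
... | inj₂ s = ⊥-elim (<⇒≱ (#-< X Y v p r s) q)

-- Linear arithmetic by certificate: `L ≤ R` is the sum of the hypotheses, `d` the slack, and the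
-- equation is left to the ring solver.
lin : ∀ {L R} a b d → L ≤ R → a + R + d ≡ b + L → a ≤ b
lin {L} {R} a b d h e = +-cancelʳ-≤ L a b (begin
  a + L      ≤⟨ +-mono-≤ (≤-refl {a}) h ⟩
  a + R      ≤⟨ m≤m+n (a + R) d ⟩
  a + R + d  ≡⟨ e ⟩
  b + L      ∎)
  where open ≤-Reasoning

⊆? : ∀ {n} (X Y : VSet n) → Dec (X ⊆ Y)
⊆? X Y = all? λ v → (X v ≟ᵇ true) →-dec (Y v ≟ᵇ true)

-- The search runs over bit vectors while sets are functions, hence the demand that `P` respect
-- pointwise equality.
searchVSet : ∀ {n} {P : VSet n → Set} → (∀ {X Y} → (∀ v → X v ≡ Y v) → P X → P Y) →
             (∀ X → Dec (P X)) → (∃ λ X → P X) ⊎ (∀ X → ¬ P X)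
searchVSet resp P? with anySubset? (λ p → P? (lookup p))
... | yes (p , q) = inj₁ (lookup p , q)
... | no ¬q = inj₂ λ X q → ¬q (tabulate X , resp (λ v → sym (lookup∘tabulate X v)) q)

-- Sums over ordered pairs

ΣΣ : ∀ {n} → (Fin n → Fin n → ℕ) → ℕ
ΣΣ f = sumFin λ u → sumFin (f u)

ΣΣ-mono : ∀ {n} {f g : Fin n → Fin n → ℕ} → (∀ u v → f u v ≤ g u v) → ΣΣ f ≤ ΣΣ g
ΣΣ-mono h = Σ-mono λ u → Σ-mono (h u)

ΣΣ-cong : ∀ {n} {f g : Fin n → Fin n → ℕ} → (∀ u v → f u v ≡ g u v) → ΣΣ f ≡ ΣΣ g
ΣΣ-cong h = Σ-cong λ u → Σ-cong (h u)

ΣΣ-+ : ∀ {n} (f g : Fin n → Fin n → ℕ) → ΣΣ (λ u v → f u v + g u v) ≡ ΣΣ f + ΣΣ g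
ΣΣ-+ f g = trans (Σ-cong λ u → Σ-+ (f u) (g u)) (Σ-+ (λ u → sumFin (f u)) (λ u → sumFin (g u)))

ΣΣ-row : ∀ {n} (y : Fin n) (g : Fin n → ℕ) → ΣΣ (λ u v → 𝟙 (u == y) * g v) ≡ sumFin g
ΣΣ-row y g = trans (Σ-cong λ u → Σ-* (𝟙 (u == y)) g) (Σ-single y (λ _ → sumFin g))

ΣΣ-point : ∀ {n} (a b : Fin n) → ΣΣ (λ u v → 𝟙 (u == a) * 𝟙 (v == b)) ≡ 1
ΣΣ-point a b = trans (ΣΣ-row a (λ v → 𝟙 (v == b))) (#-single b)

-- Counts an edge from its smaller end, as `eRootedQuot` does. Comparisons between graphs are easier
-- on the symmetric double sum, which is twice this.
half : ∀ {n} → (Fin n → Fin n → Bool) → ℕ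
half f = sumFin λ u → # λ v → (toℕ u <ᵇ toℕ v) ∧ f u v

<ᵇ-asym : ∀ {n} (u v : Fin n) → u ≢ v → 𝟙 (toℕ u <ᵇ toℕ v) + 𝟙 (toℕ v <ᵇ toℕ u) ≡ 1
<ᵇ-asym u v p with <-cmp (toℕ u) (toℕ v)
... | tri< a _ c rewrite dec-true (toℕ u <? toℕ v) a | dec-false (toℕ v <? toℕ u) c = refl
... | tri≈ _ b _ = ⊥-elim (p (toℕ-injective b))
... | tri> a _ c rewrite dec-false (toℕ u <? toℕ v) a | dec-true (toℕ v <? toℕ u) c = refl

ΣΣ-half : ∀ {n} (f : Fin n → Fin n → Bool) → (∀ u v → f u v ≡ f v u) → (∀ u → f u u ≡ false) →
          ΣΣ (λ u v → 𝟙 (f u v)) ≡ half f + half f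
ΣΣ-half f fsym firr = trans (ΣΣ-cong pt) (trans (ΣΣ-+ lt gt) (cong (half f +_) (trans (Σ-swap gt) (ΣΣ-cong λ u v → cong (λ b → 𝟙 ((toℕ u <ᵇ toℕ v) ∧ b)) (fsym v u)))))
  where
  lt gt : _ → _ → ℕ
  lt u v = 𝟙 ((toℕ u <ᵇ toℕ v) ∧ f u v)
  gt u v = 𝟙 ((toℕ v <ᵇ toℕ u) ∧ f u v)
  ∧-false : ∀ a → a ∧ false ≡ false
  ∧-false true  = refl
  ∧-false false = refl
  ∧-true : ∀ a → a ∧ true ≡ a
  ∧-true true  = refl
  ∧-true false = refl
  pt : ∀ u v → 𝟙 (f u v) ≡ lt u v + gt u v
  pt u v with bool (f u v)
  ... | inj₂ q rewrite q | ∧-false (toℕ u <ᵇ toℕ v) | ∧-false (toℕ v <ᵇ toℕ u) = refl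
  ... | inj₁ q rewrite q | ∧-true (toℕ u <ᵇ toℕ v) | ∧-true (toℕ v <ᵇ toℕ u) =
    sym (<ᵇ-asym u v λ { refl → true≢false q (firr u) })

-- Edges touching a set

touch : ∀ {n} → Graph n → VSet n → Fin n → Fin n → Bool
touch G X u v = adj G u v ∧ (X u ∨ X v)

ρ : ∀ {n} → Graph n → VSet n → ℕ
ρ G X = half (touch G X)

touch-sym : ∀ {n} (G : Graph n) X u v → touch G X u v ≡ touch G X v u
touch-sym G X u v = cong₂ _∧_ (adj-sym G u v) (∨-comm (X u) (X v))

touch-irrefl : ∀ {n} (G : Graph n) X u → touch G X u u ≡ false
touch-irrefl G X u rewrite adj-irrefl G u = refl

ΣΣ-touch : ∀ {n} (G : Graph n) X → ΣΣ (λ u v → 𝟙 (touch G X u v)) ≡ ρ G X + ρ G X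
ΣΣ-touch G X = ΣΣ-half (touch G X) (touch-sym G X) (touch-irrefl G X)

double-≤ : ∀ {a b} → a + a ≤ b + b → a ≤ b
double-≤ {a} {b} h with a ≤? b
... | yes p = p
... | no ¬p = ⊥-elim (<⇒≱ (+-mono-< (≰⇒> ¬p) (≰⇒> ¬p)) h)

ρ-mono : ∀ {n} {G G' : Graph n} {X X' : VSet n} →
         (∀ u v → touch G X u v ≡ true → touch G' X' u v ≡ true) → ρ G X ≤ ρ G' X'
ρ-mono h = Σ-mono λ u → #-mono _ _ λ v p →
  let q , r = ∧-elim (toℕ u <ᵇ toℕ v) p in ∧-intro q (h u v r)

touch-elim : ∀ {n} (G : Graph n) X {u v} → touch G X u v ≡ true → Adj G u v × (u ∈ X ⊎ v ∈ X)
touch-elim G X {u} {v} p with ∧-elim (adj G u v) p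
... | q , r = q , ∨-elim (X u) r

touch-intro : ∀ {n} (G : Graph n) X {u v} → Adj G u v → (u ∈ X ⊎ v ∈ X) → touch G X u v ≡ true
touch-intro G X p (inj₁ q) = ∧-intro p (∨-introˡ q)
touch-intro G X {u} p (inj₂ q) = ∧-intro p (∨-introʳ (X u) q)

ρ-cong : ∀ {n} (G : Graph n) {X Y : VSet n} → (∀ v → X v ≡ Y v) → ρ G X ≡ ρ G Y
ρ-cong G h = Σ-cong λ u → #-cong λ v → cong₂ (λ a b → (toℕ u <ᵇ toℕ v) ∧ (adj G u v ∧ (a ∨ b))) (h u) (h v)

Nbd-cong : ∀ {n} (G : Graph n) {X Y : VSet n} → (∀ v → X v ≡ Y v) → ∀ v → Nbd G X v ≡ Nbd G Y v
Nbd-cong G {X} {Y} h v = cong₂ (λ a b → not a ∧ b) (h v) (any-cong λ u → cong (_∧ adj G u v) (h u))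
  where
  any-cong : ∀ {k} {f g : Fin k → Bool} → (∀ i → f i ≡ g i) → anyᵇ f ≡ anyᵇ g
  any-cong {zero}  e = refl
  any-cong {suc k} e = cong₂ _∨_ (e zero) (any-cong (e ∘ suc))

ρ-∅ : ∀ {n} (G : Graph n) {X : VSet n} → 1 ≤ ρ G X → ∃ λ v → v ∈ X
ρ-∅ G {X} p with #-pos-Σ _ p
  where
  #-pos-Σ : ∀ {n} (f : Fin n → ℕ) → 1 ≤ sumFin f → ∃ λ i → 1 ≤ f i
  #-pos-Σ {suc n} f p with f zero in eq
  ... | suc _ = zero , subst (1 ≤_) (sym eq) (s≤s z≤n)
  ... | 0 with #-pos-Σ (f ∘ suc) p
  ...   | i , q = suc i , q
... | u , q with #-pos _ q
...   | v , r with touch-elim G X {u} {v} (proj₂ (∧-elim (toℕ u <ᵇ toℕ v) r))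
...     | _ , inj₁ s = u , s
...     | _ , inj₂ s = v , s

-- Contraction, vertex deletion and elimination

-- All operations keep the vertex set `Fin n`: removed vertices merely become isolated, so vertex
-- sets need no transport between graphs.
mkGraph : ∀ {n} {P : Fin n → Fin n → Set} → (∀ u v → Dec (P u v)) →
          (∀ {u v} → P u v → P v u) → (∀ {u} → ¬ P u u) → Graph n
mkGraph P? psym pirr = record
  { adj        = λ u v → does (P? u v)
  ; adj-sym    = λ u v → both (P? u v) (P? v u) psym psym
  ; adj-irrefl = λ u → dec-false (P? u u) pirr
  }
  where
  both : ∀ {A B : Set} (a? : Dec A) (b? : Dec B) → (A → B) → (B → A) → does a? ≡ does b?
  both (yes a) b? f g = sym (dec-true b? (f a))
  both (no ¬a) b? f g = sym (dec-false b? (¬a ∘ g))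

module _ {n : ℕ} (G : Graph n) where

  private
    Adj? : ∀ u v → Dec (Adj G u v)
    Adj? u v = adj G u v ≟ᵇ true

  -- The edge xy is contracted into y.
  Contract : Fin n → Fin n → Fin n → Fin n → Set
  Contract x y u v = u ≢ x × v ≢ x × u ≢ v × (Adj G u v ⊎ (u ≡ y × Adj G x v) ⊎ (v ≡ y × Adj G u x))

  contract? : ∀ x y u v → Dec (Contract x y u v)
  contract? x y u v = ¬? (u ≟ x) ×-dec ¬? (v ≟ x) ×-dec ¬? (u ≟ v) ×-dec
    (Adj? u v ⊎-dec ((u ≟ y) ×-dec Adj? x v) ⊎-dec ((v ≟ y) ×-dec Adj? u x))

  contract : Fin n → Fin n → Graph n
  contract x y = mkGraph (contract? x y)
    (λ { (a , b , c , inj₁ d) → b , a , c ∘ sym , inj₁ (Adj-sym G d)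
       ; (a , b , c , inj₂ (inj₁ (d , e))) → b , a , c ∘ sym , inj₂ (inj₂ (d , Adj-sym G e))
       ; (a , b , c , inj₂ (inj₂ (d , e))) → b , a , c ∘ sym , inj₂ (inj₁ (d , Adj-sym G e)) })
    (λ (_ , _ , c , _) → c refl)

  contract-elim : ∀ x y {u v} → Adj (contract x y) u v → Contract x y u v
  contract-elim x y {u} {v} = does⇒ (contract? x y u v)

  contract-intro : ∀ {x y u v} → Contract x y u v → Adj (contract x y) u v
  contract-intro {x} {y} {u} {v} = dec-true (contract? x y u v)

  Delete : Fin n → Fin n → Fin n → Set
  Delete s u v = u ≢ s × v ≢ s × Adj G u v

  delete? : ∀ s u v → Dec (Delete s u v)
  delete? s u v = ¬? (u ≟ s) ×-dec ¬? (v ≟ s) ×-dec Adj? u v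

  delete : Fin n → Graph n
  delete s = mkGraph (delete? s) (λ (a , b , c) → b , a , Adj-sym G c) (λ (_ , _ , c) → Adj-≢ G c refl)

  delete-elim : ∀ s {u v} → Adj (delete s) u v → Delete s u v
  delete-elim s {u} {v} = does⇒ (delete? s u v)

  delete-intro : ∀ {s u v} → Delete s u v → Adj (delete s) u v
  delete-intro {s} {u} {v} = dec-true (delete? s u v)

  -- G / {Y}
  Eliminate : VSet n → Fin n → Fin n → Set
  Eliminate Y u v = u ∉ Y × v ∉ Y × u ≢ v × (Adj G u v ⊎ (u ∈ Nbd G Y × v ∈ Nbd G Y))

  eliminate? : ∀ Y u v → Dec (Eliminate Y u v)
  eliminate? Y u v = (Y u ≟ᵇ false) ×-dec (Y v ≟ᵇ false) ×-dec ¬? (u ≟ v) ×-dec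
    (Adj? u v ⊎-dec ((Nbd G Y u ≟ᵇ true) ×-dec (Nbd G Y v ≟ᵇ true)))

  eliminate : VSet n → Graph n
  eliminate Y = mkGraph (eliminate? Y)
    (λ { (a , b , c , inj₁ d) → b , a , c ∘ sym , inj₁ (Adj-sym G d)
       ; (a , b , c , inj₂ (d , e)) → b , a , c ∘ sym , inj₂ (e , d) })
    (λ (_ , _ , c , _) → c refl)

  eliminate-elim : ∀ Y {u v} → Adj (eliminate Y) u v → Eliminate Y u v
  eliminate-elim Y {u} {v} = does⇒ (eliminate? Y u v)

  eliminate-intro : ∀ {Y u v} → Eliminate Y u v → Adj (eliminate Y) u v
  eliminate-intro {Y} {u} {v} = dec-true (eliminate? Y u v)

-- Walks and feasibility

data Walk {n} (G : Graph n) (D : VSet n) : Fin n → Fin n → Set where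
  nil  : ∀ {u} → u ∈ D → Walk G D u u
  cons : ∀ {u w v} → u ∈ D → Adj G u w → Walk G D w v → Walk G D u v

walk-start : ∀ {n} {G : Graph n} {D u v} → Walk G D u v → u ∈ D
walk-start (nil p)      = p
walk-start (cons p _ _) = p

infixr 5 _++_
_++_ : ∀ {n} {G : Graph n} {D u v w} → Walk G D u v → Walk G D v w → Walk G D u w
nil _ ++ q      = q
cons a e p ++ q = cons a e (p ++ q)

walk-bind : ∀ {n} {G G' : Graph n} {D D'} → D ⊆ D' →
            (∀ {u v} → u ∈ D → v ∈ D → Adj G u v → Walk G' D' u v) →
            ∀ {u v} → Walk G D u v → Walk G' D' u v
walk-bind s f (nil p)      = nil (s _ p)
walk-bind s f (cons p e w) = f p (walk-start w) e ++ walk-bind s f w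

walk-mono : ∀ {n} {G : Graph n} {D D'} → D ⊆ D' → ∀ {u v} → Walk G D u v → Walk G D' u v
walk-mono s = walk-bind s λ p q e → cons (s _ p) e (nil (s _ q))

reverse : ∀ {n} {G : Graph n} {D u v} → Walk G D u v → Walk G D v u
reverse (nil p) = nil p
reverse {G = G} (cons p e w) = reverse w ++ cons (walk-start w) (Adj-sym G e) (nil p)

-- The case `a = a'` also yields `A ⊆ D`, since a walk starts inside `D`.
Linked : ∀ {n} → Graph n → VSet n → VSet n → Set
Linked G D A = ∀ {a a'} → a ∈ A → a' ∈ A → Walk G D a a'

-- B stands for {b₁, b₂}, S ∖ B for the aᵢ, and D for the vertices that may be used; the path avoids C.
Feas : ∀ {n} → Graph n → VSet n → VSet n → VSet n → Set
Feas G D S B = ∃ λ C → Linked G (D ∩ C) (S ∖ B) × Linked G (D ∖ C) B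

AtMost2 : ∀ {n} → VSet n → Set
AtMost2 {n} B = ∃ λ b → ∃ λ b' → ∀ v → v ∈ B → v ≡ b ⊎ v ≡ b'

-- A terminal that the smaller graph has lost re-enters through one edge to a surviving terminal.
linked-extend : ∀ {n} {G G' : Graph n} {D D' A A'} →
  (∀ {u v} → Walk G D u v → Walk G' D' u v) →
  (∀ a → a ∈ A' → a ∈ A ⊎ (a ∈ D' × ∃ λ b → b ∈ A × Adj G' a b)) →
  Linked G D A → Linked G' D' A'
linked-extend {G' = G'} {D' = D'} {A} {A'} lift h l {a} {a'} p q =
  let b , r , w = reach p ; b' , r' , w' = reach q in w ++ lift (l r r') ++ reverse w'
  where
  reach : ∀ {a} → a ∈ A' → ∃ λ b → b ∈ A × Walk G' D' a b
  reach {a} p with h a p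
  ... | inj₁ q = a , q , nil (walk-start (lift (l q q)))
  ... | inj₂ (d , b , q , e) = b , q , cons d e (nil (walk-start (lift (l q q))))

linked-pair : ∀ {n} {G : Graph n} {D B b b'} → (∀ v → v ∈ B → v ≡ b ⊎ v ≡ b') →
              Walk G D b b' → Linked G D B
linked-pair {G = G} {D} {b = b} h w {a} {a'} p q = reverse (to (h a p)) ++ to (h a' q)
  where
  to : ∀ {a} → a ≡ b ⊎ a ≡ _ → Walk G D b a
  to (inj₁ refl) = nil (walk-start w)
  to (inj₂ refl) = w

linked-star : ∀ {n} (G : Graph n) {D A} x → x ∈ D → A ⊆ D →
              (∀ a → a ∈ A → a ≡ x ⊎ Adj G a x) → Linked G D A
linked-star G {D} {A} x x∈D s h p q = to p ++ reverse (to q)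
  where
  to : ∀ {a} → a ∈ A → Walk G D a x
  to {a} p with h a p
  ... | inj₁ refl = nil x∈D
  ... | inj₂ e = cons (s a p) e (nil x∈D)

∩-mono : ∀ {n} (D : VSet n) {D'} C → D ⊆ D' → D ∩ C ⊆ D' ∩ C
∩-mono D C s v p = let q , r = ∧-elim (D v) p in ∧-intro (s v q) r

∖-monoˡ : ∀ {n} (D : VSet n) {D'} C → D ⊆ D' → D ∖ C ⊆ D' ∖ C
∖-monoˡ D C s v p = let q , r = ∧-elim (D v) p in ∧-intro (s v q) r

feas-mono : ∀ {n} {G G' : Graph n} {D D' S S' B B'} →
  (∀ {u v} → u ∈ D → v ∈ D → Adj G u v → Adj G' u v) → D ⊆ D' → S' ∖ B' ⊆ S ∖ B → B' ⊆ B →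
  Feas G D S B → Feas G' D' S' B'
feas-mono {G = G} {G'} {D} {D'} f s t b (C , l , m) = C
  , (λ p q → lift (∩-mono D C s) (λ v r → proj₁ (∧-elim (D v) r)) (l (t _ p) (t _ q)))
  , (λ p q → lift (∖-monoˡ D C s) (λ v r → proj₁ (∧-elim (D v) r)) (m (b _ p) (b _ q)))
  where
  lift : ∀ {E E'} → E ⊆ E' → E ⊆ D → ∀ {u v} → Walk G E u v → Walk G' E' u v
  lift s r = walk-bind s λ p q e → cons (s _ p) (f (r _ p) (r _ q) e) (nil (s _ q))

-- Lifting from a contraction

contract-walk : ∀ {n} (G : Graph n) {x y E E'} → Adj G x y → E ⊆ E' → (y ∈ E → x ∈ E') →
                ∀ {u v} → Walk (contract G x y) E u v → Walk G E' u v
contract-walk G {x} {y} {E} {E'} xy s t = walk-bind s step'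
  where
  step' : ∀ {u v} → u ∈ E → v ∈ E → Adj (contract G x y) u v → Walk G E' u v
  step' p q e with contract-elim G x y e
  ... | _ , _ , _ , inj₁ uv = cons (s _ p) uv (nil (s _ q))
  ... | _ , _ , _ , inj₂ (inj₁ (refl , xv)) = cons (s _ p) (Adj-sym G xy) (cons (t p) xv (nil (s _ q)))
  ... | _ , _ , _ , inj₂ (inj₂ (refl , ux)) = cons (s _ p) ux (cons (t q) xy (nil (s _ q)))

-- The set `C` is pulled back along the map sending x to y, so that x joins the side of y; an edge
-- at y that came from x is replaced by a walk through x.
contract-feas : ∀ {n} (G : Graph n) {x y D D' S S' B B'} → Adj G x y →
  x ∉ D → D ⊆ D' → (y ∈ D → x ∈ D') →
  (∀ a → a ∈ S' ∖ B' → a ∈ S ∖ B ⊎ (a ≡ x × y ∈ S ∖ B)) →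
  (∀ b → b ∈ B' → b ∈ B ⊎ (b ≡ x × y ∈ B)) →
  Feas (contract G x y) D S B → Feas G D' S' B'
contract-feas {n} G {x} {y} {D} {D'} {S} {S'} {B} {B'} xy x∉D s t ra rb (C , l , m) =
  C ∘ φ , linked-extend (contract-walk G xy sA tA) (ext (S ∖ B) sA tA l ra) l
        , linked-extend (contract-walk G xy sB tB) (ext B sB tB m rb) m
  where
  φ : Fin n → Fin n
  φ u with u ≟ x
  ... | yes _ = y
  ... | no  _ = u
  φx : φ x ≡ y
  φx with x ≟ x
  ... | yes _ = refl
  ... | no ¬p = ⊥-elim (¬p refl)
  φu : ∀ {u} → u ∈ D → φ u ≡ u
  φu {u} p with u ≟ x
  ... | yes refl = absurd p x∉D
  ... | no _ = refl
  sA : D ∩ C ⊆ D' ∩ (C ∘ φ)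
  sA v p = let q , r = ∧-elim (D v) p in ∧-intro (s v q) (subst (_∈ C) (sym (φu q)) r)
  tA : y ∈ D ∩ C → x ∈ D' ∩ (C ∘ φ)
  tA p = let q , r = ∧-elim (D y) p in ∧-intro (t q) (subst (_∈ C) (sym φx) r)
  sB : D ∖ C ⊆ D' ∖ (C ∘ φ)
  sB v p = let q , r = ∖-elim D C p in ∖-intro D' (C ∘ φ) (s v q) (subst (_∉ C) (sym (φu q)) r)
  tB : y ∈ D ∖ C → x ∈ D' ∖ (C ∘ φ)
  tB p = let q , r = ∖-elim D C p in ∖-intro D' (C ∘ φ) (t q) (subst (_∉ C) (sym φx) r)
  ext : ∀ A {A' E E'} → E ⊆ E' → (y ∈ E → x ∈ E') → Linked (contract G x y) E A →
        (∀ a → a ∈ A' → a ∈ A ⊎ (a ≡ x × y ∈ A)) →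
        ∀ a → a ∈ A' → a ∈ A ⊎ (a ∈ E' × ∃ λ b → b ∈ A × Adj G a b)
  ext A s t l r a p with r a p
  ... | inj₁ q = inj₁ q
  ... | inj₂ (refl , q) = inj₂ (t (walk-start (l q q)) , y , q , xy)

-- Lifting from an elimination

-- Edges leaving a vertex outside `Z` are old, so the walk survives up to its first vertex in `Z`.
-- The clause `u ∈ Z → p ≡ u` is what later keeps the role of a root lying in N(Y).
first-hit : ∀ {n} {G G' : Graph n} {D} (Z : VSet n) →
  (∀ {u w} → u ∉ Z → Adj G' u w → Adj G u w) → ∀ {u v} → Walk G' D u v →
  Walk G (D ∖ Z) u v ⊎
  (∃ λ p → p ∈ Z × p ∈ D × Walk G ((D ∖ Z) ∪ ⁅ p ⁆) u p × (u ∈ Z → p ≡ u) × Walk G' D p v)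
first-hit {G = G} {D = D} Z f {u} w with bool (Z u)
... | inj₁ u∈Z = inj₂ (u , u∈Z , walk-start w , nil (∨-introʳ ((D ∖ Z) u) (==-intro {i = u} refl)) , (λ _ → refl) , w)
first-hit {D = D} Z f (nil p) | inj₂ u∉Z = inj₁ (nil (∖-intro D Z p u∉Z))
first-hit {D = D} Z f (cons p e w) | inj₂ u∉Z with first-hit Z f w
... | inj₁ w' = inj₁ (cons (∖-intro D Z p u∉Z) (f u∉Z e) w')
... | inj₂ (q , q∈Z , q∈D , w' , _ , rest) = inj₂ (q , q∈Z , q∈D
      , cons (∨-introˡ (∖-intro D Z p u∉Z)) (f u∉Z e) w' , (λ r → absurd r u∉Z) , rest)

walk-end : ∀ {n} {G : Graph n} {D u v} → Walk G D u v → v ∈ D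
walk-end w = walk-start (reverse w)

-- `AtMost2` bounds `B` only from above: a named vertex outside `B` is replaced by the other one, so
-- a singleton gives `b = b'`.
empty-or-pair : ∀ {n} (B : VSet n) → AtMost2 B →
  (∀ v → v ∉ B) ⊎ (∃ λ b → ∃ λ b' → b ∈ B × b' ∈ B × (∀ v → v ∈ B → v ≡ b ⊎ v ≡ b'))
empty-or-pair B (b , b' , h) with bool (B b) | bool (B b')
... | inj₁ p | inj₁ q = inj₂ (b , b' , p , q , h)
... | inj₁ p | inj₂ q = inj₂ (b , b , p , p , λ v r → [ inj₁ , (λ { refl → absurd r q }) ]′ (h v r))
... | inj₂ p | inj₁ q = inj₂ (b' , b' , q , q , λ v r → [ (λ { refl → absurd r p }) , inj₂ ]′ (h v r))
... | inj₂ p | inj₂ q = inj₁ λ v → ∉-intro λ r →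
  [ (λ { refl → true≢false r p }) , (λ { refl → true≢false r q }) ]′ (h v r)

closed : ∀ {n} → Graph n → VSet n → VSet n
closed G Y = Y ∪ Nbd G Y

pair : ∀ {n} → Fin n → Fin n → VSet n
pair p q = ⁅ p ⁆ ∪ ⁅ q ⁆

pair-elim : ∀ {n} (p q v : Fin n) → v ∈ pair p q → v ≡ p ⊎ v ≡ q
pair-elim p q v h with ∨-elim (v == p) h
... | inj₁ r = inj₁ (==-elim v p r)
... | inj₂ r = inj₂ (==-elim v q r)

pair-introˡ : ∀ {n} (p q : Fin n) → p ∈ pair p q
pair-introˡ p q = ∨-introˡ (==-intro {i = p} refl)

pair-introʳ : ∀ {n} (p q : Fin n) → q ∈ pair p q
pair-introʳ p q = ∨-introʳ (q == p) (==-intro {i = q} refl)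

Agree : ∀ {n} → VSet n → VSet n → VSet n → Set
Agree T B B' = ∀ v → v ∈ T → (v ∈ B → v ∈ B') × (v ∈ B' → v ∈ B)

-- The walk between the two vertices of B is rerouted through Y between its first and its last vertex in N(Y);
-- these two vertices are the role set B' on N(Y), and the new edges used inside C are replaced by walks through Y.
eliminate-feas : ∀ {n} (G : Graph n) {Y D T B} → Nbd G Y ⊆ D → (∀ v → v ∈ D → v ∉ Y) → AtMost2 B → B ⊆ T →
  (∀ B' → AtMost2 B' → B' ⊆ Nbd G Y → Agree (Nbd G Y ∩ T) B B' → Feas G (closed G Y) (Nbd G Y) B') →
  Feas (eliminate G Y) D T B → Feas G (D ∪ Y) T B
eliminate-feas {n} G {Y} {D} {T} {B} N⊆D D∌Y two B⊆T rigid (C , la , lb) = go (empty-or-pair B two)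
  where
  Z = Nbd G Y
  E = D ∖ C
  -- On N(Y) a vertex belongs to the new side if either partition puts it there. The vertices of
  -- `B'`, through which the walk of `B` passes, are put there by neither.
  big : VSet n → VSet n
  big C″ = (C ∩ D) ∪ (C″ ∩ closed G Y)

  Z∌Y : ∀ {v} → v ∈ Z → v ∉ Y
  Z∌Y p = proj₁ (Nbd-elim G Y p)

  old : ∀ {u w} → u ∉ Z → Adj (eliminate G Y) u w → Adj G u w
  old p e with eliminate-elim G Y e
  ... | _ , _ , _ , inj₁ q = q
  ... | _ , _ , _ , inj₂ (q , _) = absurd q p

  finish : ∀ B' → AtMost2 B' → B' ⊆ Z → (∀ v → v ∈ B' → v ∉ C) → Agree (Z ∩ T) B B' →
    (∀ C″ → (∀ v → v ∈ closed G Y → v ∉ C″ → v ∈ (D ∪ Y) ∖ big C″) → (∀ v → v ∈ B' → v ∉ C″) →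
       Linked G (closed G Y ∖ C″) B' → Linked G ((D ∪ Y) ∖ big C″) B) →
    Feas G (D ∪ Y) T B
  finish B' two' B'⊆Z B'∌C agree useB with rigid B' two' B'⊆Z agree
  ... | C″ , la″ , lb″ = big C″ , linkA , useB C″ region B'∌C″ lb″
    where
    B'∌C″ : ∀ v → v ∈ B' → v ∉ C″
    B'∌C″ v p = proj₂ (∖-elim (closed G Y) C″ (walk-start (lb″ p p)))
    Z∖B' : ∀ {v} → v ∈ Z → v ∉ B' → v ∈ C″
    Z∖B' {v} p q = proj₂ (∧-elim (closed G Y v) (walk-start (la″ (∖-intro Z B' p q) (∖-intro Z B' p q))))
    region : ∀ v → v ∈ closed G Y → v ∉ C″ → v ∈ (D ∪ Y) ∖ big C″
    region v p q with ∨-elim (Y v) p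
    ... | inj₁ v∈Y = ∖-intro (D ∪ Y) (big C″) (∨-introʳ (D v) v∈Y)
      (∉-intro λ r → [ (λ s → true≢false v∈Y (D∌Y v (proj₂ (∧-elim (C v) s))))
                         , (λ s → true≢false (proj₁ (∧-elim (C″ v) s)) q) ]′ (∨-elim ((C ∩ D) v) r))
    ... | inj₂ v∈Z with bool (B' v)
    ...   | inj₂ v∉B' = absurd (Z∖B' v∈Z v∉B') q
    ...   | inj₁ v∈B' = ∖-intro (D ∪ Y) (big C″) (∨-introˡ (N⊆D v v∈Z))
      (∉-intro λ r → [ (λ s → true≢false (proj₁ (∧-elim (C v) s)) (B'∌C v v∈B'))
                         , (λ s → true≢false (proj₁ (∧-elim (C″ v) s)) q) ]′ (∨-elim ((C ∩ D) v) r))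
    sub : D ∩ C ⊆ (D ∪ Y) ∩ big C″
    sub v p = let q , r = ∧-elim (D v) p in ∧-intro (∨-introˡ q) (∨-introˡ (∧-intro r q))
    sub″ : closed G Y ∩ C″ ⊆ (D ∪ Y) ∩ big C″
    sub″ v p with ∧-elim (closed G Y v) p
    ... | q , r = ∧-intro ([ ∨-introʳ (D v) , (λ s → ∨-introˡ (N⊆D v s)) ]′ (∨-elim (Y v) q))
                          (∨-introʳ ((C ∩ D) v) (∧-intro r q))
    inZ∖B' : ∀ {u} → u ∈ D ∩ C → u ∈ Z → u ∈ Z ∖ B'
    inZ∖B' {u} p q = ∖-intro Z B' q
      (∉-intro λ r → true≢false (proj₂ (∧-elim (D u) p)) (B'∌C u r))
    stepA : ∀ {u v} → u ∈ D ∩ C → v ∈ D ∩ C → Adj (eliminate G Y) u v → Walk G ((D ∪ Y) ∩ big C″) u v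
    stepA p q e with eliminate-elim G Y e
    ... | _ , _ , _ , inj₁ uv = cons (sub _ p) uv (nil (sub _ q))
    ... | _ , _ , _ , inj₂ (r , s) = walk-mono sub″ (la″ (inZ∖B' p r) (inZ∖B' q s))
    linkA : Linked G ((D ∪ Y) ∩ big C″) (T ∖ B)
    linkA p q = walk-bind sub stepA (la p q)

  avoiding : ∀ C″ → E ∖ Z ⊆ (D ∪ Y) ∖ big C″
  avoiding C″ v p with ∖-elim E Z p
  ... | q , v∉Z with ∖-elim D C q
  ...   | v∈D , v∉C = ∖-intro (D ∪ Y) (big C″) (∨-introˡ v∈D) (∉-intro λ r →
          [ (λ s → true≢false (proj₁ (∧-elim (C v) s)) v∉C)
          , (λ s → [ (λ t → true≢false t (D∌Y v v∈D)) , (λ t → true≢false t v∉Z) ]′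
                   (∨-elim (Y v) (proj₂ (∧-elim (C″ v) s)))) ]′ (∨-elim ((C ∩ D) v) r))

  go : _ → Feas G (D ∪ Y) T B
  go (inj₁ none) = finish ∅ (two' two) (λ _ ()) (λ _ ()) (λ v _ → (λ p → absurd p (none v)) , λ ())
                     λ _ _ _ _ p → absurd p (none _)
    where
    two' : AtMost2 B → AtMost2 ∅
    two' (b , b' , _) = b , b' , λ _ ()
  go (inj₂ (b , b' , b∈B , b'∈B , cover)) with first-hit Z old (lb b∈B b'∈B)
  ... | inj₁ w = finish ∅ (b , b' , λ _ ()) (λ _ ()) (λ _ ()) agree
                   λ C″ _ _ _ → linked-pair cover (walk-mono (avoiding C″) w)
    where
    agree : Agree (Z ∩ T) B ∅
    agree v p = (λ q → ⊥-elim ([ (λ { refl → true≢false (proj₁ (∧-elim (Z v) p)) (proj₂ (∖-elim E Z (walk-start w))) })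
                               , (λ { refl → true≢false (proj₁ (∧-elim (Z v) p)) (proj₂ (∖-elim E Z (walk-end w))) }) ]′ (cover v q)))
              , λ ()
  -- `p` is the first vertex of the walk in N(Y). The last one, `q`, is the first on the reversed
  -- remainder, which cannot miss N(Y) because it ends in `p`.
  ... | inj₂ (p , p∈Z , p∈E , w , b∈Z , rest) with first-hit Z old (reverse rest)
  ...   | inj₁ w' = absurd p∈Z (proj₂ (∖-elim E Z (walk-end w')))
  ...   | inj₂ (q , q∈Z , q∈E , w' , b'∈Z , _) = finish (pair p q) (p , q , pair-elim p q)
            (λ v r → [ (λ { refl → p∈Z }) , (λ { refl → q∈Z }) ]′ (pair-elim p q v r)) notC agree useB
    where
    notC : ∀ v → v ∈ pair p q → v ∉ C
    notC v r = [ (λ { refl → proj₂ (∖-elim D C p∈E) }) , (λ { refl → proj₂ (∖-elim D C q∈E) }) ]′ (pair-elim p q v r)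
    -- `T ∖ B` lies on the side `C`, which the walk avoids.
    inB : ∀ {v} → v ∈ T → v ∈ E → v ∈ B
    inB {v} r s with bool (B v)
    ... | inj₁ t = t
    ... | inj₂ t = absurd (proj₂ (∧-elim (D v) (walk-start (la (∖-intro T B r t) (∖-intro T B r t)))))
                                      (proj₂ (∖-elim D C s))
    agree : Agree (Z ∩ T) B (pair p q)
    agree v r with ∧-elim (Z v) r
    ... | v∈Z , v∈T =
      (λ s → [ (λ { refl → subst (λ x → v ∈ pair x q) (sym (b∈Z v∈Z)) (pair-introˡ v q) })
             , (λ { refl → subst (λ x → v ∈ pair p x) (sym (b'∈Z v∈Z)) (pair-introʳ p v) }) ]′ (cover v s))
      , λ s → [ (λ { refl → inB v∈T p∈E }) , (λ { refl → inB v∈T q∈E }) ]′ (pair-elim p q v s)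
    useB : ∀ C″ → _ → _ → Linked G (closed G Y ∖ C″) (pair p q) → Linked G ((D ∪ Y) ∖ big C″) B
    useB C″ region out l = linked-pair cover
      (walk-mono (into p p∈Z (pair-introˡ p q)) w ++
       walk-mono (λ v r → let s , t = ∖-elim (closed G Y) C″ r in region v s t) (l (pair-introˡ p q) (pair-introʳ p q)) ++
       reverse (walk-mono (into q q∈Z (pair-introʳ p q)) w'))
      where
      into : ∀ x → x ∈ Z → x ∈ pair p q → (E ∖ Z) ∪ ⁅ x ⁆ ⊆ (D ∪ Y) ∖ big C″
      into x x∈Z x∈pq v r with ∨-elim ((E ∖ Z) v) r
      ... | inj₁ s = avoiding C″ v s
      ... | inj₂ s with ==-elim v x s
      ...   | refl = region x (∨-introʳ (Y x) x∈Z) (out x x∈pq)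

-- Menger-type linking of S to a rigid set

⊆-trans : ∀ {n} {X Y Z : VSet n} → X ⊆ Y → Y ⊆ Z → X ⊆ Z
⊆-trans p q v r = q v (p v r)

Nbd-mono : ∀ {n} (G : Graph n) {X Y : VSet n} {v} → X ⊆ Y → v ∉ Y → v ∈ Nbd G X → v ∈ Nbd G Y
Nbd-mono G {X} {Y} s q p with Nbd-elim G X p
... | _ , u , u∈X , uv = ∈-Nbd G Y q (s u u∈X) uv

∖-∈ : ∀ {n} (X : VSet n) {v x} → v ∈ X → v ≢ x → v ∈ X ∖ ⁅ x ⁆
∖-∈ X {v} {x} p q = ∖-intro X (⁅ x ⁆) p (==-false q)

∖-∉ : ∀ {n} (X : VSet n) {v x} → v ∈ X ∖ ⁅ x ⁆ → v ∈ X × v ≢ x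
∖-∉ X {v} {x} p with ∖-elim X ⁅ x ⁆ p
... | q , r = q , λ e → true≢false (==-intro e) r

closed-⊆ : ∀ {n} (G : Graph n) {X U S : VSet n} → X ⊆ U → Nbd G U ⊆ S → closed G X ⊆ U ∪ S
closed-⊆ G {X} {U} s N v p with bool (U v)
... | inj₁ q = ∨-introˡ q
... | inj₂ q with ∨-elim (X v) p
...   | inj₁ r = absurd (s v r) q
...   | inj₂ r = ∨-introʳ (U v) (N v (Nbd-mono G s q r))

adj-∪ : ∀ {n} (G : Graph n) {U S : VSet n} {u v} → Nbd G U ⊆ S → u ∈ U → Adj G u v → v ∈ U ⊎ v ∈ S
adj-∪ G {U} {v = v} N p e with bool (U v)
... | inj₁ q = inj₁ q
... | inj₂ q = inj₂ (N v (∈-Nbd G U q p e))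

Disjoint : ∀ {n} → VSet n → VSet n → Set
Disjoint X Y = ∀ v → v ∈ X → v ∉ Y

#-remove : ∀ {n} (X : VSet n) x → x ∈ X → suc (# (X ∖ ⁅ x ⁆)) ≤ # X
#-remove X x p = #-< (X ∖ ⁅ x ⁆) X x (λ v q → proj₁ (∖-∉ X {v} {x} q)) p
  (∉-intro λ q → proj₂ (∖-∉ X {x} {x} q) refl)

find : ∀ {n} (X Y : VSet n) → X ⊆ Y ⊎ (∃ λ v → v ∈ X × v ∉ Y)
find X Y with bool (anyᵇ (X ∖ Y))
... | inj₁ p with any-elim (X ∖ Y) p
...   | v , q = inj₂ (v , ∖-elim X Y q)
find X Y | inj₂ p = inj₁ λ v q → [ id , (λ r → absurd (∖-intro X Y q r) (any-false (X ∖ Y) p v)) ]′ (bool (Y v))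

-- Only what a linkage from S can ask of `X`: its ends `T` on N(X) number at most `r`, and the roots
-- already there, `PA` and `PB`, keep their roles. This weaker notion is the one verified for a
-- single vertex of low weight.
RigidFor : ∀ {n} → Graph n → (X PA PB : VSet n) → ℕ → Set
RigidFor G X PA PB r = ∀ T B → T ⊆ Nbd G X → # T ≤ r → B ⊆ T → AtMost2 B → PA ⊆ T ∖ B → PB ⊆ B →
  Feas G (closed G X) T B

-- Either s can be moved along an edge sz, or a larger set Y with |N(Y)| = |S| takes over the role of X.
menger : ∀ {n} fuel (G : Graph n) (U S X PA PB : VSet n) → # U + # (U ∖ X) < fuel →
  X ⊆ U → Disjoint U S → Nbd G U ⊆ S → (∀ Y → X ⊆ Y → Y ⊆ U → # S ≤ # (Nbd G Y)) →
  RigidFor G X PA PB (# S) → PA ⊆ Nbd G X → PB ⊆ Nbd G X →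
  ∀ B → B ⊆ S → AtMost2 B → PA ⊆ S ∖ B → PB ⊆ B → Feas G (U ∪ S) S B
menger (suc fuel) G U S X PA PB (s≤s le) X⊆U dis N⊆S sep rigid PA⊆N PB⊆N B B⊆S two PA⊆ PB⊆
  with find S (Nbd G X)
... | inj₁ S⊆N = feas-mono {G = G} {G' = G} (λ _ _ e → e) (closed-⊆ G X⊆U N⊆S) (λ _ p → p) (λ _ p → p)
                  (rigid S B S⊆N ≤-refl B⊆S two PA⊆ PB⊆)
... | inj₂ (s , s∈S , s∉NX) with bool (Nbd G U s)
-- If `s` had no neighbour in `U`, then N(U) would be smaller than `S`, against `sep` for `U`
-- itself.
...   | inj₂ s∉NU = ⊥-elim (<⇒≱ (#-< (Nbd G U) S s N⊆S s∈S s∉NU) (sep U X⊆U (λ _ p → p)))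
...   | inj₁ s∈NU with Nbd-elim G U s∈NU
...     | s∉U , z , z∈U , zs = go (searchVSet resp (λ Y → ⊆? X Y ×-dec ⊆? Y U' ×-dec (# (Nbd G' Y) <? # S)))
  where
  G' = delete G s
  U' = U ∖ ⁅ z ⁆
  S' = (S ∖ ⁅ s ⁆) ∪ ⁅ z ⁆

  -- An obstruction to moving the root `s` along `sz`: after deleting `s` and making `z` a root,
  -- fewer than |S| vertices separate such a `Y` from the rest.
  Bad : VSet _ → Set
  Bad Y = X ⊆ Y × Y ⊆ U' × # (Nbd G' Y) < # S

  resp : ∀ {Y Y'} → (∀ v → Y v ≡ Y' v) → Bad Y → Bad Y'
  resp e (a , b , c) = (λ v p → trans (sym (e v)) (a v p)) , (λ v p → b v (trans (e v) p))
    , subst (_< # S) (#-cong (Nbd-cong G' e)) c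

  z∉S : z ∉ S
  z∉S = dis z z∈U
  s≢ : ∀ {v} → v ∈ U → v ≢ s
  s≢ p = ∈∉⇒≢ U p s∉U
  s∉X : s ∉ X
  s∉X = ∉-intro λ p → true≢false (X⊆U s p) s∉U
  z∉X : z ∉ X
  z∉X = ∉-intro λ p → true≢false (∈-Nbd G X s∉X p zs) s∉NX
  S≢z : ∀ {v} → v ∈ S → v ≢ z
  S≢z p = ∈∉⇒≢ S p z∉S
  N≢s : ∀ {v} → v ∈ Nbd G X → v ≢ s
  N≢s p = ∈∉⇒≢ (Nbd G X) p s∉NX

  S'-elim : ∀ {v} → v ∈ S' → (v ∈ S × v ≢ s) ⊎ v ≡ z
  S'-elim {v} p with ∨-elim ((S ∖ ⁅ s ⁆) v) p
  ... | inj₁ q = inj₁ (∖-∉ S q)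
  ... | inj₂ q = inj₂ (==-elim v z q)
  S'-intro : ∀ {v} → v ∈ S → v ≢ s → v ∈ S'
  S'-intro p q = ∨-introˡ (∖-∈ S p q)
  z∈S' : z ∈ S'
  z∈S' = ∨-introʳ ((S ∖ ⁅ s ⁆) z) (==-intro {i = z} refl)

  #S'≤ : # S' ≤ # S
  #S'≤ = ≤-trans (#-∪-≤ (S ∖ ⁅ s ⁆) ⁅ z ⁆ S' (λ v p → ∨-elim ((S ∖ ⁅ s ⁆) v) p))
    (≤-trans (≤-reflexive (trans (cong (# (S ∖ ⁅ s ⁆) +_) (#-single z)) (+-comm _ 1))) (#-remove S s s∈S))

  N'⊆N : ∀ {Y v} → v ∈ Nbd G' Y → v ∈ Nbd G Y
  N'⊆N {Y} p with Nbd-elim G' Y p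
  ... | a , u , b , c = ∈-Nbd G Y a b (proj₂ (proj₂ (delete-elim G s c)))
  N⊆N' : ∀ {Y v} → Y ⊆ U → v ≢ s → v ∈ Nbd G Y → v ∈ Nbd G' Y
  N⊆N' {Y} t q p with Nbd-elim G Y p
  ... | a , u , b , c = ∈-Nbd G' Y a b (delete-intro G (s≢ (t u b) , q , c))

  -- `G − s` is a subgraph of the contraction of `s` into `z`, so prolonging the linkage by the edge
  -- `sz` is an instance of `contract-feas`.
  lift : ∀ B' → Feas G' (U' ∪ S') S' B' →
    (∀ a → a ∈ S ∖ B → a ∈ S' ∖ B' ⊎ (a ≡ s × z ∈ S' ∖ B')) →
    (∀ b → b ∈ B → b ∈ B' ⊎ (b ≡ s × z ∈ B')) → Feas G (U ∪ S) S B
  lift B' f ra rb = contract-feas G (Adj-sym G zs) s∉D D⊆ (λ _ → ∨-introʳ (U s) s∈S) ra rb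
    (feas-mono {G = G'} {G' = contract G s z} (λ {u} {v} _ _ e → let a , b , c = delete-elim G s {u} {v} e in contract-intro G {s} {z} {u} {v} (a , b , Adj-≢ G c , inj₁ c))
      (λ _ p → p) (λ _ p → p) (λ _ p → p) f)
    where
    s∉D : s ∉ U' ∪ S'
    s∉D = ∉-intro λ p → [ (λ q → true≢false (proj₁ (∖-∉ U q)) s∉U)
      , (λ q → [ (λ (_ , r) → r refl) , (λ r → S≢z s∈S r) ]′ (S'-elim q)) ]′ (∨-elim (U' s) p)
    D⊆ : U' ∪ S' ⊆ U ∪ S
    D⊆ v p = [ (λ q → ∨-introˡ (proj₁ (∖-∉ U q)))
      , (λ q → [ (λ (r , _) → ∨-introʳ (U v) r) , (λ { refl → ∨-introˡ z∈U }) ]′ (S'-elim q)) ]′ (∨-elim (U' v) p)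
  reduced : (∀ Y → ¬ Bad Y) → ∀ B' → B' ⊆ S' → AtMost2 B' → PA ⊆ S' ∖ B' → PB ⊆ B' → Feas G' (U' ∪ S') S' B'
  reduced none B' = menger fuel G' U' S' X PA PB
    (≤-trans (+-mono-<-≤ (#-remove U z z∈U) (#-mono (U' ∖ X) (U ∖ X) λ v p → let q , r = ∖-elim U' X p in ∖-intro U X (proj₁ (∖-∉ U q)) r)) le)
    (λ v p → ∖-∈ U (X⊆U v p) λ { refl → true≢false p z∉X })
    (λ v p → ∉-intro λ q → [ (λ (r , _) → true≢false r (dis v (proj₁ (∖-∉ U p)))) , proj₂ (∖-∉ U p) ]′ (S'-elim q))
    (λ v p → let a , u , b , c = Nbd-elim G' U' p ; _ , d , e = delete-elim G s c in
       [ (λ q → [ (λ r → ∨-introʳ ((S ∖ ⁅ s ⁆) v) r) , (λ r → absurd (∖-intro U (⁅ z ⁆) q r) a) ]′ (bool (v == z)))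
       , (λ q → S'-intro q d) ]′ (adj-∪ G N⊆S (proj₁ (∖-∉ U b)) e))
    (λ Y p q → ≤-trans #S'≤ (≮⇒≥ λ r → none Y (p , q , r)))
    (λ T B t r b two a c → feas-mono {G = G} {G' = G'}
       (λ p q e → delete-intro G (c≢ p , c≢ q , e))
       (λ v p → [ ∨-introˡ , (λ q → ∨-introʳ (X v) (N⊆N' X⊆U (N≢s q) q)) ]′ (∨-elim (X v) p))
       (λ _ p → p) (λ _ p → p) (rigid T B (λ v p → N'⊆N (t v p)) (≤-trans r #S'≤) b two a c))
    (λ v p → N⊆N' X⊆U (N≢s (PA⊆N v p)) (PA⊆N v p))
    (λ v p → N⊆N' X⊆U (N≢s (PB⊆N v p)) (PB⊆N v p)) B'
    where
    c≢ : ∀ {v} → v ∈ closed G X → v ≢ s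
    c≢ {v} p = [ (λ q → s≢ (X⊆U v q)) , N≢s ]′ (∨-elim (X v) p)

  go : _ → Feas G (U ∪ S) S B
  go (inj₂ none) with bool (B s)
  ... | inj₁ s∈B = lift B' (reduced none B' B'⊆ two' PA⊆' PB⊆')
                     (λ a p → inj₁ (a∈ p)) (λ b p → roleB p (b ≟ s))
    where
    B' = (B ∖ ⁅ s ⁆) ∪ ⁅ z ⁆
    B'-elim : ∀ {v} → v ∈ B' → (v ∈ B × v ≢ s) ⊎ v ≡ z
    B'-elim {v} p with ∨-elim ((B ∖ ⁅ s ⁆) v) p
    ... | inj₁ q = inj₁ (∖-∉ B q)
    ... | inj₂ q = inj₂ (==-elim v z q)
    B'⊆ : B' ⊆ S'
    B'⊆ v p = [ (λ (q , r) → S'-intro (B⊆S v q) r) , (λ { refl → z∈S' }) ]′ (B'-elim p)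
    move : AtMost2 B → AtMost2 B'
    move (b , b' , h) with h s s∈B
    ...   | inj₁ refl = z , b' , λ v p → [ (λ (q , r) → [ (λ e → ⊥-elim (r e)) , inj₂ ]′ (h v q)) , inj₁ ]′ (B'-elim p)
    ...   | inj₂ refl = b , z , λ v p → [ (λ (q , r) → [ inj₁ , (λ e → ⊥-elim (r e)) ]′ (h v q)) , inj₂ ]′ (B'-elim p)
    a∈ : ∀ {v} → v ∈ S ∖ B → v ∈ S' ∖ B'
    a∈ {v} p with ∖-elim S B p
    ... | q , r = ∖-intro S' B' (S'-intro q λ { refl → true≢false s∈B r })
      (∉-intro λ t → [ (λ (t , _) → true≢false t r) , S≢z q ]′ (B'-elim t))
    two' : AtMost2 B'
    two' = move two
    PA⊆' : PA ⊆ S' ∖ B'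
    PA⊆' v p = a∈ (PA⊆ v p)
    PB⊆' : PB ⊆ B'
    PB⊆' v p = ∨-introˡ (∖-∈ B (PB⊆ v p) (N≢s (PB⊆N v p)))
    roleB : ∀ {b} → b ∈ B → Dec (b ≡ s) → b ∈ B' ⊎ (b ≡ s × z ∈ B')
    roleB p (yes refl) = inj₂ (refl , ∨-introʳ ((B ∖ ⁅ s ⁆) z) (==-intro {i = z} refl))
    roleB p (no q) = inj₁ (∨-introˡ (∖-∈ B p q))
  ... | inj₂ s∉B = lift B (reduced none B (λ v p → S'-intro (B⊆S v p) (∈∉⇒≢ B p s∉B)) two
                       (λ v p → a∈ (PA⊆ v p) (N≢s (PA⊆N v p))) PB⊆)
                     (λ a p → roleA p (a ≟ s)) (λ _ p → inj₁ p)
    where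
    a∈ : ∀ {v} → v ∈ S ∖ B → v ≢ s → v ∈ S' ∖ B
    a∈ p q with ∖-elim S B p
    ... | r , t = ∖-intro S' B (S'-intro r q) t
    roleA : ∀ {a} → a ∈ S ∖ B → Dec (a ≡ s) → a ∈ S' ∖ B ⊎ (a ≡ s × z ∈ S' ∖ B)
    roleA p (yes refl) = inj₂ (refl , ∖-intro S' B z∈S' (∉-intro λ q → S≢z (B⊆S z q) refl))
    roleA p (no q) = inj₁ (a∈ p q)
  -- The inner call links N(Y) to `X` inside `Y`, which is smaller than `U` since `z ∉ Y`. The outer
  -- call links `S` to `Y`, which is larger than `X`: `s` is in N(Y) but not in N(X).
  go (inj₁ (Y , X⊆Y , Y⊆U' , small)) = menger fuel G U S Y PA PB
    (≤-trans (+-mono-≤-< (≤-refl {# U}) (#-< (U ∖ Y) (U ∖ X) y (λ v p → let q , r = ∖-elim U Y p in ∖-intro U X q (∉-intro λ t → true≢false (X⊆Y v t) r))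
       (∖-intro U X (Y⊆U _ y∈Y) y∉X) (∉-intro λ p → true≢false y∈Y (proj₂ (∖-elim U Y p))))) le)
    Y⊆U dis N⊆S (λ Y' p → sep Y' (⊆-trans X⊆Y p))
    (λ T B' t r b two' a c → feas-mono {G = G} {G' = G} (λ _ _ e → e) (λ _ p → p)
       (λ v p → let q , r = ∖-elim T B' p in ∖-intro (Nbd G Y) B' (t v q) r) (λ _ p → p)
       (menger fuel G Y (Nbd G Y) X PA PB
          (≤-trans (+-mono-<-≤ (#-< Y U z Y⊆U z∈U (∉-intro λ p → proj₂ (∖-∉ U (Y⊆U' z p)) refl))
             (#-mono (Y ∖ X) (U ∖ X) λ v p → let q , r = ∖-elim Y X p in ∖-intro U X (Y⊆U v q) r)) le)
          X⊆Y (λ v p → ∉-intro λ q → true≢false p (proj₁ (Nbd-elim G Y q))) (λ _ p → p)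
          (λ Y' p q → ≤-trans #NY≤ (sep Y' p (⊆-trans q Y⊆U)))
          (λ T B t r → rigid T B t (≤-trans r #NY≤)) PA⊆N PB⊆N
          B' (⊆-trans b t) two' (λ v p → let q , r = ∖-elim T B' (a v p) in ∖-intro (Nbd G Y) B' (t v q) r) c))
    (λ v p → N⊆NY (proj₁ (∖-elim S B (PA⊆ v p))) (PA⊆N v p))
    (λ v p → N⊆NY (B⊆S v (PB⊆ v p)) (PB⊆N v p)) B B⊆S two PA⊆ PB⊆
    where
    Y⊆U : Y ⊆ U
    Y⊆U v p = proj₁ (∖-∉ U (Y⊆U' v p))
    N⊆NY : ∀ {v} → v ∈ S → v ∈ Nbd G X → v ∈ Nbd G Y
    N⊆NY p q = Nbd-mono G X⊆Y (∉-intro λ r → true≢false p (dis _ (Y⊆U _ r))) q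
    #NY≤ : # (Nbd G Y) ≤ # S
    #NY≤ = ≤-trans (#-∪-≤ (Nbd G' Y) ⁅ s ⁆ (Nbd G Y) λ v p → [ (λ q → inj₂ q) , (λ q → inj₁ (N⊆N' Y⊆U (λ e → true≢false (==-intro e) q) p)) ]′ (bool (v == s)))
      (≤-trans (≤-reflexive (trans (cong (# (Nbd G' Y) +_) (#-single s)) (+-comm _ 1))) small)
    s∈NY : s ∈ Nbd G Y
    s∈NY with bool (Nbd G Y s)
    ... | inj₁ p = p
    ... | inj₂ p = ⊥-elim (<⇒≱ (≤-trans (s≤s (#-mono (Nbd G Y) (Nbd G' Y) λ v q → N⊆N' Y⊆U (∈∉⇒≢ (Nbd G Y) q p) q)) small) (sep Y X⊆Y Y⊆U))
    y = proj₁ (proj₂ (Nbd-elim G Y s∈NY))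
    y∈Y : y ∈ Y
    y∈Y = proj₁ (proj₂ (proj₂ (Nbd-elim G Y s∈NY)))
    y∉X : y ∉ X
    y∉X = ∉-intro λ p → true≢false (∈-Nbd G X s∉X p (proj₂ (proj₂ (proj₂ (Nbd-elim G Y s∈NY))))) s∉NX

-- Massed graphs

Bonus : ∀ {n} → Graph n → (U S B : VSet n) → Set
Bonus G U S B = ∃ λ x → ∃ λ y → x ∈ S ∖ B × y ∈ B × (∀ z → z ∈ U → Adj G x z → Adj G y z → ⊥)

Sparse : ∀ {n} → ℕ → Graph n → (U S : VSet n) → Set
Sparse k G U S = ∀ X → X ⊆ U → # (Nbd G X) < # S → ρ G X ≤ k * # X

-- One edge less suffices when S is small or when two roots with different roles have no common neighbour in U.
-- This is all that is known about a violator of order |S| whose neighbourhood contains the contracted edge.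
Dense : ∀ {n} → ℕ → Graph n → (U S B : VSet n) → Set
Dense k G U S B = k * # U + 2 ≤ ρ G U ⊎ (k * # U + 1 ≤ ρ G U × (# S ≤ k ⊎ Bonus G U S B))

record Massed {n} (k : ℕ) (G : Graph n) (U S B : VSet n) : Set where
  constructor massed
  field
    disjoint : Disjoint U S
    nbd      : Nbd G U ⊆ S
    roles    : B ⊆ S
    two      : AtMost2 B
    order    : # S ≤ suc k
    sparse   : Sparse k G U S
    dense    : Dense k G U S B

MassedBelow : ℕ → ℕ → ℕ → Set
MassedBelow n k u = ∀ (G : Graph n) U S B → # U < u → Massed k G U S B → Feas G (U ∪ S) S B

Rigid : ∀ {n} → Graph n → VSet n → Set
Rigid G X = ∀ B → B ⊆ Nbd G X → AtMost2 B → Feas G (closed G X) (Nbd G X) B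

-- When `X` is eliminated in favour of S, the roots on N(X) already have roles, so only choices `B'`
-- agreeing with `B` there can be asked for.
RigidWith : ∀ {n} → Graph n → (X S B : VSet n) → Set
RigidWith G X S B = ∀ B' → AtMost2 B' → B' ⊆ Nbd G X → Agree (Nbd G X ∩ S) B B' → Feas G (closed G X) (Nbd G X) B'

⊆-resp : ∀ {n} {X X' Y : VSet n} → (∀ v → X v ≡ X' v) → X ⊆ Y → X' ⊆ Y
⊆-resp e s v p = s v (trans (e v) p)

Violator : ∀ {n} → ℕ → Graph n → VSet n → ℕ → VSet n → Set
Violator k G U r X = X ⊆ U × # (Nbd G X) < r × k * # X < ρ G X

violator? : ∀ {n} k (G : Graph n) U r → (∃ λ X → Violator k G U r X) ⊎ (∀ X → ¬ Violator k G U r X)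
violator? k G U r = searchVSet resp λ X → ⊆? X U ×-dec (# (Nbd G X) <? r) ×-dec (k * # X <? ρ G X)
  where
  resp : ∀ {X Y} → (∀ v → X v ≡ Y v) → Violator k G U r X → Violator k G U r Y
  resp {X} {Y} e (a , b , c) = ⊆-resp e a , subst (_< r) (#-cong (Nbd-cong G e)) b
    , subst (_< ρ G Y) (cong (k *_) (#-cong e)) (subst (k * # X <_) (ρ-cong G e) c)

self-disjoint : ∀ {n} (G : Graph n) X → Disjoint X (Nbd G X)
self-disjoint G X v p = ∉-intro λ q → true≢false p (proj₁ (Nbd-elim G X q))

-- Passing to smaller neighbourhoods ends in a violator that is massed with its own neighbourhood as
-- root set: minimality gives sparseness, and because |N(X)| ≤ k one excess edge is dense enough.
-- The roles on N(X) were arbitrary, so induction gives rigidity.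
rigid-violator : ∀ {n k u} → MassedBelow n k u → ∀ fuel (G : Graph n) X → # (Nbd G X) < fuel →
  # X < u → # (Nbd G X) ≤ k → k * # X < ρ G X →
  ∃ λ Y → Y ⊆ X × # (Nbd G Y) ≤ # (Nbd G X) × k * # Y < ρ G Y × Rigid G Y
rigid-violator {k = k} ih (suc fuel) G X (s≤s le) X<u N≤k ex with violator? k G X (# (Nbd G X))
... | inj₁ (Y , Y⊆X , Y< , exY) with rigid-violator ih fuel G Y (≤-trans Y< le)
        (≤-trans (s≤s (#-mono Y X Y⊆X)) X<u) (≤-trans (<⇒≤ Y<) N≤k) exY
...   | Z , Z⊆Y , Z≤ , exZ , rig = Z , ⊆-trans Z⊆Y Y⊆X , ≤-trans Z≤ (<⇒≤ Y<) , exZ , rig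
rigid-violator {k = k} ih (suc fuel) G X (s≤s le) X<u N≤k ex | inj₂ none = X , (λ _ p → p) , ≤-refl , ex , λ B B⊆ two →
  ih G X (Nbd G X) B X<u (massed (self-disjoint G X) (λ _ p → p) B⊆ two (m≤n⇒m≤1+n N≤k)
    (λ Y s l → ≮⇒≥ λ q → none Y (s , l , q))
    (inj₂ (≤-trans (≤-reflexive (+-comm _ 1)) ex , inj₁ N≤k)))

-- Counting edges after an elimination

module _ {n} (G : Graph n) (Y U : VSet n) where

  private
    G' = eliminate G Y
    U' = U ∖ Y

    survives : ∀ {u v} → touch G U u v ≡ true → touch G Y u v ≡ false → touch G' U' u v ≡ true
    survives {u} {v} p q with touch-elim G U {u} {v} p
    ... | uv , uU⊎vU = touch-intro G' U' (eliminate-intro G {Y} {u} {v} (u∉ , v∉ , Adj-≢ G uv , inj₁ uv))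
                         ([ (λ r → inj₁ (∖-intro U Y r u∉)) , (λ r → inj₂ (∖-intro U Y r v∉)) ]′ uU⊎vU)
      where
      u∉ : u ∉ Y
      u∉ = ∉-intro λ r → true≢false (touch-intro G Y {u} {v} uv (inj₁ r)) q
      v∉ : v ∉ Y
      v∉ = ∉-intro λ r → true≢false (touch-intro G Y {u} {v} uv (inj₂ r)) q

    base : ∀ u v → 𝟙 (touch G U u v) ≤ 𝟙 (touch G' U' u v) + 𝟙 (touch G Y u v)
    base u v with bool (touch G Y u v)
    ... | inj₁ q rewrite q = ≤-trans (𝟙≤1 _) (m≤n+m 1 _)
    ... | inj₂ q rewrite q | +-identityʳ (𝟙 (touch G' U' u v)) = 𝟙-mono (λ p → survives {u} {v} p q)

    sum-eq : ΣΣ (λ u v → 𝟙 (touch G' U' u v) + 𝟙 (touch G Y u v)) ≡ (ρ G' U' + ρ G Y) + (ρ G' U' + ρ G Y)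
    sum-eq = trans (ΣΣ-+ (λ u v → 𝟙 (touch G' U' u v)) (λ u v → 𝟙 (touch G Y u v))) (trans (cong₂ _+_ (ΣΣ-touch G' U') (ΣΣ-touch G Y)) (+-swap (ρ G' U') _ _ _))

  -- An edge touching `U` either touches `Y` or survives in G/Y.
  ρ-eliminate : ρ G U ≤ ρ G' U' + ρ G Y
  ρ-eliminate = double-≤ (≤-trans (≤-reflexive (sym (ΣΣ-touch G U))) (≤-trans (ΣΣ-mono base) (≤-reflexive sum-eq)))

  -- The clique edge `ab` touches `U'` without coming from an edge of `G`. This gain will replace a
  -- lost bonus.
  ρ-eliminate-new : ∀ {a b} → a ∈ Nbd G Y → b ∈ Nbd G Y → a ≢ b → adj G a b ≡ false → b ∈ U' →
                    suc (ρ G U) ≤ ρ G' U' + ρ G Y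
  ρ-eliminate-new {a} {b} a∈N b∈N a≢b a≁b b∈U' = double-≤ (begin
    suc (ρ G U) + suc (ρ G U)                      ≡⟨ arith (ρ G U) ⟩
    (ρ G U + ρ G U) + (1 + 1)                      ≡⟨ cong₂ _+_ (ΣΣ-touch G U) (cong₂ _+_ (ΣΣ-point a b) (ΣΣ-point b a)) ⟨
    ΣΣ (λ u v → 𝟙 (touch G U u v)) + (ΣΣ (pt a b) + ΣΣ (pt b a))
      ≡⟨ trans (ΣΣ-+ (λ u v → 𝟙 (touch G U u v)) (λ u v → pt a b u v + pt b a u v)) (cong (ΣΣ (λ u v → 𝟙 (touch G U u v)) +_) (ΣΣ-+ (pt a b) (pt b a))) ⟨
    ΣΣ (λ u v → 𝟙 (touch G U u v) + (pt a b u v + pt b a u v)) ≤⟨ ΣΣ-mono point ⟩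
    ΣΣ (λ u v → 𝟙 (touch G' U' u v) + 𝟙 (touch G Y u v)) ≡⟨ sum-eq ⟩
    (ρ G' U' + ρ G Y) + (ρ G' U' + ρ G Y) ∎)
    where
    open ≤-Reasoning
    arith : ∀ r → suc r + suc r ≡ (r + r) + (1 + 1)
    arith = solve-∀
    pt : Fin n → Fin n → Fin n → Fin n → ℕ
    pt a b u v = 𝟙 (u == a) * 𝟙 (v == b)
    a∉Y : a ∉ Y
    a∉Y = proj₁ (Nbd-elim G Y a∈N)
    b∉Y : b ∉ Y
    b∉Y = proj₁ (Nbd-elim G Y b∈N)
    ab : touch G' U' a b ≡ true
    ab = touch-intro G' U' (eliminate-intro G {Y} {a} {b} (a∉Y , b∉Y , a≢b , inj₂ (a∈N , b∈N))) (inj₂ b∈U')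
    ba : touch G' U' b a ≡ true
    ba = trans (touch-sym G' U' b a) ab
    old : ∀ {u v} → pt a b u v ≡ 0 → pt b a u v ≡ 0 → 𝟙 (touch G U u v) + (pt a b u v + pt b a u v) ≤ 𝟙 (touch G' U' u v) + 𝟙 (touch G Y u v)
    old {u} {v} p q rewrite p | q | +-identityʳ (𝟙 (touch G U u v)) = base u v
    pt-1 : ∀ a b → pt a b a b ≡ 1
    pt-1 a b = cong₂ (λ p q → 𝟙 p * 𝟙 q) (==-intro {i = a} refl) (==-intro {i = b} refl)
    pt-0ˡ : ∀ a b {u} v → u ≢ a → pt a b u v ≡ 0
    pt-0ˡ a b v p = cong (λ q → 𝟙 q * 𝟙 (v == b)) (==-false p)
    pt-0ʳ : ∀ a b u {v} → v ≢ b → pt a b u v ≡ 0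
    pt-0ʳ a b u p = trans (cong (λ q → 𝟙 (u == a) * 𝟙 q) (==-false p)) (*-zeroʳ (𝟙 (u == a)))
    one : ∀ {u v} → adj G u v ≡ false → touch G' U' u v ≡ true → pt a b u v + pt b a u v ≡ 1 →
          𝟙 (touch G U u v) + (pt a b u v + pt b a u v) ≤ 𝟙 (touch G' U' u v) + 𝟙 (touch G Y u v)
    one {u} {v} p q r = ≤-trans (≤-reflexive (cong₂ _+_ (cong (λ x → 𝟙 (x ∧ (U u ∨ U v))) p) r))
      (≤-trans (≤-reflexive (sym (cong 𝟙 q))) (m≤m+n _ _))
    cases : ∀ {u v} → Dec (u ≡ a) → Dec (v ≡ b) → Dec (u ≡ b) → Dec (v ≡ a) →
            𝟙 (touch G U u v) + (pt a b u v + pt b a u v) ≤ 𝟙 (touch G' U' u v) + 𝟙 (touch G Y u v)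
    cases (yes refl) (yes refl) _ _ = one a≁b ab (cong₂ _+_ (pt-1 a b) (pt-0ˡ b a b a≢b))
    cases {u} {v} (yes refl) (no q) _ _ = old (pt-0ʳ a b a q) (pt-0ˡ b a v a≢b)
    cases (no p) _ (yes refl) (yes refl) = one (trans (adj-sym G b a) a≁b) ba (cong₂ _+_ (pt-0ˡ a b a (a≢b ∘ sym)) (pt-1 b a))
    cases {u} {v} (no p) _ (yes refl) (no q) = old (pt-0ˡ a b v p) (pt-0ʳ b a u q)
    cases {u} {v} (no p) _ (no q) _ = old (pt-0ˡ a b v p) (pt-0ˡ b a v q)
    point : ∀ u v → 𝟙 (touch G U u v) + (pt a b u v + pt b a u v) ≤ 𝟙 (touch G' U' u v) + 𝟙 (touch G Y u v)
    point u v = cases (u ≟ a) (v ≟ b) (u ≟ b) (v ≟ a)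

∖-split : ∀ {n} (X Y : VSet n) → Y ⊆ X → # (X ∖ Y) + # Y ≤ # X
∖-split X Y s = #-∪-≥ (X ∖ Y) Y X (λ v p → proj₁ (∖-elim X Y p)) s (λ v p → proj₂ (∖-elim X Y p))

excess-∖ : ∀ k c {u u' y r r' s} → u' + y ≤ u → k * u + c ≤ r → r ≤ r' + s → s ≤ k * y → k * u' + c ≤ r'
excess-∖ k c {u} {u'} {y} {r} {r'} {s} h₁ h₂ h₃ h₄ =
  lin (k * u' + c) r' 0 (+-mono-≤ (*-monoʳ-≤ k h₁) (+-mono-≤ h₂ (+-mono-≤ h₃ h₄))) (eq k c u u' y r r' s)
  where
  eq : ∀ k c u u' y r r' s → k * u' + c + (k * u + (r + (r' + s + k * y))) + 0 ≡
                             r' + (k * (u' + y) + (k * u + c + (r + s)))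
  eq = solve-∀

-- Rigid sets in a massed graph

module _ {n k u} (ih : MassedBelow n k u) (G : Graph n) (U S B : VSet n) (m : Massed k G U S B) (U≤u : # U ≤ u) where
  open Massed m

  private
    <u : ∀ {Y} → Y ⊆ U → ∀ y → y ∈ Y → # (U ∖ Y) < u
    <u {Y} s y p = ≤-trans (#-< (U ∖ Y) U y (λ v q → proj₁ (∖-elim U Y q)) (s y p)
      (∉-intro λ q → true≢false p (proj₂ (∖-elim U Y q)))) U≤u

  -- Sparseness pays for the edges at `Y`. If x and y acquire a common neighbour z, then xz or yz is
  -- a new edge; it raises the excess from one to two, and the bonus is no longer needed.
  dense-eliminate : ∀ Y → Y ⊆ U → # (Nbd G Y) < # S → Dense k (eliminate G Y) (U ∖ Y) S B
  dense-eliminate Y Y⊆U N<S = go dense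
    where
    G' = eliminate G Y
    U' = U ∖ Y
    keep : ∀ c → k * # U + c ≤ ρ G U → k * # U' + c ≤ ρ G' U'
    keep c h = excess-∖ k c (∖-split U Y Y⊆U) h (ρ-eliminate G Y U) (sparse Y Y⊆U N<S)
    gain : ∀ {a b} → k * # U + 1 ≤ ρ G U → adj G a b ≡ false → Adj G' a b → b ∈ U' → Dense k G' U' S B
    gain {a} {b} h na e b∈ with eliminate-elim G Y {a} {b} e
    ... | _ , _ , _ , inj₁ e' = absurd e' na
    ... | _ , _ , a≢b , inj₂ (p , q) = inj₁ (excess-∖ k 2 {u = # U} {r = suc (ρ G U)} {ρ G' U'} (∖-split U Y Y⊆U)
            (≤-trans (≤-reflexive (+-suc (k * # U) 1)) (s≤s h)) (ρ-eliminate-new G Y U p q a≢b na b∈) (sparse Y Y⊆U N<S))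
    go : Dense k G U S B → Dense k G' U' S B
    go (inj₁ h) = inj₁ (keep 2 h)
    go (inj₂ (h , inj₁ s)) = inj₂ (keep 1 h , inj₁ s)
    go (inj₂ (h , inj₂ (x , y , x∈ , y∈ , none))) with bool (anyᵇ λ z → U' z ∧ adj G' x z ∧ adj G' y z)
    ... | inj₂ p = inj₂ (keep 1 h , inj₂ (x , y , x∈ , y∈ , λ z z∈ e f →
                     true≢false (∧-intro z∈ (∧-intro e f)) (any-false (λ z → U' z ∧ adj G' x z ∧ adj G' y z) p z)))
    ... | inj₁ p with any-elim (λ z → U' z ∧ adj G' x z ∧ adj G' y z) p
    ...   | z , q with ∧-elim (U' z) q
    ...     | z∈ , r with ∧-elim (adj G' x z) r | bool (adj G x z) | bool (adj G y z)
    ...       | xz , yz | inj₁ e | inj₁ f = ⊥-elim (none z (proj₁ (∖-elim U Y z∈)) e f)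
    ...       | xz , yz | inj₂ e | _ = gain h e xz z∈
    ...       | xz , yz | _ | inj₂ f = gain h f yz z∈

  massed-eliminate : ∀ Y → Y ⊆ U → # (Nbd G Y) < # S → Sparse k (eliminate G Y) (U ∖ Y) S →
                     Massed k (eliminate G Y) (U ∖ Y) S B
  massed-eliminate Y Y⊆U N<S sp = massed (λ v p → disjoint v (proj₁ (∖-elim U Y p))) nbd' roles two order sp
                                     (dense-eliminate Y Y⊆U N<S)
    where
    out : ∀ {v} → v ∈ U ⊎ v ∈ S → v ∉ Y → v ∉ U ∖ Y → v ∈ S
    out (inj₂ p) q r = p
    out (inj₁ p) q r = absurd (∖-intro U Y p q) r
    nbd' : Nbd (eliminate G Y) (U ∖ Y) ⊆ S
    nbd' v p with Nbd-elim (eliminate G Y) (U ∖ Y) p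
    ... | v∉ , w , w∈ , wv with eliminate-elim G Y {w} {v} wv
    ...   | _ , v∉Y , _ , inj₁ e = out (adj-∪ G nbd (proj₁ (∖-elim U Y w∈)) e) v∉Y v∉
    ...   | _ , v∉Y , _ , inj₂ (_ , v∈N) with Nbd-elim G Y v∈N
    ...     | _ , t , t∈Y , tv = out (adj-∪ G nbd (Y⊆U t t∈Y) tv) v∉Y v∉

  -- If G/Y is still sparse, induction solves it and the solution lifts. Otherwise a rigid violator
  -- `Z` of G/Y meets N(Y), and `Y ∪ Z` takes the place of `Y`: its neighbourhood in `G` is that of
  -- `Z` in G/Y, and it is routed first through `Z`, then through `Y`.
  rigid-small : ∀ fuel Y → # (U ∖ Y) < fuel → Y ⊆ U → ∀ y → y ∈ Y → # (Nbd G Y) < # S → RigidWith G Y S B →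
                Feas G (U ∪ S) S B
  rigid-small (suc fuel) Y (s≤s le) Y⊆U y y∈Y N<S rig = go (violator? k G' U' (# S))
    where
    G' = eliminate G Y
    U' = U ∖ Y
    U'⊆U : U' ⊆ U
    U'⊆U v p = proj₁ (∖-elim U Y p)
    go : _ → Feas G (U ∪ S) S B
    go (inj₂ none) = feas-mono {G = G} {G' = G} (λ _ _ e → e)
      (λ v p → [ (λ q → [ (λ r → ∨-introˡ (U'⊆U v r)) , ∨-introʳ (U v) ]′ (∨-elim (U' v) q)) , (λ q → ∨-introˡ (Y⊆U v q)) ]′ (∨-elim ((U' ∪ S) v) p))
      (λ _ p → p) (λ _ p → p)
      (eliminate-feas G {Y} {U' ∪ S} {S} {B}
         (λ v p → [ (λ q → ∨-introˡ (∖-intro U Y q (proj₁ (Nbd-elim G Y p)))) , ∨-introʳ (U' v) ]′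
                  (∨-elim (U v) (closed-⊆ G Y⊆U nbd v (∨-introʳ (Y v) p))))
         (λ v p → [ (λ q → proj₂ (∖-elim U Y q)) , (λ q → ∉-intro λ r → true≢false q (disjoint v (Y⊆U v r))) ]′ (∨-elim (U' v) p))
         two roles rig
         (ih G' U' S B (<u Y⊆U y y∈Y) (massed-eliminate Y Y⊆U N<S λ X s l → ≮⇒≥ λ q → none X (s , l , q))))
    go (inj₁ (X , X⊆ , X< , ex)) with rigid-violator ih (suc (# (Nbd G' X))) G' X ≤-refl
         (≤-trans (s≤s (#-mono X U' X⊆)) (<u Y⊆U y y∈Y)) (s≤s⁻¹ (≤-trans X< order)) ex
    ... | Z , Z⊆X , Z≤ , exZ , rigZ = merge (find Z (λ v → not (Nbd G Y v)))
      where
      Z⊆U' : Z ⊆ U'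
      Z⊆U' = ⊆-trans Z⊆X X⊆
      Z∌Y : ∀ {v} → v ∈ Z → v ∉ Y
      Z∌Y p = proj₂ (∖-elim U Y (Z⊆U' _ p))
      merge : _ → Feas G (U ∪ S) S B
      -- Away from N(Y) the elimination adds no edge at `Z` and loses no neighbour of `Z`, so `Z`
      -- would already violate sparseness in `G`.
      merge (inj₁ off) = ⊥-elim (<⇒≱ exZ (≤-trans (ρ-mono {G = G'} {G} {Z} {Z} same) (sparse Z (⊆-trans Z⊆U' U'⊆U)
        (≤-trans (s≤s (≤-trans (#-mono (Nbd G Z) (Nbd G' Z) bd) Z≤)) X<))))
        where
        Z∌N : ∀ {v} → v ∈ Z → v ∉ Nbd G Y
        Z∌N {v} p = not-elim (Nbd G Y v) (off v p)
        same : ∀ a b → touch G' Z a b ≡ true → touch G Z a b ≡ true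
        same a b p with touch-elim G' Z {a} {b} p
        ... | e , q with eliminate-elim G Y {a} {b} e
        ...   | _ , _ , _ , inj₁ e' = touch-intro G Z e' q
        ...   | _ , _ , _ , inj₂ (r , s) = ⊥-elim ([ (λ t → true≢false r (Z∌N t)) , (λ t → true≢false s (Z∌N t)) ]′ q)
        bd : Nbd G Z ⊆ Nbd G' Z
        bd v p with Nbd-elim G Z p
        ... | v∉ , w , w∈ , wv = ∈-Nbd G' Z v∉ w∈ (eliminate-intro G {Y} {w} {v} (Z∌Y w∈
                , ∉-intro (λ q → true≢false (∈-Nbd G Y (Z∌Y w∈) q (Adj-sym G wv)) (Z∌N w∈)) , Adj-≢ G wv , inj₁ wv))
      merge (inj₂ (z , z∈Z , z∈N')) = rigid-small fuel W
          (≤-trans (#-< (U ∖ W) U' z (λ v p → let q , r = ∖-elim U W p in ∖-intro U Y q (∉-intro λ t → true≢false (∨-introˡ t) r))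
             (Z⊆U' z z∈Z) (∉-intro λ p → true≢false (∨-introʳ (Y z) z∈Z) (proj₂ (∖-elim U W p)))) le)
          W⊆U z (∨-introʳ (Y z) z∈Z) (≤-trans (s≤s (≤-trans (#-mono (Nbd G W) (Nbd G' Z) N⊆) Z≤)) X<) rigW
        where
        W = Y ∪ Z
        z∈N : z ∈ Nbd G Y
        z∈N = notnot z∈N'
          where
          notnot : ∀ {a} → not a ≡ false → a ≡ true
          notnot {true} _ = refl
        W⊆U : W ⊆ U
        W⊆U v p = [ Y⊆U v , (λ q → U'⊆U v (Z⊆U' v q)) ]′ (∨-elim (Y v) p)
        viaz : ∀ {v} → v ∈ Nbd G Y → v ∉ Z → v ∈ Nbd G' Z
        viaz {v} p q = ∈-Nbd G' Z q z∈Z (eliminate-intro G {Y} {z} {v}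
          (Z∌Y z∈Z , proj₁ (Nbd-elim G Y p) , ∈∉⇒≢ Z z∈Z q , inj₂ (z∈N , p)))
        N⊆ : Nbd G W ⊆ Nbd G' Z
        N⊆ v p with Nbd-elim G W p
        ... | v∉W , w , w∈W , wv = [ (λ q → viaz (∈-Nbd G Y v∉Y q wv) v∉Z) , (λ q → ∈-Nbd G' Z v∉Z q
                 (eliminate-intro G {Y} {w} {v} (Z∌Y q , v∉Y , Adj-≢ G wv , inj₁ wv))) ]′ (∨-elim (Y w) w∈W)
          where
          v∉Y : v ∉ Y
          v∉Y = ∉-intro λ q → true≢false (∨-introˡ q) v∉W
          v∉Z : v ∉ Z
          v∉Z = ∉-intro λ q → true≢false (∨-introʳ (Y v) q) v∉W
        N'∌Y : ∀ {v} → v ∈ Nbd G' Z → v ∉ Y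
        N'∌Y {v} p with Nbd-elim G' Z p
        ... | _ , w , _ , wv = proj₁ (proj₂ (eliminate-elim G Y {w} {v} wv))
        ⊆N : Nbd G' Z ⊆ Nbd G W
        ⊆N v p with Nbd-elim G' Z p
        ... | v∉Z , w , w∈ , wv with eliminate-elim G Y {w} {v} wv
        ...   | _ , v∉Y , _ , inj₁ e = ∈-Nbd G W (∨-false v∉Y v∉Z) (∨-introʳ (Y w) w∈) e
        ...   | _ , v∉Y , _ , inj₂ (_ , q) with Nbd-elim G Y q
        ...     | _ , t , t∈Y , tv = ∈-Nbd G W (∨-false v∉Y v∉Z) (∨-introˡ t∈Y) tv
        rigW : RigidWith G W S B
        rigW B″ two″ B″⊆ agree = feas-mono {G = G} {G' = G} (λ _ _ e → e)
          (λ v p → [ (λ q → [ (λ r → ∨-introˡ (∨-introʳ (Y v) r)) , (λ r → ∨-introʳ (W v) (⊆N v r)) ]′ (∨-elim (Z v) q))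
                   , (λ q → ∨-introˡ (∨-introˡ q)) ]′ (∨-elim (closed G' Z v) p))
          (λ _ p → p) (λ _ p → p)
          (eliminate-feas G {Y} {closed G' Z} {Nbd G W} {B″}
            (λ v p → [ ∨-introˡ , (λ q → ∨-introʳ (Z v) (viaz p q)) ]′ (bool (Z v)))
            (λ v p → [ Z∌Y , N'∌Y ]′ (∨-elim (Z v) p))
            two″ B″⊆
            (λ B' two' B'⊆ ag → rig B' two' B'⊆ (through ag))
            (feas-mono {G = G'} {G' = G'} (λ _ _ e → e) (λ _ p → p)
               (λ v p → let q , r = ∖-elim (Nbd G W) B″ p in ∖-intro (Nbd G' Z) B″ (N⊆ v q) r) (λ _ p → p)
               (rigZ B″ (⊆-trans B″⊆ N⊆) two″)))
          where
          through : ∀ {B'} → Agree (Nbd G Y ∩ Nbd G W) B″ B' → Agree (Nbd G Y ∩ S) B B'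
          through ag v p with ∧-elim (Nbd G Y v) p
          ... | q , r with Nbd-mono G {Y} {W} (λ _ → ∨-introˡ) (∉-intro λ t → true≢false r (disjoint v (W⊆U v t))) q
          ...   | s with agree v (∧-intro s r) | ag v (∧-intro q s)
          ...     | f , g | f' , g' = f' ∘ f , g ∘ g'

  -- If some `Y` between `X` and `U` has |N(Y)| < |S|, one with |N(Y)| minimal is linked to `X` by
  -- Menger inside `Y`, and `rigid-small` applies to it. If there is none, `S` itself can be linked
  -- to `X`.
  rigid-set : ∀ X → X ⊆ U → ∀ x → x ∈ X →
    RigidFor G X (Nbd G X ∩ (S ∖ B)) (Nbd G X ∩ B) (# S) → Feas G (U ∪ S) S B
  rigid-set X X⊆U x x∈X rig = conclude (search U (# S))
    where
    PA PB : VSet n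
    PA = Nbd G X ∩ (S ∖ B)
    PB = Nbd G X ∩ B
    search : ∀ V r → _
    search V r = searchVSet {P = λ Y → X ⊆ Y × Y ⊆ V × # (Nbd G Y) < r}
      (λ e (a , b , c) → (λ v p → trans (sym (e v)) (a v p)) , ⊆-resp e b , subst (_< r) (#-cong (Nbd-cong G e)) c)
      (λ Y → ⊆? X Y ×-dec ⊆? Y V ×-dec (# (Nbd G Y) <? r))
    minimise : ∀ fuel Y → # (Nbd G Y) < fuel → X ⊆ Y → Y ⊆ U → # (Nbd G Y) < # S → Feas G (U ∪ S) S B
    minimise (suc fuel) Y (s≤s le) X⊆Y Y⊆U Y<S with search Y (# (Nbd G Y))
    ... | inj₁ (Y' , X⊆Y' , Y'⊆Y , less) = minimise fuel Y' (≤-trans less le) X⊆Y' (⊆-trans Y'⊆Y Y⊆U) (≤-trans less (<⇒≤ Y<S))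
    ... | inj₂ none = rigid-small (suc (# (U ∖ Y))) Y ≤-refl Y⊆U x (X⊆Y x x∈X) Y<S λ B' two' B'⊆ agree →
        menger (suc (# Y + # (Y ∖ X))) G Y (Nbd G Y) X PA PB ≤-refl X⊆Y (self-disjoint G Y) (λ _ p → p)
          (λ Y' p q → ≮⇒≥ λ l → none Y' (p , q , l))
          (λ T B t l → rig T B t (≤-trans l (<⇒≤ Y<S)))
          (λ v p → proj₁ (∧-elim (Nbd G X v) p)) (λ v p → proj₁ (∧-elim (Nbd G X v) p)) B' B'⊆ two'
          (λ v p → let a , b = ∧-elim (Nbd G X v) p ; c , d = ∖-elim S B b ; e = NY a c in
             ∖-intro (Nbd G Y) B' e (∉-intro λ f → true≢false (proj₂ (agree v (∧-intro e c)) f) d))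
          (λ v p → let a , b = ∧-elim (Nbd G X v) p ; c = roles v b in proj₁ (agree v (∧-intro (NY a c) c)) b)
      where
      NY : ∀ {v} → v ∈ Nbd G X → v ∈ S → v ∈ Nbd G Y
      NY {v} p q = Nbd-mono G X⊆Y (∉-intro λ r → true≢false q (disjoint v (Y⊆U v r))) p
    conclude : _ → Feas G (U ∪ S) S B
    conclude (inj₁ (Y , a , b , c)) = minimise (suc (# (Nbd G Y))) Y ≤-refl a b c
    conclude (inj₂ none) = menger (suc (# U + # (U ∖ X))) G U S X PA PB ≤-refl X⊆U disjoint nbd
      (λ Y p q → ≮⇒≥ λ l → none Y (p , q , l)) rig
      (λ v p → proj₁ (∧-elim (Nbd G X v) p)) (λ v p → proj₁ (∧-elim (Nbd G X v) p)) B roles two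
      (λ v p → proj₂ (∧-elim (Nbd G X v) p)) (λ v p → proj₂ (∧-elim (Nbd G X v) p))

-- Contracting an edge

-- The corrections `f` and `g` live on ordered pairs. Symmetrised, they are counted twice, exactly
-- like edges, so a pointwise inequality can be summed and halved.
ρ-compare : ∀ {n} {G G' : Graph n} {X X' : VSet n} (f g : Fin n → Fin n → ℕ) →
  (∀ u v → 𝟙 (touch G X u v) + (f u v + f v u) ≤ 𝟙 (touch G' X' u v) + (g u v + g v u)) →
  ρ G X + ΣΣ f ≤ ρ G' X' + ΣΣ g
ρ-compare {G = G} {G'} {X} {X'} f g h = double-≤ (begin
  (ρ G X + ΣΣ f) + (ρ G X + ΣΣ f)                               ≡⟨ total G X f ⟨
  ΣΣ (λ u v → 𝟙 (touch G X u v) + (f u v + f v u))              ≤⟨ ΣΣ-mono h ⟩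
  ΣΣ (λ u v → 𝟙 (touch G' X' u v) + (g u v + g v u))            ≡⟨ total G' X' g ⟩
  (ρ G' X' + ΣΣ g) + (ρ G' X' + ΣΣ g)                           ∎)
  where
  open ≤-Reasoning
  total : ∀ G X f → ΣΣ (λ u v → 𝟙 (touch G X u v) + (f u v + f v u)) ≡ (ρ G X + ΣΣ f) + (ρ G X + ΣΣ f)
  total G X f = trans (ΣΣ-+ (λ u v → 𝟙 (touch G X u v)) (λ u v → f u v + f v u))
    (trans (cong₂ _+_ (ΣΣ-touch G X) (trans (ΣΣ-+ f (λ u v → f v u)) (cong (ΣΣ f +_) (sym (Σ-swap f)))))
           (+-swap (ρ G X) (ρ G X) (ΣΣ f) (ΣΣ f)))

compare-sym : ∀ {n} (G G' : Graph n) X X' (f g : Fin n → Fin n → ℕ) u v →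
  𝟙 (touch G X u v) + (f u v + f v u) ≤ 𝟙 (touch G' X' u v) + (g u v + g v u) →
  𝟙 (touch G X v u) + (f v u + f u v) ≤ 𝟙 (touch G' X' v u) + (g v u + g u v)
compare-sym G G' X X' f g u v h
  rewrite touch-sym G X v u | touch-sym G' X' v u | +-comm (f v u) (f u v) | +-comm (g v u) (g u v) = h

two-≤ : ∀ p c {t e} → (p ≡ true → t ≡ true ⊎ e ≡ true) → (c ≡ true → t ≡ true × e ≡ true) → 𝟙 p + 𝟙 c ≤ 𝟙 t + 𝟙 e
two-≤ p true f g with g refl
... | refl , refl = +-monoˡ-≤ 1 (𝟙≤1 p)
two-≤ false false f g = z≤n
two-≤ true false {t} f g with f refl
... | inj₁ refl = s≤s z≤n
... | inj₂ refl = m≤n+m 1 (𝟙 t)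

-- Common neighbours of x and y, where S is regarded as complete.
tri : ∀ {n} → Graph n → VSet n → Fin n → Fin n → ℕ
tri G S x y = # λ v → adj G x v ∧ (adj G y v ∨ (S y ∧ S v)) ∧ not (v == y)

==-refl : ∀ {n} (x : Fin n) → (x == x) ≡ true
==-refl x = ==-intro {i = x} refl

module _ {n} (G : Graph n) {x y : Fin n} (xy : Adj G x y) where

  private
    G' = contract G x y
    x≢y : x ≢ y
    x≢y = Adj-≢ G xy

    row : Fin n → VSet n → Fin n → Fin n → ℕ
    row a X u v = 𝟙 (u == a) * 𝟙 (X v)

    row-0 : ∀ a X {u} v → u ≢ a → row a X u v ≡ 0
    row-0 a X v p = cong (λ q → 𝟙 q * 𝟙 (X v)) (==-false p)

    row-0' : ∀ a X u {v} → v ∉ X → row a X u v ≡ 0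
    row-0' a X u p = trans (cong (λ q → 𝟙 (u == a) * 𝟙 q) p) (*-zeroʳ (𝟙 (u == a)))

    row-1 : ∀ a X v → row a X a v ≡ 𝟙 (X v)
    row-1 a X v = trans (cong (λ q → 𝟙 q * 𝟙 (X v)) (==-refl a)) (+-identityʳ _)

    ΣΣ-row' : ∀ a X → ΣΣ (row a X) ≡ # X
    ΣΣ-row' a X = ΣΣ-row a (𝟙 ∘ X)

    touch-x : ∀ X v → touch G' X x v ≡ false
    touch-x X v = ∉-intro λ p → proj₁ (contract-elim G x y {x} {v} (proj₁ (touch-elim G' X {x} {v} p))) refl

  contract-old : ∀ {u v} → u ≢ x → v ≢ x → Adj G u v → Adj G' u v
  contract-old {u} {v} p q e = contract-intro G {x} {y} {u} {v} (p , q , Adj-≢ G e , inj₁ e)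

  contract-new : ∀ {v} → v ≢ x → v ≢ y → Adj G x v → Adj G' y v
  contract-new {v} p q e = contract-intro G {x} {y} {y} {v} ((x≢y ∘ sym) , p , (q ∘ sym) , inj₂ (inj₁ (refl , e)))

  module _ (U S : VSet n) (x∈U : x ∈ U) (N⊆S : Nbd G U ⊆ S) where

    private
      U' = U ∖ ⁅ x ⁆
      new common : VSet n
      new v = adj G x v ∧ not (v == y) ∧ not (adj G y v) ∧ not (S y ∧ S v)
      common v = adj G x v ∧ (adj G y v ∨ (S y ∧ S v)) ∧ not (v == y)

      deg : # (adj G x) ≤ # new + # common + 1
      deg = ≤-trans (Σ-mono pt) (≤-reflexive (trans (Σ-+ (λ v → 𝟙 (new v) + 𝟙 (common v)) (𝟙 ∘ ⁅ y ⁆))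
              (cong₂ _+_ (#-++ new common) (#-single y))))
        where
        pt : ∀ v → 𝟙 (adj G x v) ≤ (𝟙 (new v) + 𝟙 (common v)) + 𝟙 (v == y)
        pt v with adj G x v | v == y | adj G y v | S y ∧ S v
        ... | false | _ | _ | _ = z≤n
        ... | true | true | a | b = m≤n+m 1 (0 + _)
        ... | true | false | true | b = s≤s z≤n
        ... | true | false | false | true = s≤s z≤n
        ... | true | false | false | false = s≤s z≤n

      new-elim : ∀ {v} → v ∈ new → Adj G x v × v ≢ y × adj G y v ≡ false × (S y ∧ S v) ≡ false
      new-elim {v} p with ∧-elim (adj G x v) p
      ... | a , q with ∧-elim (not (v == y)) q
      ...   | b , r with ∧-elim (not (adj G y v)) r
      ...     | c , d = a , (λ e → true≢false (==-intro e) (not-elim (v == y) b)) , not-elim _ c , not-elim _ d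

      new∌x : x ∉ new
      new∌x = cong (λ b → b ∧ (not (x == y) ∧ not (adj G y x) ∧ not (S y ∧ S x))) (adj-irrefl G x)
      new∌y : y ∉ new
      new∌y = ∉-intro λ p → proj₁ (proj₂ (new-elim p)) refl

      survives : ∀ {u v} → u ≢ x → v ≢ x → touch G U u v ≡ true → touch G' U' u v ≡ true
      survives {u} {v} p q t with touch-elim G U {u} {v} t
      ... | e , i = touch-intro G' U' (contract-old p q e)
                      ([ (λ r → inj₁ (∖-∈ U r p)) , (λ r → inj₂ (∖-∈ U r q)) ]′ i)

      created : ∀ {v} → v ∈ new → touch G' U' y v ≡ true
      created {v} p with new-elim p
      ... | xv , v≢y , _ , ¬SS = touch-intro G' U' (contract-new v≢x v≢y xv) side
        where
        v≢x : v ≢ x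
        v≢x = Adj-≢ G xv ∘ sym
        side : y ∈ U' ⊎ v ∈ U'
        side with adj-∪ G N⊆S x∈U xy | adj-∪ G N⊆S x∈U xv
        ... | inj₁ r | _ = inj₁ (∖-∈ U r (x≢y ∘ sym))
        ... | inj₂ r | inj₁ s = inj₂ (∖-∈ U s v≢x)
        ... | inj₂ r | inj₂ s = absurd (∧-intro r s) ¬SS

      f g : Fin n → Fin n → ℕ
      f = row y new
      g = row x (adj G x)

      Goal : Fin n → Fin n → Set
      Goal u v = 𝟙 (touch G U u v) + (f u v + f v u) ≤ 𝟙 (touch G' U' u v) + (g u v + g v u)

      flip : ∀ u v → Goal u v → Goal v u
      flip = compare-sym G G' U U' f g

      at-x : ∀ v → Goal x v
      at-x v rewrite row-0 y new v x≢y | row-0' y new v new∌x | +-identityʳ (𝟙 (touch G U x v)) =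
        ≤-trans (𝟙-mono {b = adj G x v} (λ p → proj₁ (touch-elim G U {x} {v} p)))
          (≤-trans (≤-reflexive (sym (row-1 x (adj G x) v))) (≤-trans (m≤m+n (g x v) (g v x)) (m≤n+m _ (𝟙 (touch G' U' x v)))))

      at-y : ∀ v → v ≢ x → Goal y v
      at-y v v≢x rewrite row-1 y new v | row-0' y new v new∌y | +-identityʳ (𝟙 (new v)) = ≤-trans le (m≤m+n _ _)
        where
        le : 𝟙 (touch G U y v) + 𝟙 (new v) ≤ 𝟙 (touch G' U' y v)
        le with bool (touch G U y v)
        ... | inj₂ p rewrite p = 𝟙-mono created
        ... | inj₁ p with bool (new v)
        ...   | inj₁ q = absurd (proj₁ (touch-elim G U {y} {v} p)) (proj₁ (proj₂ (proj₂ (new-elim q))))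
        ...   | inj₂ q rewrite p | q | survives {y} {v} (x≢y ∘ sym) v≢x p = ≤-refl

      off : ∀ u v → u ≢ x → v ≢ x → u ≢ y → v ≢ y → Goal u v
      off u v a b c d rewrite row-0 y new v c | row-0 y new u d | +-identityʳ (𝟙 (touch G U u v)) =
        ≤-trans (𝟙-mono {b = touch G' U' u v} (survives a b)) (m≤m+n _ _)

      cases : ∀ {u v} → Dec (u ≡ x) → Dec (v ≡ x) → Dec (u ≡ y) → Dec (v ≡ y) → Goal u v
      cases {v = v} (yes refl) _ _ _ = at-x v
      cases {u = u} (no a) (yes refl) _ _ = flip x u (at-x u)
      cases {v = v} (no a) (no b) (yes refl) _ = at-y v b
      cases {u = u} (no a) (no b) (no c) (yes refl) = flip y u (at-y u a)
      cases {u} {v} (no a) (no b) (no c) (no d) = off u v a b c d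

      goal : ∀ u v → Goal u v
      goal u v = cases (u ≟ x) (v ≟ x) (u ≟ y) (v ≟ y)

    -- An edge at x moves to y or is lost. Lost are xy, one edge per common neighbour and, if y is a
    -- root, the edges from x to other roots, since an edge inside S does not count in ρ(U). This is
    -- why `tri` regards S as complete.
    ρ-contract : ρ G U ≤ ρ G' U' + tri G S x y + 1
    ρ-contract = lin (ρ G U) (ρ G' U' + # common + 1) 0
      (+-mono-≤ (subst (λ t → ρ G U + # new ≤ ρ G' U' + t) (ΣΣ-row' x (adj G x))
        (subst (λ t → ρ G U + t ≤ ρ G' U' + ΣΣ g) (ΣΣ-row' y new) (ρ-compare {G = G} {G'} {U} {U'} f g goal))) deg)
      (eq (ρ G U) (# new) (ρ G' U') (# (adj G x)) (# common))
      where
      eq : ∀ a b c d e → a + (c + d + (b + e + 1)) + 0 ≡ c + e + 1 + (a + b + d)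
      eq = solve-∀

  module _ (Y : VSet n) (x∉Y : x ∉ Y) (y∉Y : y ∉ Y) where

    private
      ex cm : VSet n
      ex v = Y v ∧ adj G x v
      cm v = Y v ∧ adj G x v ∧ adj G y v

      f g : Fin n → Fin n → ℕ
      f u v = row x ex u v + row y cm u v
      g = row y ex

      Goal : Fin n → Fin n → Set
      Goal u v = 𝟙 (touch G' Y u v) + (f u v + f v u) ≤ 𝟙 (touch G Y u v) + (g u v + g v u)

      flip : ∀ u v → Goal u v → Goal v u
      flip = compare-sym G' G Y Y f g

      outside : ∀ {v} X → v ∉ Y → (Y v ∧ X) ≡ false
      outside X p rewrite p = refl

      at-x : ∀ v → Goal x v
      at-x v rewrite touch-x Y v | row-0 y cm v x≢y | row-1 x ex v | row-0' x ex v (outside {x} (adj G x x) x∉Y)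
        | row-0' y cm v (outside {x} (adj G x x ∧ adj G y x) x∉Y) | +-identityʳ (𝟙 (ex v)) | +-identityʳ (𝟙 (ex v)) =
        ≤-trans (𝟙-mono {b = touch G Y x v} λ p → let a , b = ∧-elim (Y v) p in touch-intro G Y {x} {v} b (inj₂ a)) (m≤m+n _ _)

      touch-y : ∀ v → touch G' Y y v ≡ true → v ∈ Y × (Adj G y v ⊎ Adj G x v)
      touch-y v p with touch-elim G' Y {y} {v} p
      ... | _ , inj₁ q = absurd q y∉Y
      ... | e , inj₂ q with contract-elim G x y {y} {v} e
      ...   | _ , _ , _ , inj₁ a = q , inj₁ a
      ...   | _ , _ , _ , inj₂ (inj₁ (_ , a)) = q , inj₂ a
      ...   | _ , _ , y≢v , inj₂ (inj₂ (a , _)) = ⊥-elim (y≢v (sym a))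

      at-y : ∀ v → v ≢ x → Goal y v
      at-y v v≢x rewrite row-0 x ex v (x≢y ∘ sym) | row-1 y cm v | row-1 y ex v | row-0 x ex y v≢x
        | row-0' y cm v (outside {y} (adj G x y ∧ adj G y y) y∉Y) | +-identityʳ (𝟙 (cm v)) =
        ≤-trans le (+-monoʳ-≤ (𝟙 (touch G Y y v)) (m≤m+n (𝟙 (ex v)) (g v y)))
        where
        le : 𝟙 (touch G' Y y v) + 𝟙 (cm v) ≤ 𝟙 (touch G Y y v) + 𝟙 (ex v)
        le = two-≤ (touch G' Y y v) (cm v)
          (λ p → let q , r = touch-y v p in [ (λ a → inj₁ (touch-intro G Y {y} {v} a (inj₂ q))) , (λ a → inj₂ (∧-intro q a)) ]′ r)
          (λ p → let q , r = ∧-elim (Y v) p ; a , b = ∧-elim (adj G x v) r in touch-intro G Y {y} {v} b (inj₂ q) , ∧-intro q a)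

      off : ∀ u v → u ≢ x → v ≢ x → u ≢ y → v ≢ y → Goal u v
      off u v a b c d rewrite row-0 x ex v a | row-0 x ex u b | row-0 y cm v c | row-0 y cm u d | +-identityʳ (𝟙 (touch G' Y u v)) =
        ≤-trans (𝟙-mono {b = touch G Y u v} old) (m≤m+n _ _)
        where
        old : touch G' Y u v ≡ true → touch G Y u v ≡ true
        old p with touch-elim G' Y {u} {v} p
        ... | e , i with contract-elim G x y {u} {v} e
        ...   | _ , _ , _ , inj₁ e' = touch-intro G Y e' i
        ...   | _ , _ , _ , inj₂ (inj₁ (q , _)) = ⊥-elim (c q)
        ...   | _ , _ , _ , inj₂ (inj₂ (q , _)) = ⊥-elim (d q)

      cases : ∀ {u v} → Dec (u ≡ x) → Dec (v ≡ x) → Dec (u ≡ y) → Dec (v ≡ y) → Goal u v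
      cases {v = v} (yes refl) _ _ _ = at-x v
      cases {u = u} (no a) (yes refl) _ _ = flip x u (at-x u)
      cases {v = v} (no a) (no b) (yes refl) _ = at-y v b
      cases {u = u} (no a) (no b) (no c) (yes refl) = flip y u (at-y u a)
      cases {u} {v} (no a) (no b) (no c) (no d) = off u v a b c d

      goal : ∀ u v → Goal u v
      goal u v = cases (u ≟ x) (v ≟ x) (u ≟ y) (v ≟ y)

    -- For `Y` away from x and y, contraction merges two edges at each common neighbour in `Y` and
    -- changes no other count. One such neighbour later supplies a second excess edge.
    ρ-contract-off : ρ G' Y + (# λ v → Y v ∧ adj G x v ∧ adj G y v) ≤ ρ G Y
    ρ-contract-off = lin (ρ G' Y + # cm) (ρ G Y) 0 (subst (λ t → ρ G' Y + t ≤ ρ G Y + ΣΣ g)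
        (trans (ΣΣ-+ (row x ex) (row y cm)) (cong₂ _+_ (ΣΣ-row' x ex) (ΣΣ-row' y cm)))
        (ρ-compare {G = G'} {G} {Y} {Y} f g goal))
      (trans (cong (λ t → ρ G' Y + # cm + (ρ G Y + t) + 0) (ΣΣ-row' y ex)) (eq (ρ G' Y) (# cm) (ρ G Y) (# ex)))
      where
      eq : ∀ a b c d → a + b + (c + d) + 0 ≡ c + (a + (d + b))
      eq = solve-∀

rigid⇒with : ∀ {n} (G : Graph n) {X S B} → Rigid G X → RigidWith G X S B
rigid⇒with G rig B' two B'⊆ _ = rig B' B'⊆ two

rigid⇒for : ∀ {n} (G : Graph n) {X PA PB r} → Rigid G X → RigidFor G X PA PB r
rigid⇒for G {X} rig T B T⊆ _ B⊆ two _ _ = feas-mono {G = G} {G' = G} (λ _ _ e → e) (λ _ p → p)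
  (λ v p → let q , r = ∖-elim T B p in ∖-intro (Nbd G X) B (T⊆ v q) r) (λ _ p → p) (rig B (⊆-trans B⊆ T⊆) two)

AtMost2-⊆ : ∀ {n} {B B' : VSet n} → B' ⊆ B → AtMost2 B → AtMost2 B'
AtMost2-⊆ s (b , b' , h) = b , b' , λ v p → h v (s v p)

module _ {n k u} (ih : MassedBelow n k u) (G : Graph n) (U S B : VSet n) (m : Massed k G U S B) (U≤u : # U ≤ u)
         {x y : Fin n} (x∈U : x ∈ U) (xy : Adj G x y) where
  open Massed m

  private
    G' = contract G x y
    U' = U ∖ ⁅ x ⁆
    x≢y : x ≢ y
    x≢y = Adj-≢ G xy
    <u : # U' < u
    <u = ≤-trans (#-remove U x x∈U) U≤u

  -- If the contraction is not sparse, it has a rigid violator `Z`. With `y ∈ Z`, adding x gives a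
  -- rigid set of `G` with the same neighbourhood, small enough for `rigid-small`. With `y ∉ Z`,
  -- sparseness of `G` puts x and y into N(Z), and `Z` turns out to be rigid in `G`.
  contract-massed-feas : Dense k G' U' S B → Feas G (U ∪ S) S B
  contract-massed-feas dn = go (violator? k G' U' (# S))
    where
    x∉S : x ∉ S
    x∉S = disjoint x x∈U
    U'≢x : ∀ {v} → v ∈ U' → v ≢ x
    U'≢x p = proj₂ (∖-∉ U p)
    U'⊆U : U' ⊆ U
    U'⊆U v p = proj₁ (∖-∉ U p)
    nbd' : Nbd G' U' ⊆ S
    nbd' v p with Nbd-elim G' U' p
    ... | v∉ , w , w∈ , wv with contract-elim G x y {w} {v} wv
    ...   | _ , v≢x , _ , inj₁ e = out (adj-∪ G nbd (U'⊆U w w∈) e)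
      where
      out : v ∈ U ⊎ v ∈ S → v ∈ S
      out (inj₁ q) = absurd (∖-∈ U q v≢x) v∉
      out (inj₂ q) = q
    ...   | _ , v≢x , _ , inj₂ (inj₁ (_ , e)) = [ (λ q → absurd (∖-∈ U q v≢x) v∉) , id ]′ (adj-∪ G nbd x∈U e)
    ...   | _ , v≢x , _ , inj₂ (inj₂ (refl , e)) = [ (λ q → absurd (∖-∈ U q v≢x) v∉) , id ]′ (adj-∪ G nbd x∈U xy)
    go : _ → Feas G (U ∪ S) S B
    go (inj₂ none) = contract-feas G {D = U' ∪ S} xy
      (∨-false (∉-intro λ p → U'≢x p refl) x∉S)
      (λ v p → [ (λ q → ∨-introˡ (U'⊆U v q)) , ∨-introʳ (U v) ]′ (∨-elim (U' v) p))
      (λ _ → ∨-introˡ x∈U) (λ _ p → inj₁ p) (λ _ p → inj₁ p)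
      (ih G' U' S B <u (massed (λ v p → disjoint v (U'⊆U v p)) nbd' roles two order
        (λ X s l → ≮⇒≥ λ q → none X (s , l , q)) dn))
    go (inj₁ (X , X⊆ , X< , exX)) with rigid-violator ih (suc (# (Nbd G' X))) G' X ≤-refl
         (≤-trans (s≤s (#-mono X U' X⊆)) <u) (s≤s⁻¹ (≤-trans X< order)) exX
    ... | Z , Z⊆X , Z≤ , ex , rigZ = [ absorbed , separated ]′ (bool (Z y))
      where
      Z⊆U' : Z ⊆ U'
      Z⊆U' = ⊆-trans Z⊆X X⊆
      Z⊆U : Z ⊆ U
      Z⊆U = ⊆-trans Z⊆U' U'⊆U
      NZ< : # (Nbd G' Z) < # S
      NZ< = ≤-trans (s≤s Z≤) X<
      Z≢x : ∀ {v} → v ∈ Z → v ≢ x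
      Z≢x p = U'≢x (Z⊆U' _ p)
      x∉Z : x ∉ Z
      x∉Z = ∉-intro λ p → Z≢x p refl
      N'≢x : ∀ {v} → v ∈ Nbd G' Z → v ≢ x
      N'≢x {v} p with Nbd-elim G' Z p
      ... | _ , w , _ , wv = proj₁ (proj₂ (contract-elim G x y {w} {v} wv))
      x∉D : x ∉ closed G' Z
      x∉D = ∨-false x∉Z (∉-intro λ p → N'≢x p refl)

      absorbed : y ∈ Z → Feas G (U ∪ S) S B
      absorbed y∈Z = rigid-small ih G U S B m U≤u (suc (# (U ∖ W))) W ≤-refl
          (λ v p → [ Z⊆U v , (λ q → subst (_∈ U) (sym (==-elim v x q)) x∈U) ]′ (∨-elim (Z v) p)) y (∨-introˡ y∈Z)
          (≤-trans (s≤s (#-mono (Nbd G W) (Nbd G' Z) to)) NZ<) (rigid⇒with G rigW)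
        where
        W = Z ∪ ⁅ x ⁆
        x∈W : x ∈ W
        x∈W = ∨-introʳ (Z x) (==-refl x)
        to : Nbd G W ⊆ Nbd G' Z
        to v p with Nbd-elim G W p
        ... | v∉W , w , w∈W , wv = [ (λ q → ∈-Nbd G' Z v∉Z q (contract-old G xy (Z≢x q) v≢x wv))
                                   , (λ q → ∈-Nbd G' Z v∉Z y∈Z (contract-new G xy v≢x (∈∉⇒≢ Z y∈Z v∉Z ∘ sym)
                                              (subst (λ t → Adj G t v) (==-elim w x q) wv))) ]′ (∨-elim (Z w) w∈W)
          where
          v∉Z : v ∉ Z
          v∉Z = ∉-intro λ q → true≢false (∨-introˡ q) v∉W
          v≢x : v ≢ x
          v≢x = ∈∉⇒≢ W x∈W v∉W ∘ sym
        from : Nbd G' Z ⊆ Nbd G W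
        from v p with Nbd-elim G' Z p
        ... | v∉Z , w , w∈Z , wv with contract-elim G x y {w} {v} wv
        ...   | _ , v≢x , _ , inj₁ e = ∈-Nbd G W (∨-false v∉Z (==-false v≢x)) (∨-introˡ w∈Z) e
        ...   | _ , v≢x , _ , inj₂ (inj₁ (_ , e)) = ∈-Nbd G W (∨-false v∉Z (==-false v≢x)) x∈W e
        ...   | _ , _ , _ , inj₂ (inj₂ (refl , _)) = absurd y∈Z v∉Z
        rigW : Rigid G W
        rigW B' B'⊆ two' = contract-feas G {D = closed G' Z} xy x∉D
          (λ v p → [ (λ q → ∨-introˡ (∨-introˡ q)) , (λ q → ∨-introʳ (W v) (from v q)) ]′ (∨-elim (Z v) p))
          (λ _ → ∨-introˡ x∈W)
          (λ v p → let q , r = ∖-elim (Nbd G W) B' p in inj₁ (∖-intro (Nbd G' Z) B' (to v q) r))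
          (λ _ p → inj₁ p) (rigZ B' (⊆-trans B'⊆ to) two')

      separated : y ∉ Z → Feas G (U ∪ S) S B
      separated y∉Z = split (bool (Nbd G Z x)) (bool (Nbd G Z y))
        where
        N⊆N' : ∀ {v} → v ≢ x → v ∈ Nbd G Z → v ∈ Nbd G' Z
        N⊆N' v≢x p with Nbd-elim G Z p
        ... | v∉Z , w , w∈Z , wv = ∈-Nbd G' Z v∉Z w∈Z (contract-old G xy (Z≢x w∈Z) v≢x wv)

        ρ≤ : ρ G' Z + (# λ v → Z v ∧ adj G x v ∧ adj G y v) ≤ ρ G Z
        ρ≤ = ρ-contract-off G xy Z x∉Z y∉Z

        -- `Z` touches at least as many edges in `G` as in the contraction, so an order below |S| in
        -- `G` contradicts sparseness.
        impossible : # (Nbd G Z) ≤ # (Nbd G' Z) → Feas G (U ∪ S) S B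
        impossible le = ⊥-elim (<⇒≱ ex (≤-trans (m≤m+n _ _) (≤-trans ρ≤ (sparse Z Z⊆U (≤-trans (s≤s le) NZ<)))))

        almost : # (Nbd G Z) ≤ suc (# (Nbd G Z ∖ ⁅ x ⁆))
        almost = ≤-trans (#-∪-≤ (Nbd G Z ∖ ⁅ x ⁆) ⁅ x ⁆ (Nbd G Z) (λ v p →
            [ inj₂ , (λ q → inj₁ (∖-intro (Nbd G Z) (⁅ x ⁆) p q)) ]′ (bool (v == x))))
          (≤-reflexive (trans (cong (# (Nbd G Z ∖ ⁅ x ⁆) +_) (#-single x)) (+-comm _ 1)))

        minus-x : Nbd G Z ∖ ⁅ x ⁆ ⊆ Nbd G' Z
        minus-x v p = let q , r = ∖-∉ (Nbd G Z) {v} {x} p in N⊆N' r q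

        split : _ → _ → Feas G (U ∪ S) S B
        split (inj₂ x∉N) _ = impossible (#-mono (Nbd G Z) (Nbd G' Z) λ v p → N⊆N' (∈∉⇒≢ (Nbd G Z) p x∉N) p)
        -- The contraction exchanges `x` for `y` in the neighbourhood, so the order does not drop.
        split (inj₁ x∈N) (inj₂ y∉N) = impossible (≤-trans almost (#-< (Nbd G Z ∖ ⁅ x ⁆) (Nbd G' Z) y minus-x y∈N'
            (∉-intro λ p → true≢false (proj₁ (∖-∉ (Nbd G Z) {y} {x} p)) y∉N)))
          where
          y∈N' : y ∈ Nbd G' Z
          y∈N' with Nbd-elim G Z x∈N
          ... | _ , w , w∈Z , wx = ∈-Nbd G' Z y∉Z w∈Z (contract-intro G {x} {y} {w} {y}
                  (Z≢x w∈Z , (x≢y ∘ sym) , ∈∉⇒≢ Z w∈Z y∉Z , inj₂ (inj₂ (refl , wx))))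
        split (inj₁ x∈N) (inj₁ y∈N) = rigid-set ih G U S B m U≤u Z Z⊆U z z∈Z (rigid⇒for G rigG)
          where
          z = proj₁ (proj₂ (Nbd-elim G Z x∈N))
          z∈Z : z ∈ Z
          z∈Z = proj₁ (proj₂ (proj₂ (Nbd-elim G Z x∈N)))
          y∈N' : y ∈ Nbd G' Z
          y∈N' = N⊆N' (x≢y ∘ sym) y∈N
          N'⊆N : Nbd G' Z ⊆ Nbd G Z
          N'⊆N v p with Nbd-elim G' Z p
          ... | v∉Z , w , w∈Z , wv with contract-elim G x y {w} {v} wv
          ...   | _ , _ , _ , inj₁ e = ∈-Nbd G Z v∉Z w∈Z e
          ...   | _ , _ , _ , inj₂ (inj₁ (refl , _)) = absurd w∈Z y∉Z
          ...   | _ , _ , _ , inj₂ (inj₂ (refl , _)) = y∈N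
          order' : # (Nbd G Z) ≤ # S
          order' = ≤-trans almost (≤-trans (s≤s (#-mono (Nbd G Z ∖ ⁅ x ⁆) (Nbd G' Z) minus-x)) NZ<)

          -- x and y have the same role: use the contraction.
          same : ∀ B' → B' ⊆ Nbd G Z → AtMost2 B' → (x ∈ B' → y ∈ B') → (x ∉ B' → y ∉ B') → Feas G (closed G Z) (Nbd G Z) B'
          same B' B'⊆ two' f g = contract-feas G {D = closed G' Z} {S = Nbd G' Z} {B = B' ∖ ⁅ x ⁆} xy x∉D
              (λ v p → [ ∨-introˡ , (λ q → ∨-introʳ (Z v) (N'⊆N v q)) ]′ (∨-elim (Z v) p))
              (λ _ → ∨-introʳ (Z x) x∈N) (λ a p → roleA p (a ≟ x)) (λ b p → roleB p (b ≟ x))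
              (rigZ (B' ∖ ⁅ x ⁆) (λ v p → let q , r = ∖-∉ B' {v} {x} p in N⊆N' r (B'⊆ v q))
                (AtMost2-⊆ (λ v p → proj₁ (∖-∉ B' {v} {x} p)) two'))
            where
            still : ∀ {v} → v ∈ Nbd G' Z → v ∉ B' → v ∈ Nbd G' Z ∖ (B' ∖ ⁅ x ⁆)
            still {v} p q = ∖-intro (Nbd G' Z) (B' ∖ ⁅ x ⁆) p (∉-intro λ r → true≢false (proj₁ (∖-∉ B' {v} {x} r)) q)
            roleA : ∀ {a} → a ∈ Nbd G Z ∖ B' → Dec (a ≡ x) → a ∈ Nbd G' Z ∖ (B' ∖ ⁅ x ⁆) ⊎ (a ≡ x × y ∈ Nbd G' Z ∖ (B' ∖ ⁅ x ⁆))
            roleA p (yes refl) = inj₂ (refl , still y∈N' (g (proj₂ (∖-elim (Nbd G Z) B' p))))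
            roleA p (no q) = let r , s = ∖-elim (Nbd G Z) B' p in inj₁ (still (N⊆N' q r) s)
            roleB : ∀ {b} → b ∈ B' → Dec (b ≡ x) → b ∈ B' ∖ ⁅ x ⁆ ⊎ (b ≡ x × y ∈ B' ∖ ⁅ x ⁆)
            roleB p (yes refl) = inj₂ (refl , ∖-∈ B' (f p) (x≢y ∘ sym))
            roleB p (no q) = inj₁ (∖-∈ B' p q)

          -- x and y have different roles: a common neighbour in Z gives an edge more, none gives the bonus.
          different : ∀ B' → B' ⊆ Nbd G Z → AtMost2 B' →
            (∃ λ a → ∃ λ b → a ∈ Nbd G Z ∖ B' × b ∈ B' × (∀ w → Adj G a w → Adj G b w → Adj G x w × Adj G y w)) →
            Feas G (closed G Z) (Nbd G Z) B'
          different B' B'⊆ two' (a , b , a∈ , b∈ , h) = ih G Z (Nbd G Z) B' (≤-trans (s≤s (#-mono Z U' Z⊆U')) <u)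
              (massed (self-disjoint G Z) (λ _ p → p) B'⊆ two' (≤-trans order' order)
                (λ X s l → sparse X (⊆-trans s Z⊆U) (≤-trans l order')) dns)
            where
            C : VSet n
            C v = Z v ∧ adj G x v ∧ adj G y v
            dns : Dense k G Z (Nbd G Z) B'
            dns with bool (anyᵇ C)
            ... | inj₂ p = inj₂ (≤-trans (≤-reflexive (+-comm _ 1)) (≤-trans ex (≤-trans (m≤m+n _ _) ρ≤))
                  , inj₂ (a , b , a∈ , b∈ , λ w w∈ e f → let e' , f' = h w e f in
                      true≢false (∧-intro w∈ (∧-intro e' f')) (any-false C p w)))
            ... | inj₁ p with any-elim C p
            ...   | w , q = inj₁ (≤-trans (≤-reflexive (eq (k * # Z))) (≤-trans (+-mono-≤ ex (#-∈ C w q)) ρ≤))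
              where
              eq : ∀ a → a + 2 ≡ suc a + 1
              eq = solve-∀

          rigG : Rigid G Z
          rigG B' B'⊆ two' = pick (bool (B' x)) (bool (B' y))
            where
            pick : _ → _ → Feas G (closed G Z) (Nbd G Z) B'
            pick (inj₁ p) (inj₁ q) = same B' B'⊆ two' (λ _ → q) (λ r → absurd p r)
            pick (inj₂ p) (inj₂ q) = same B' B'⊆ two' (λ r → absurd r p) (λ _ → q)
            pick (inj₁ p) (inj₂ q) = different B' B'⊆ two' (y , x , ∖-intro (Nbd G Z) B' y∈N q , p , λ _ e f → f , e)
            pick (inj₂ p) (inj₁ q) = different B' B'⊆ two' (x , y , ∖-intro (Nbd G Z) B' x∈N p , q , λ _ e f → e , f)

-- Counting in the neighbourhood of a vertex of small degree

Component : ∀ {n} → Graph n → VSet n → Fin n → VSet n → Set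
Component G R a K = K ⊆ R × a ∈ K × (∀ v → v ∈ K → Walk G R a v) × (∀ {v w} → v ∈ K → w ∈ R → Adj G v w → w ∈ K)

component : ∀ {n} (G : Graph n) (R : VSet n) a → a ∈ R → ∃ (Component G R a)
component {n} G R a a∈R = grow (suc (# (R ∖ ⁅ a ⁆))) ⁅ a ⁆ ≤-refl (λ v p → subst (_∈ R) (sym (==-elim v a p)) a∈R) (==-refl a)
    (λ v p → subst (Walk G R a) (sym (==-elim v a p)) (nil a∈R))
  where
  grow : ∀ fuel K → # (R ∖ K) < fuel → K ⊆ R → a ∈ K → (∀ v → v ∈ K → Walk G R a v) → ∃ (Component G R a)
  grow (suc fuel) K (s≤s le) K⊆R a∈K walk with find (R ∩ Nbd G K) ∅
  ... | inj₁ none = K , K⊆R , a∈K , walk , λ {v} {w} v∈K w∈R e →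
        [ id , (λ w∉K → absurd (none w (∧-intro w∈R (∈-Nbd G K w∉K v∈K e))) refl) ]′ (bool (K w))
  ... | inj₂ (w , p , _) with ∧-elim (R w) p
  ...   | w∈R , w∈N with Nbd-elim G K w∈N
  ...     | w∉K , v , v∈K , vw = grow fuel (K ∪ ⁅ w ⁆)
        (≤-trans (#-< (R ∖ (K ∪ ⁅ w ⁆)) (R ∖ K) w
           (λ x q → let r , s = ∖-elim R (K ∪ ⁅ w ⁆) q in ∖-intro R K r (∉-intro λ t → true≢false (∨-introˡ t) s))
           (∖-intro R K w∈R w∉K)
           (∉-intro λ q → true≢false (∨-introʳ (K w) (==-refl w)) (proj₂ (∖-elim R (K ∪ ⁅ w ⁆) q)))) le)
        (λ x q → [ K⊆R x , (λ r → subst (_∈ R) (sym (==-elim x w r)) w∈R) ]′ (∨-elim (K x) q))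
        (∨-introˡ a∈K)
        (λ x q → [ walk x , (λ r → subst (Walk G R a) (sym (==-elim x w r)) (walk v v∈K ++ cons (K⊆R v v∈K) vw (nil w∈R))) ]′ (∨-elim (K x) q))

sing : ∀ {n} → Bool → Fin n → VSet n
sing c x v = (v == x) ∧ c

#-sing : ∀ {n} c (x : Fin n) → # (sing c x) ≡ 𝟙 c
#-sing true  x = trans (#-cong (λ v → ∧-true (v == x))) (#-single x)
  where
  ∧-true : ∀ a → a ∧ true ≡ a
  ∧-true true  = refl
  ∧-true false = refl
#-sing false x = #-∅ λ v → ∧-false (v == x)
  where
  ∧-false : ∀ a → a ∧ false ≡ false
  ∧-false true  = refl
  ∧-false false = refl

sing-elim : ∀ {n} c (x v : Fin n) → v ∈ sing c x → v ≡ x × c ≡ true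
sing-elim c x v p = let q , r = ∧-elim (v == x) p in ==-elim v x q , r

sing-intro : ∀ {n} {c} (x : Fin n) → c ≡ true → x ∈ sing c x
sing-intro x p = ∧-intro (==-refl x) p

-- The refuting form of `lin`: the hypotheses sum to `L ≤ R`, but the identity shows that `L`
-- exceeds `R` by `suc d`.
absurd-lin : ∀ {L R} d → L ≤ R → R + suc d ≡ L → ⊥
absurd-lin {L} {R} d h e = <⇒≱ (≤-trans (≤-trans (s≤s (m≤m+n R d)) (≤-reflexive (sym (+-suc R d)))) (≤-reflexive e)) h

record Split {n} (G : Graph n) (N K L : VSet n) (b b' : Fin n) : Set where
  constructor split
  field
    b∈N   : b ∈ N
    b'∈N  : b' ∈ N
    b≢b'  : b ≢ b'
    b≁b'  : adj G b b' ≡ false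
    K⊆N   : K ⊆ N
    L⊆N   : L ⊆ N
    cover : ∀ v → v ∈ N → (v ≡ b ⊎ v ≡ b') ⊎ (v ∈ K ⊎ v ∈ L)
    disj  : Disjoint K L
    b∉K   : b ∉ K
    b'∉K  : b' ∉ K
    b∉L   : b ∉ L
    b'∉L  : b' ∉ L
    cut   : ∀ {x y} → x ∈ K → y ∈ L → adj G x y ≡ false

split-swap : ∀ {n} {G : Graph n} {N K L b b'} → Split G N K L b b' → Split G N L K b b'
split-swap {G = G} (split a b c d e f g h i j k l m) = split a b c d f e
  (λ v p → [ inj₁ , (λ q → inj₂ ([ inj₂ , inj₁ ]′ q)) ]′ (g v p))
  (λ v p → ∉-intro λ q → true≢false p (h v q)) k l i j (λ p q → trans (adj-sym G _ _) (m q p))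

split-flip : ∀ {n} {G : Graph n} {N K L b b'} → Split G N K L b b' → Split G N K L b' b
split-flip {G = G} (split a b c d e f g h i j k l m) = split b a (c ∘ sym) (trans (adj-sym G _ _) d) e f
  (λ v p → [ (λ q → inj₁ ([ inj₂ , inj₁ ]′ q)) , inj₂ ]′ (g v p)) h j i l k m

module _ {n} (G : Graph n) (N S K L : VSet n) (b b' : Fin n) (sp : Split G N K L b b') where
  open Split sp

  #-inside : # K + # L + 2 ≤ # (N ∖ S) + # (N ∩ S)
  #-inside = ≤-trans (≤-reflexive (trans (eq (# K + # L)) (sym (cong₂ (λ p q → # K + # L + p + q) (#-single b) (#-single b')))))
    (≤-trans (+-monoˡ-≤ (# ⁅ b' ⁆) (≤-trans (+-monoˡ-≤ (# ⁅ b ⁆) (#-∪-≥ K L (K ∪ L) (λ _ → ∨-introˡ) (λ v → ∨-introʳ (K v)) disj))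
       (#-∪-≥ (K ∪ L) ⁅ b ⁆ KLb (λ _ → ∨-introˡ) (λ v → ∨-introʳ ((K ∪ L) v))
         (λ v p → ∉-intro λ q → outK∪L b b∉K b∉L (subst (_∈ K ∪ L) (==-elim v b q) p)))))
    (≤-trans (#-∪-≥ KLb ⁅ b' ⁆ N
         (λ v p → [ (λ q → [ K⊆N v , L⊆N v ]′ (∨-elim (K v) q)) , (λ q → subst (_∈ N) (sym (==-elim v b q)) b∈N) ]′ (∨-elim ((K ∪ L) v) p))
         (λ v p → subst (_∈ N) (sym (==-elim v b' p)) b'∈N)
         (λ v p → ∉-intro λ q → [ (λ r → outK∪L b' b'∉K b'∉L (subst (_∈ K ∪ L) (==-elim v b' q) r))
                                    , (λ r → b≢b' (trans (sym (==-elim v b r)) (==-elim v b' q))) ]′ (∨-elim ((K ∪ L) v) p)))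
      (#-∪-≤ (N ∖ S) (N ∩ S) N λ v p → [ (λ q → inj₂ (∧-intro p q)) , (λ q → inj₁ (∖-intro N S p q)) ]′ (bool (S v)))))
    where
    KLb = (K ∪ L) ∪ ⁅ b ⁆
    eq : ∀ a → a + 2 ≡ a + 1 + 1
    eq = solve-∀
    outK∪L : ∀ x → x ∉ K → x ∉ L → x ∈ K ∪ L → ⊥
    outK∪L x p q r = [ (λ s → true≢false s p) , (λ s → true≢false s q) ]′ (∨-elim (K x) r)

  -- f records whether r is a vertex of K not adjacent to p.
  degree-K : ∀ {p} → p ∈ K → ∀ f r → (f ≡ true → r ∈ K × adj G p r ≡ false × r ≢ p) →
    # (N ∩ adj G p) + 𝟙 f + 1 ≤ # K + (𝟙 (adj G p b) + 𝟙 (adj G p b'))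
  degree-K {p} p∈K f r h = ≤-trans (≤-reflexive (sym (cong₂ (λ x y → # (N ∩ adj G p) + x + y) (#-sing f r) (#-single p))))
    (≤-trans (+-monoˡ-≤ (# ⁅ p ⁆) (#-∪-≥ (N ∩ adj G p) (sing f r) X (λ _ → ∨-introˡ) (λ v → ∨-introʳ ((N ∩ adj G p) v))
       (λ v q → ∉-intro λ s → let t , ft = sing-elim f r v s in
          true≢false (subst (Adj G p) t (proj₂ (∧-elim (N v) q))) (proj₁ (proj₂ (h ft))))))
    (≤-trans (#-∪-≥ X ⁅ p ⁆ Z X⊆Z (λ v q → subst (_∈ Z) (sym (==-elim v p q)) (∨-introˡ p∈K))
       (λ v q → ∉-intro λ s → X∌p (subst (_∈ X) (==-elim v p s) q)))
    (≤-trans (#-∪-≤ K (sing (adj G p b) b ∪ sing (adj G p b') b') Z (λ v → ∨-elim (K v)))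
      (+-monoʳ-≤ (# K) (≤-trans (#-∪-≤ (sing (adj G p b) b) (sing (adj G p b') b') _ (λ v → ∨-elim (sing (adj G p b) b v)))
        (≤-reflexive (cong₂ _+_ (#-sing (adj G p b) b) (#-sing (adj G p b') b'))))))))
    where
    X = (N ∩ adj G p) ∪ sing f r
    Z = K ∪ (sing (adj G p b) b ∪ sing (adj G p b') b')
    X∌p : p ∈ X → ⊥
    X∌p q = [ (λ s → Adj-≢ G (proj₂ (∧-elim (N p) s)) refl)
            , (λ s → let t , ft = sing-elim f r p s in proj₂ (proj₂ (h ft)) (sym t)) ]′ (∨-elim ((N ∩ adj G p) p) q)
    X⊆Z : X ⊆ Z
    X⊆Z v q with ∨-elim ((N ∩ adj G p) v) q
    ... | inj₂ s with sing-elim f r v s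
    ...   | refl , ft = ∨-introˡ (proj₁ (h ft))
    X⊆Z v q | inj₁ s with ∧-elim (N v) s
    ...   | v∈N , pv with cover v v∈N
    ...     | inj₁ (inj₁ refl) = ∨-introʳ (K v) (∨-introˡ (sing-intro v pv))
    ...     | inj₁ (inj₂ refl) = ∨-introʳ (K v) (∨-introʳ (sing (adj G p b) b v) (sing-intro v pv))
    ...     | inj₂ (inj₁ t) = ∨-introˡ t
    ...     | inj₂ (inj₂ t) = absurd pv (cut p∈K t)

  -- Within `N` a vertex of `K` sees only `K`, b and b', and here `K` has nothing outside `S`.
  degree-S : ∀ {s} → s ∈ K → (∀ v → v ∈ K → v ∈ S) →
    # ((N ∖ S) ∩ adj G s) ≤ 𝟙 ((N ∖ S) b ∧ adj G s b) + 𝟙 ((N ∖ S) b' ∧ adj G s b')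
  degree-S {s} s∈K K⊆S = ≤-trans (#-∪-≤ (sing ((N ∖ S) b ∧ adj G s b) b) (sing ((N ∖ S) b' ∧ adj G s b') b') ((N ∖ S) ∩ adj G s) to)
    (≤-reflexive (cong₂ _+_ (#-sing ((N ∖ S) b ∧ adj G s b) b) (#-sing ((N ∖ S) b' ∧ adj G s b') b')))
    where
    to : ∀ v → v ∈ (N ∖ S) ∩ adj G s → v ∈ sing ((N ∖ S) b ∧ adj G s b) b ⊎ v ∈ sing ((N ∖ S) b' ∧ adj G s b') b'
    to v p with ∧-elim ((N ∖ S) v) p
    ... | q , sv with ∖-elim N S q
    ...   | v∈N , v∉S with cover v v∈N
    ...     | inj₁ (inj₁ refl) = inj₁ (sing-intro v p)
    ...     | inj₁ (inj₂ refl) = inj₂ (sing-intro v p)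
    ...     | inj₂ (inj₁ t) = absurd (K⊆S v t) v∉S
    ...     | inj₂ (inj₂ t) = absurd sv (cut s∈K t)

  degree-b : ∀ f r → (f ≡ true → r ∈ K ∪ L × adj G b r ≡ false) → # (N ∩ adj G b) + 𝟙 f ≤ # K + # L
  degree-b f r h = ≤-trans (≤-reflexive (cong (# (N ∩ adj G b) +_) (sym (#-sing f r))))
    (≤-trans (#-∪-≥ (N ∩ adj G b) (sing f r) (K ∪ L) to
       (λ v p → let q , ft = sing-elim f r v p in subst (_∈ K ∪ L) (sym q) (proj₁ (h ft)))
       (λ v p → ∉-intro λ q → let t , ft = sing-elim f r v q in
          true≢false (subst (Adj G b) t (proj₂ (∧-elim (N v) p))) (proj₂ (h ft))))
     (#-∪-≤ K L (K ∪ L) (λ v → ∨-elim (K v))))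
    where
    to : N ∩ adj G b ⊆ K ∪ L
    to v p with ∧-elim (N v) p
    ... | v∈N , bv with cover v v∈N
    ...   | inj₁ (inj₁ refl) = ⊥-elim (Adj-≢ G bv refl)
    ...   | inj₁ (inj₂ refl) = absurd bv b≁b'
    ...   | inj₂ (inj₁ t) = ∨-introˡ t
    ...   | inj₂ (inj₂ t) = ∨-introʳ (K v) t

  common-nbrs : VSet n
  common-nbrs v = N v ∧ adj G b v ∧ adj G b' v

  -- As b and b' are not adjacent, their neighbours in `N` lie in `K ∪ L`; only the common ones are
  -- counted twice.
  degree-bb : # (N ∩ adj G b) + # (N ∩ adj G b') ≤ # K + # L + # common-nbrs
  degree-bb = ≤-trans (≤-reflexive (sym (#-++ (N ∩ adj G b) (N ∩ adj G b')))) (≤-trans (Σ-mono pt)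
    (≤-trans (≤-reflexive (#-++ (K ∪ L) common-nbrs)) (+-monoˡ-≤ (# common-nbrs) (#-∪-≤ K L (K ∪ L) (λ v → ∨-elim (K v))))))
    where
    inside : ∀ v → v ∈ N → Adj G b v ⊎ Adj G b' v → v ∈ K ∪ L
    inside v v∈N e with cover v v∈N
    ... | inj₁ (inj₁ refl) = ⊥-elim ([ (λ f → Adj-≢ G f refl) , (λ f → true≢false f (trans (adj-sym G b' b) b≁b')) ]′ e)
    ... | inj₁ (inj₂ refl) = ⊥-elim ([ (λ f → true≢false f b≁b') , (λ f → Adj-≢ G f refl) ]′ e)
    ... | inj₂ (inj₁ t) = ∨-introˡ t
    ... | inj₂ (inj₂ t) = ∨-introʳ (K v) t
    pt : ∀ v → 𝟙 ((N ∩ adj G b) v) + 𝟙 ((N ∩ adj G b') v) ≤ 𝟙 ((K ∪ L) v) + 𝟙 (common-nbrs v)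
    pt v = ≤-trans (≤-reflexive (+-comm (𝟙 ((N ∩ adj G b) v)) _)) (two-≤' ((N ∩ adj G b') v) ((N ∩ adj G b) v)
      (λ p → let q , r = ∧-elim (N v) p in inside v q (inj₂ r)) (λ p → let q , r = ∧-elim (N v) p in inside v q (inj₁ r))
      (λ p q → let x , y = ∧-elim (N v) p ; _ , z = ∧-elim (N v) q in ∧-intro x (∧-intro z y)))
      where
      two-≤' : ∀ p c {t e} → (p ≡ true → t ≡ true) → (c ≡ true → t ≡ true) → (p ≡ true → c ≡ true → e ≡ true) → 𝟙 p + 𝟙 c ≤ 𝟙 t + 𝟙 e
      two-≤' true  true  f g h rewrite f refl | h refl refl = ≤-refl
      two-≤' true  false f g h rewrite f refl = s≤s z≤n
      two-≤' false true  f g h rewrite g refl = s≤s z≤n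
      two-≤' false false f g h = z≤n

  #-M-b : 𝟙 ((N ∖ S) b) + 𝟙 ((N ∖ S) b') ≤ # (N ∖ S)
  #-M-b = ≤-trans (≤-reflexive (sym (cong₂ _+_ (#-sing ((N ∖ S) b) b) (#-sing ((N ∖ S) b') b'))))
    (#-∪-≥ (sing ((N ∖ S) b) b) (sing ((N ∖ S) b') b') (N ∖ S)
      (λ v p → let q , r = sing-elim ((N ∖ S) b) b v p in subst (_∈ N ∖ S) (sym q) r)
      (λ v p → let q , r = sing-elim ((N ∖ S) b') b' v p in subst (_∈ N ∖ S) (sym q) r)
      (λ v p → ∉-intro λ q → b≢b' (trans (sym (proj₁ (sing-elim ((N ∖ S) b) b v p))) (proj₁ (sing-elim ((N ∖ S) b') b' v q)))))

infixr 4 _⊕_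
_⊕_ : ∀ {a b c d} → a ≤ b → c ≤ d → a + c ≤ b + d
_⊕_ = +-mono-≤

∈-count2 : ∀ {n} (X : VSet n) x y → x ∈ X → y ∈ X → x ≢ y → 2 ≤ # X
∈-count2 X x y p q x≢y = ≤-trans (s≤s (#-∈ (X ∖ ⁅ y ⁆) x (∖-∈ X p x≢y))) (#-remove X y q)

-- N is the neighbourhood of a vertex. If A is not linked in N minus b and b', it meets both sides K and L of a split.
-- When degrees inside N are large compared to |N ∖ S| + 2 |N ∩ S|, this forces almost all vertices of K ∪ L to be
-- common neighbours of b and b', hence to lie in A, which is too small for that.
module Counting {n} (G : Graph n) (N S A : VSet n) (κ : ℕ) (A< : # A + 1 ≤ κ) where

  M : VSet n
  M = N ∖ S
  σ : ℕ
  σ = # (N ∩ S)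
  deg degM : Fin n → ℕ
  deg u = # (N ∩ adj G u)
  degM u = # (M ∩ adj G u)

  Sp : VSet n → VSet n → Fin n → Fin n → Set
  Sp = Split G N

  C : Fin n → Fin n → VSet n
  C b b' z = N z ∧ adj G b z ∧ adj G b' z

  β : Fin n → Fin n → Fin n → ℕ
  β b b' p = 𝟙 (adj G p b) + 𝟙 (adj G p b')

  β≤2 : ∀ b b' p → β b b' p ≤ 2
  β≤2 b b' p = 𝟙≤1 (adj G p b) ⊕ 𝟙≤1 (adj G p b')

  J : Fin n → Fin n → VSet n
  J b b' p = adj G p b ∧ adj G p b'

  β-J : ∀ b b' p → p ∉ J b b' → β b b' p ≤ 1
  β-J b b' p q with adj G p b | adj G p b'
  ... | true  | false = ≤-refl
  ... | false | x = 𝟙≤1 x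
  β-J b b' p () | true | true

  M-elim : ∀ {v} → v ∈ M → v ∈ N × v ∉ S
  M-elim = ∖-elim N S

  side : ∀ {K} → K ⊆ N → K ⊆ S ⊎ ∃ λ p → p ∈ K × p ∈ M
  side {K} K⊆N with find K S
  ... | inj₁ h = inj₁ h
  ... | inj₂ (p , q , r) = inj₂ (p , q , ∖-intro N S (K⊆N p q) r)

  J⊆A : ∀ {K L b b'} → Sp K L b b' → C b b' ⊆ A → ∀ {p} → p ∈ K → p ∈ J b b' → p ∈ A
  J⊆A {b = b} {b'} sp h {p} p∈K q = let x , y = ∧-elim (adj G p b) q in
    h p (∧-intro (Split.K⊆N sp p p∈K) (∧-intro (Adj-sym G x) (Adj-sym G y)))

  -- The degree bound gives κ + 1 ≤ |K| + 2, whereas |K| + 1 ≤ |A| < κ.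
  full : ∀ {K L b b' p a'} → # K + 1 ≤ # A → κ + 1 ≤ # K + β b b' p → Sp K L b b' → a' ∈ L → ⊥
  full {K} {b = b} {b'} {p} h h' _ _ = absurd-lin 0 (h ⊕ h' ⊕ β≤2 b b' p ⊕ A<) (eq (# K) (# A) κ (β b b' p))
    where
    eq : ∀ k a κ β → a + (k + β + (2 + κ)) + 1 ≡ k + 1 + (κ + 1 + (β + (a + 1)))
    eq = solve-∀

  K+1≤A : ∀ {K L b b' a'} → Sp K L b b' → K ⊆ A → a' ∈ L → a' ∈ A → # K + 1 ≤ # A
  K+1≤A {K} {a' = a'} sp s p q = ≤-trans (≤-reflexive (+-comm (# K) 1)) (#-< K A a' s q (∉-intro λ r → true≢false p (Split.disj sp a' r)))

  Mb≤ : ∀ a b → 𝟙 (a ∧ b) ≤ 𝟙 a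
  Mb≤ true  b = 𝟙≤1 b
  Mb≤ false b = z≤n

  S-degree : ∀ {K L b b' a} → Sp K L b b' → K ⊆ S → a ∈ K → degM a ≤ 𝟙 (M b) + 𝟙 (M b')
  S-degree {K} {L} {b} {b'} sp s p = ≤-trans (degree-S G N S K L b b' sp p s) (Mb≤ (M b) _ ⊕ Mb≤ (M b') _)

  module Regular (hM : ∀ u → u ∈ M → κ ≤ deg u) (hS : ∀ s → s ∈ N ∩ S → κ + 1 ≤ degM s + σ)
                 (w : # M + (σ + σ) ≤ κ + κ + 1) where

    b-bound : ∀ {K L b b'} → Sp K L b b' → b ∈ M → κ ≤ # K + # L
    b-bound {K} {L} {b} {b'} sp p = ≤-trans (hM b p) (≤-trans (m≤m+n _ 0) (degree-b G N S K L b b' sp false b (λ ())))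

    -- A vertex of `K ⊆ S` sees at most b and b' in `M`, which forces σ ≥ κ - 1 and, by `w`, |K| +
    -- |L| ≤ κ. With both b and b' in `M`, their degrees sum to at most |K| + |L| plus the common
    -- neighbours, which lie in `A` and number less than κ.
    no-M : ∀ {K L b b' a} → Sp K L b b' → C b b' ⊆ A → K ⊆ S → a ∈ K → ⊥
    no-M {K} {L} {b} {b'} {a} sp h K⊆S a∈K = go (M b) (M b') refl refl
      where
      x₁ : κ + 1 ≤ (𝟙 (M b) + 𝟙 (M b')) + σ
      x₁ = ≤-trans (hS a (∧-intro (Split.K⊆N sp a a∈K) (K⊆S a a∈K))) (+-monoˡ-≤ σ (S-degree sp K⊆S a∈K))
      c₁ : # K + # L + 2 ≤ # M + σ
      c₁ = #-inside G N S K L b b' sp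
      few : ∀ {t} → κ + 1 ≤ t + σ → t ≤ 1 → κ ≤ # K + # L → ⊥
      few {t} x y z = absurd-lin 0 (x ⊕ y ⊕ z ⊕ c₁ ⊕ w) (eq t σ κ (# K) (# L) (# M))
        where
        eq : ∀ t σ κ k l m → t + σ + (1 + (k + l + (m + σ + (κ + κ + 1)))) + 1 ≡
                             κ + 1 + (t + (κ + (k + l + 2 + (m + (σ + σ)))))
        eq = solve-∀
      go : ∀ m m' → M b ≡ m → M b' ≡ m' → ⊥
      go false false p q = absurd-lin (# M) (x ⊕ x ⊕ w) (eq σ κ (# M))
        where
        x : κ + 1 ≤ 0 + σ
        x = subst (λ t → κ + 1 ≤ t + σ) (cong₂ (λ s t → 𝟙 s + 𝟙 t) p q) x₁
        eq : ∀ σ κ m → 0 + σ + (0 + σ + (κ + κ + 1)) + suc m ≡ κ + 1 + (κ + 1 + (m + (σ + σ)))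
        eq = solve-∀
      go true false p q = few (subst (λ t → κ + 1 ≤ t + σ) (cong₂ (λ s t → 𝟙 s + 𝟙 t) p q) x₁) ≤-refl (b-bound sp p)
      go false true p q = few (subst (λ t → κ + 1 ≤ t + σ) (cong₂ (λ s t → 𝟙 s + 𝟙 t) p q) x₁) ≤-refl (b-bound (split-flip sp) q)
      go true true p q = absurd-lin 0 (subst (λ t → κ + 1 ≤ t + σ) (cong₂ (λ s t → 𝟙 s + 𝟙 t) p q) x₁ ⊕ hM b p ⊕ hM b' q
          ⊕ degree-bb G N S K L b b' sp ⊕ (≤-trans (+-monoˡ-≤ 1 (#-mono (C b b') A h)) A<) ⊕ c₁ ⊕ w)
          (eq σ κ (deg b) (deg b') (# K) (# L) (# (C b b')) (# M))
        where
        eq : ∀ σ κ d e k l c m → 2 + σ + (d + (e + (k + l + c + (κ + (m + σ + (κ + κ + 1)))))) + 1 ≡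
                                 κ + 1 + (κ + (κ + (d + e + (c + 1 + (k + l + 2 + (m + (σ + σ)))))))
        eq = solve-∀

    half-degree : ∀ {K L b b' p} → Sp K L b b' → p ∈ K → p ∈ M → κ + 1 ≤ # K + β b b' p
    half-degree {K} {L} {b} {b'} {p} sp p∈K p∈M = ≤-trans (+-monoˡ-≤ 1 (≤-trans (hM p p∈M) (m≤m+n _ 0)))
      (degree-K G N S K L b b' sp p∈K false p (λ ()))

    -- Two degree bounds, one on each side, against the total size of `N`. As β is at most 2, they
    -- leave σ ≤ 1, and with σ = 1 both vertices are common neighbours of b and b'.
    pair-bound : ∀ {K L b b' p q} → Sp K L b b' → p ∈ K → p ∈ M → q ∈ L → q ∈ M → σ + 3 ≤ β b b' p + β b b' q
    pair-bound {K} {L} {b} {b'} {p} {q} sp p∈K p∈M q∈L q∈M = lin (σ + 3) (β b b' p + β b b' q) 0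
      (half-degree sp p∈K p∈M ⊕ half-degree (split-swap sp) q∈L q∈M ⊕ #-inside G N S K L b b' sp ⊕ w)
      (eq σ κ (# K) (# L) (# M) (β b b' p) (β b b' q))
      where
      eq : ∀ σ κ k l m x y → σ + 3 + (k + x + (l + y + (m + σ + (κ + κ + 1)))) + 0 ≡
                             x + y + (κ + 1 + (κ + 1 + (k + l + 2 + (m + (σ + σ)))))
      eq = solve-∀

    -- Since β is at most 1 at p, `pair-bound` requires σ = 0 and β = 2 on all of `L`. Then `L`
    -- consists of common neighbours of b and b', so `L ⊆ A`, and `full` applies.
    one-sided : ∀ {K L b b' p q a a'} → Sp K L b b' → C b b' ⊆ A → a ∈ K → a ∈ A → a' ∈ L →
      p ∈ K → p ∈ M → p ∉ J b b' → q ∈ L → q ∈ M → ⊥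
    one-sided {K} {L} {b} {b'} {p} {q} sp h a∈K a∈A a'∈L p∈K p∈M p∉J q∈L q∈M =
        full {p = q} (K+1≤A (split-swap sp) L⊆A a∈K a∈A) (half-degree (split-swap sp) q∈L q∈M) (split-swap sp) a∈K
      where
      force : ∀ {v} → v ∈ L → v ∈ M → σ + 3 ≤ 1 + β b b' v
      force v∈L v∈M = ≤-trans (pair-bound sp p∈K p∈M v∈L v∈M) (+-monoˡ-≤ _ (β-J b b' p p∉J))
      L⊆A : L ⊆ A
      L⊆A v v∈L with bool (S v)
      ... | inj₁ v∈S = ⊥-elim (absurd-lin 0 (force q∈L q∈M ⊕ β≤2 b b' q ⊕ #-∈ (N ∩ S) v (∧-intro (Split.L⊆N sp v v∈L) v∈S)) (eq σ (β b b' q)))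
        where
        eq : ∀ σ x → 1 + x + (2 + σ) + 1 ≡ σ + 3 + (x + 1)
        eq = solve-∀
      ... | inj₂ v∉S with bool (J b b' v)
      ...   | inj₁ j = J⊆A (split-swap sp) h v∈L j
      ...   | inj₂ j = ⊥-elim (absurd-lin σ (force v∈L (∖-intro N S (Split.L⊆N sp v v∈L) v∉S) ⊕ β-J b b' v j) (eq σ (β b b' v)))
        where
        eq : ∀ σ x → 1 + x + 1 + suc σ ≡ σ + 3 + x
        eq = solve-∀

    -- In the last case all of `M` on both sides is adjacent to b and b'. A side without roots then
    -- lies in `A`; a root on each side gives σ ≥ 2, more than `pair-bound` permits.
    regular : ∀ {K L b b' a a'} → Sp K L b b' → C b b' ⊆ A → a ∈ K → a ∈ A → a' ∈ L → a' ∈ A → ⊥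
    regular {K} {L} {b} {b'} {a} {a'} sp h a∈K a∈A a'∈L a'∈A with side (Split.K⊆N sp) | side (Split.L⊆N sp)
    ... | inj₁ K⊆S | _ = no-M sp h K⊆S a∈K
    ... | _ | inj₁ L⊆S = no-M (split-swap sp) h L⊆S a'∈L
    ... | inj₂ (p , p∈K , p∈M) | inj₂ (q , q∈L , q∈M) with find (K ∩ M) (J b b') | find (L ∩ M) (J b b')
    ...   | inj₂ (p' , p'∈ , p'∉J) | _ = let x , y = ∧-elim (K p') p'∈ in one-sided {p = p'} {q} sp h a∈K a∈A a'∈L x y p'∉J q∈L q∈M
    ...   | _ | inj₂ (q' , q'∈ , q'∉J) = let x , y = ∧-elim (L q') q'∈ in one-sided {p = q'} {p} (split-swap sp) h a'∈L a'∈A a∈K x y q'∉J p∈K p∈M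
    ...   | inj₁ KJ | inj₁ LJ with find K M | find L M
    ...     | inj₁ K⊆M | _ = full {p = p} (K+1≤A sp (λ v r → J⊆A sp h r (KJ v (∧-intro r (K⊆M v r)))) a'∈L a'∈A) (half-degree sp p∈K p∈M) sp a'∈L
    ...     | _ | inj₁ L⊆M = full {p = q} (K+1≤A (split-swap sp) (λ v r → J⊆A (split-swap sp) h r (LJ v (∧-intro r (L⊆M v r)))) a∈K a∈A) (half-degree (split-swap sp) q∈L q∈M) (split-swap sp) a∈K
    ...     | inj₂ (s , s∈K , s∉M) | inj₂ (t , t∈L , t∉M) = absurd-lin 0 (pair-bound sp p∈K p∈M q∈L q∈M ⊕ β≤2 b b' p ⊕ β≤2 b b' q
                ⊕ ∈-count2 (N ∩ S) s t (NS (Split.K⊆N sp s s∈K) s∉M) (NS (Split.L⊆N sp t t∈L) t∉M)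
                    (λ { refl → true≢false t∈L (Split.disj sp s s∈K) })) (eq σ (β b b' p) (β b b' q))
      where
      NS : ∀ {v} → v ∈ N → v ∉ M → v ∈ N ∩ S
      NS {v} x y = [ ∧-intro x , (λ z → absurd (∖-intro N S x z) y) ]′ (bool (S v))
      eq : ∀ σ x y → x + y + (2 + (2 + σ)) + 1 ≡ σ + 3 + (x + (y + 2))
      eq = solve-∀

  -- A vertex in Q may have one neighbour less, but it is not adjacent to the root r: adding the edges from r to Q
  -- would restore the degrees of the regular case.
  module Deficient (Q : VSet n) (r : Fin n) (r∈ : r ∈ N ∩ S) (rQ : ∀ u → u ∈ Q → adj G u r ≡ false)
                   (hM : ∀ u → u ∈ M → κ ≤ deg u + 𝟙 (Q u)) (hS : ∀ s → s ∈ N ∩ S → s ≢ r → κ + 1 ≤ degM s + σ)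
                   (hr : κ ≤ degM r + σ) (w : # M + (σ + σ) ≤ κ + κ) where

    r∈S : r ∈ S
    r∈S = proj₂ (∧-elim (N r) r∈)
    σ≥1 : 1 ≤ σ
    σ≥1 = #-∈ (N ∩ S) r r∈
    M≢r : ∀ {p} → p ∈ M → r ≢ p
    M≢r p = ∈∉⇒≢ S r∈S (proj₂ (M-elim p))

    few : ∀ {t} → κ + 1 ≤ t + σ → t ≤ 1 → t ≤ # M → ⊥
    few {t} x y z = absurd-lin 0 (x ⊕ x ⊕ y ⊕ z ⊕ w) (eq t σ κ (# M))
      where
      eq : ∀ t σ κ m → t + σ + (t + σ + (1 + (m + (κ + κ)))) + 1 ≡ κ + 1 + (κ + 1 + (t + (t + (m + (σ + σ)))))
      eq = solve-∀

    b-bound : ∀ {K L b b'} → Sp K L b b' → r ∈ K → b ∈ M → κ ≤ # K + # L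
    b-bound {K} {L} {b} {b'} sp r∈K p = ≤-trans (hM b p)
      (degree-b G N S K L b b' sp (Q b) r (λ q → ∨-introˡ r∈K , rQ b q))

    no-M-far : ∀ {K L b b' a} → Sp K L b b' → r ∈ K → L ⊆ S → a ∈ L → ⊥
    no-M-far {K} {L} {b} {b'} {a} sp r∈K L⊆S a∈L = go (M b) (M b') refl refl
      where
      x₁ : κ + 1 ≤ (𝟙 (M b) + 𝟙 (M b')) + σ
      x₁ = ≤-trans (hS a (∧-intro (Split.L⊆N sp a a∈L) (L⊆S a a∈L)) (λ { refl → true≢false a∈L (Split.disj sp a r∈K) }))
                   (+-monoˡ-≤ σ (S-degree (split-swap sp) L⊆S a∈L))
      c₂ : 𝟙 (M b) + 𝟙 (M b') ≤ # M
      c₂ = #-M-b G N S K L b b' sp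
      go : ∀ m m' → M b ≡ m → M b' ≡ m' → ⊥
      go false m' p q = few x₁ (≤-trans (≤-reflexive (cong (λ t → 𝟙 t + 𝟙 (M b')) p)) (𝟙≤1 (M b'))) c₂
      go true false p q = few x₁ (≤-reflexive (cong₂ (λ s t → 𝟙 s + 𝟙 t) p q)) c₂
      go true true p q = absurd-lin 0 (subst (λ t → κ + 1 ≤ t + σ) (cong₂ (λ s t → 𝟙 s + 𝟙 t) p q) x₁ ⊕ b-bound sp r∈K p ⊕ #-inside G N S K L b b' sp ⊕ w)
          (eq σ κ (# K) (# L) (# M))
        where
        eq : ∀ σ κ k l m → 2 + σ + (k + l + (m + σ + (κ + κ))) + 1 ≡ κ + 1 + (κ + (k + l + 2 + (m + (σ + σ))))
        eq = solve-∀

    -- In `M` only b and b' can be adjacent to r, and one that is adjacent lies outside `Q`, so its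
    -- degree is not deficient.
    no-M-near : ∀ {K L b b' q} → Sp K L b b' → C b b' ⊆ A → r ∈ K → K ⊆ S → q ∈ M → ⊥
    no-M-near {K} {L} {b} {b'} {q} sp h r∈K K⊆S q∈M = go (M b) (M b') (adj G r b) (adj G r b') refl refl refl refl
      where
      e e' : ℕ
      e  = 𝟙 (M b ∧ adj G r b)
      e' = 𝟙 (M b' ∧ adj G r b')
      x₁ : κ ≤ (e + e') + σ
      x₁ = ≤-trans hr (+-monoˡ-≤ σ (degree-S G N S K L b b' sp r∈K K⊆S))
      c₁ : # K + # L + 2 ≤ # M + σ
      c₁ = #-inside G N S K L b b' sp
      real : ∀ {b} → b ∈ M → adj G r b ≡ true → κ ≤ deg b
      real {b} p i = ≤-trans (hM b p) (≤-trans (≤-reflexive (cong (λ t → deg b + 𝟙 t)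
          (∉-intro λ q → true≢false (Adj-sym G i) (rQ b q)))) (≤-reflexive (+-identityʳ _)))
      one : e + e' ≤ 1 → κ ≤ # K + # L → ⊥
      one x y = absurd-lin 0 (x₁ ⊕ x ⊕ y ⊕ c₁ ⊕ w) (eq (e + e') σ κ (# K) (# L) (# M))
        where
        eq : ∀ t σ κ k l m → t + σ + (1 + (k + l + (m + σ + (κ + κ)))) + 1 ≡ κ + (t + (κ + (k + l + 2 + (m + (σ + σ)))))
        eq = solve-∀
      none : e + e' ≤ 0 → ⊥
      none x = absurd-lin 0 (x₁ ⊕ x₁ ⊕ x ⊕ x ⊕ #-∈ M q q∈M ⊕ w) (eq (e + e') σ κ (# M))
        where
        eq : ∀ t σ κ m → t + σ + (t + σ + (0 + (0 + (m + (κ + κ))))) + 1 ≡ κ + (κ + (t + (t + (1 + (m + (σ + σ))))))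
        eq = solve-∀
      zeroʳ : ∀ a {c} → c ≡ false → 𝟙 (a ∧ c) ≤ 0
      zeroʳ true  refl = z≤n
      zeroʳ false refl = z≤n
      zeroˡ : ∀ {a} c → a ≡ false → 𝟙 (a ∧ c) ≤ 0
      zeroˡ c refl = z≤n
      go : ∀ m m' i i' → M b ≡ m → M b' ≡ m' → adj G r b ≡ i → adj G r b' ≡ i' → ⊥
      go false false _ _ p p' _ _ = none (zeroˡ (adj G r b) p ⊕ zeroˡ (adj G r b') p')
      go false true _ _ p p' _ _ = one (zeroˡ (adj G r b) p ⊕ 𝟙≤1 _) (b-bound (split-flip sp) r∈K p')
      go true false _ _ p p' _ _ = one (𝟙≤1 (M b ∧ adj G r b) ⊕ zeroˡ (adj G r b') p') (b-bound sp r∈K p)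
      go true true false _ p p' i _ = one (zeroʳ (M b) i ⊕ 𝟙≤1 _) (b-bound sp r∈K p)
      go true true true false p p' _ i' = one (𝟙≤1 (M b ∧ adj G r b) ⊕ zeroʳ (M b') i') (b-bound sp r∈K p)
      go true true true true p p' i i' = absurd-lin 0 (x₁ ⊕ 𝟙≤1 (M b ∧ adj G r b) ⊕ 𝟙≤1 (M b' ∧ adj G r b') ⊕ real p i ⊕ real p' i'
          ⊕ degree-bb G N S K L b b' sp ⊕ (≤-trans (+-monoˡ-≤ 1 (#-mono (C b b') A h)) A<) ⊕ c₁ ⊕ w)
          (eq e e' σ κ (deg b) (deg b') (# K) (# L) (# (C b b')) (# M))
        where
        eq : ∀ e e' σ κ x y k l c m → e + e' + σ + (1 + (1 + (x + (y + (k + l + c + (κ + (m + σ + (κ + κ)))))))) + 1 ≡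
                                      κ + (e + (e' + (κ + (κ + (x + y + (c + 1 + (k + l + 2 + (m + (σ + σ)))))))))
        eq = solve-∀

    -- On the side of r the deficiency costs nothing: the vertex of `K` that p misses is r itself.
    near-degree : ∀ {K L b b' p} → Sp K L b b' → r ∈ K → p ∈ K → p ∈ M → κ + 1 ≤ # K + β b b' p
    near-degree {K} {L} {b} {b'} {p} sp r∈K p∈K p∈M = ≤-trans (+-monoˡ-≤ 1 (hM p p∈M))
      (degree-K G N S K L b b' sp p∈K (Q p) r (λ q → r∈K , rQ p q , M≢r p∈M))

    far-degree : ∀ {K L b b' q} → Sp K L b b' → q ∈ L → q ∈ M → κ + 1 ≤ # L + β b b' q + 𝟙 (Q q)
    far-degree {K} {L} {b} {b'} {q} sp q∈L q∈M = lin (κ + 1) (# L + β b b' q + 𝟙 (Q q)) 0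
      (hM q q∈M ⊕ degree-K G N S L K b b' (split-swap sp) q∈L false q (λ ())) (eq κ (deg q) (𝟙 (Q q)) (# L) (β b b' q))
      where
      eq : ∀ κ d f l x → κ + 1 + (d + f + (l + x)) + 0 ≡ l + x + f + (κ + (d + 0 + 1))
      eq = solve-∀

    -- The bounds give σ = 1 and β = 2 throughout `K ∩ M`. Hence `K` consists of r and common
    -- neighbours of b and b', all in `A`, and `full` applies.
    rooted-near : ∀ {K L b b' a'} → Sp K L b b' → C b b' ⊆ A → r ∈ K → r ∈ A → a' ∈ L → a' ∈ A → ⊥
    rooted-near {K} {L} {b} {b'} {a'} sp h r∈K r∈A a'∈L a'∈A with side (Split.L⊆N sp) | side (Split.K⊆N sp)
    ... | inj₁ L⊆S | _ = no-M-far sp r∈K L⊆S a'∈L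
    ... | inj₂ (q , q∈L , q∈M) | inj₁ K⊆S = no-M-near sp h r∈K K⊆S q∈M
    ... | inj₂ (q , q∈L , q∈M) | inj₂ (p , p∈K , p∈M) =
        full {p = p} (K+1≤A sp K⊆A a'∈L a'∈A) (near-degree sp r∈K p∈K p∈M) sp a'∈L
      where
      pair-bound : ∀ {p} → p ∈ K → p ∈ M → σ + 3 ≤ β b b' p + 2
      pair-bound {p} x y = lin (σ + 3) (β b b' p + 2) 0
        (near-degree sp r∈K x y ⊕ far-degree sp q∈L q∈M ⊕ β≤2 b b' q ⊕ 𝟙≤1 (Q q) ⊕ #-inside G N S K L b b' sp ⊕ w)
        (eq σ κ (# K) (# L) (# M) (β b b' p) (β b b' q) (𝟙 (Q q)))
        where
        eq : ∀ σ κ k l m x y f → σ + 3 + (k + x + (l + y + f + (2 + (1 + (m + σ + (κ + κ)))))) + 0 ≡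
                                 x + 2 + (κ + 1 + (κ + 1 + (y + (f + (k + l + 2 + (m + (σ + σ)))))))
        eq = solve-∀
      K⊆A : K ⊆ A
      K⊆A v v∈K with bool (S v)
      ... | inj₂ v∉S = [ J⊆A sp h v∈K , (λ j → ⊥-elim (absurd-lin 0
              (pair-bound v∈K (∖-intro N S (Split.K⊆N sp v v∈K) v∉S) ⊕ β-J b b' v j ⊕ σ≥1) (eq σ (β b b' v)))) ]′ (bool (J b b' v))
        where
        eq : ∀ σ x → x + 2 + (1 + σ) + 1 ≡ σ + 3 + (x + 1)
        eq = solve-∀
      ... | inj₁ v∈S with v ≟ r
      ...   | yes refl = r∈A
      ...   | no v≢r = ⊥-elim (absurd-lin 0 (pair-bound p∈K p∈M ⊕ β≤2 b b' p ⊕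
                ∈-count2 (N ∩ S) v r (∧-intro (Split.K⊆N sp v v∈K) v∈S) r∈ v≢r) (eq σ (β b b' p)))
        where
        eq : ∀ σ x → x + 2 + (2 + σ) + 1 ≡ σ + 3 + (x + 2)
        eq = solve-∀

    rooted-A : ∀ {K L b b' a a'} → Sp K L b b' → C b b' ⊆ A → r ≢ b → r ≢ b' → r ∈ A →
               a ∈ K → a ∈ A → a' ∈ L → a' ∈ A → ⊥
    rooted-A sp h r≢b r≢b' r∈A a∈K a∈A a'∈L a'∈A with Split.cover sp r (proj₁ (∧-elim (N r) r∈))
    ... | inj₁ (inj₁ e) = r≢b e
    ... | inj₁ (inj₂ e) = r≢b' e
    ... | inj₂ (inj₁ r∈K) = rooted-near sp h r∈K r∈A a'∈L a'∈A
    ... | inj₂ (inj₂ r∈L) = rooted-near (split-swap sp) h r∈L r∈A a∈K a∈A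

    all-S : ∀ {K L b' a} → Sp K L r b' → K ⊆ S → a ∈ K → ⊥
    all-S {K} {L} {b'} {a} sp K⊆S a∈K = few (≤-trans (hS a (∧-intro (Split.K⊆N sp a a∈K) (K⊆S a a∈K)) (∈∉⇒≢ K a∈K (Split.b∉K sp)))
        (+-monoˡ-≤ σ (S-degree sp K⊆S a∈K)))
      (≤-trans (≤-reflexive (cong (λ t → 𝟙 t + 𝟙 (M b')) (∉-intro λ q → true≢false r∈S (proj₂ (M-elim q))))) (𝟙≤1 (M b')))
      (#-M-b G N S K L r b' sp)

    -- With r = b, a deficient vertex is not adjacent to b, so β and the deficiency together never
    -- exceed 2. The count then leaves σ = 0, although r is a root in `N`.
    rooted-B : ∀ {K L b' a a'} → Sp K L r b' → a ∈ K → a' ∈ L → ⊥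
    rooted-B {K} {L} {b'} {a} {a'} sp a∈K a'∈L with side (Split.K⊆N sp) | side (Split.L⊆N sp)
    ... | inj₁ K⊆S | _ = all-S sp K⊆S a∈K
    ... | inj₂ _ | inj₁ L⊆S = all-S (split-swap sp) L⊆S a'∈L
    ... | inj₂ (p , p∈K , p∈M) | inj₂ (q , q∈L , q∈M) = absurd-lin 0
        (far-degree (split-swap sp) p∈K p∈M ⊕ far-degree sp q∈L q∈M ⊕ βQ p ⊕ βQ q ⊕ #-inside G N S K L r b' sp ⊕ w ⊕ σ≥1)
        (eq σ κ (# K) (# L) (# M) (β r b' p) (β r b' q) (𝟙 (Q p)) (𝟙 (Q q)))
      where
      βQ : ∀ p → β r b' p + 𝟙 (Q p) ≤ 2
      βQ p with bool (Q p)
      ... | inj₂ e = ≤-trans (≤-reflexive (trans (cong (λ t → β r b' p + 𝟙 t) e) (+-identityʳ _))) (β≤2 r b' p)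
      ... | inj₁ e = (≤-trans (≤-reflexive (cong (λ t → 𝟙 t + 𝟙 (adj G p b')) (rQ p e))) (𝟙≤1 (adj G p b'))) ⊕ 𝟙≤1 (Q p)
      eq : ∀ σ κ k l m x y f g → k + x + f + (l + y + g + (2 + (2 + (m + σ + (κ + κ + σ))))) + 1 ≡
                                 κ + 1 + (κ + 1 + (x + f + (y + g + (k + l + 2 + (m + (σ + σ) + 1)))))
      eq = solve-∀

-- Massed graphs are feasible

-- What is left when every use of v fails: b and b' are not adjacent, all their common neighbours in
-- N(v) are needed in `T ∖ B`, and `T ∖ B` meets both sides of a split. Low weight of v will exclude
-- it.
Stuck : ∀ {n} → Graph n → Fin n → (T B : VSet n) → Set
Stuck {n} G v T B = ∃ λ b → ∃ λ b' → ∃ λ K → ∃ λ L → ∃ λ a → ∃ λ a' → b ∈ B × b' ∈ B × (∀ x → x ∈ B → x ≡ b ⊎ x ≡ b') ×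
  Split G (adj G v) K L b b' × a ∈ K × a ∈ T ∖ B × a' ∈ L × a' ∈ T ∖ B ×
  (λ z → adj G v z ∧ adj G b z ∧ adj G b' z) ⊆ T ∖ B × 2 + # (T ∖ B) ≤ # T

-- The vertex v links one of the two sets, the other one is linked inside the neighbourhood of v.
star-feas : ∀ {n} (G : Graph n) v T B → T ⊆ adj G v → B ⊆ T → AtMost2 B → ¬ Stuck G v T B → Feas G (closed G ⁅ v ⁆) T B
star-feas {n} G v T B T⊆N B⊆T two notStuck = go (empty-or-pair B two)
  where
  D N A : VSet n
  D = closed G ⁅ v ⁆
  N = adj G v
  A = T ∖ B

  N≢v : ∀ {u} → u ∈ N → u ≢ v
  N≢v p = Adj-≢ G p ∘ sym
  v∈D : v ∈ D
  v∈D = ∨-introˡ (==-refl v)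
  N⊆D : N ⊆ D
  N⊆D u p = ∨-introʳ (u == v) (∈-Nbd G ⁅ v ⁆ (==-false (N≢v p)) (==-refl v) p)
  A⊆N : A ⊆ N
  A⊆N u p = T⊆N u (proj₁ (∖-elim T B p))
  B⊆N : B ⊆ N
  B⊆N = ⊆-trans B⊆T T⊆N
  A∉B : ∀ {u} → u ∈ A → u ∉ B
  A∉B p = proj₂ (∖-elim T B p)

  -- If `B` is linked inside `X`, then v is free to link `A`.
  without : ∀ X → X ⊆ N → Disjoint A X → Linked G (D ∖ (λ u → not (X u))) B → Feas G D T B
  without X X⊆N dis l = (λ u → not (X u))
    , linked-star G v (∧-intro v∈D (not-intro (∉-intro λ p → N≢v (X⊆N v p) refl)))
        (λ u p → ∧-intro (N⊆D u (A⊆N u p)) (not-intro (dis u p))) (λ u p → inj₂ (Adj-sym G (A⊆N u p)))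
    , l

  inside : ∀ X u → X ⊆ N → u ∈ X → u ∈ D ∖ (λ u → not (X u))
  inside X u X⊆N p = ∖-intro D (λ u → not (X u)) (N⊆D _ (X⊆N _ p)) (cong not p)

  module _ (b b' : Fin n) (b∈B : b ∈ B) (b'∈B : b' ∈ B) (cover : ∀ x → x ∈ B → x ≡ b ⊎ x ≡ b') where

    pair⊆B : pair b b' ⊆ B
    pair⊆B u p = [ (λ { refl → b∈B }) , (λ { refl → b'∈B }) ]′ (pair-elim b b' u p)
    A∌pair : Disjoint A (pair b b')
    A∌pair u p = ∉-intro λ q → true≢false (pair⊆B u q) (A∉B p)
    pair⊆N : pair b b' ⊆ N
    pair⊆N = ⊆-trans pair⊆B B⊆N

    Free : VSet n
    Free z = N z ∧ adj G b z ∧ adj G b' z ∧ not (A z)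

    short : b ≡ b' ⊎ Adj G b b' → Feas G D T B
    short e = without (pair b b') pair⊆N A∌pair (linked-pair cover (walk e))
      where
      b∈ = inside (pair b b') b pair⊆N (pair-introˡ b b')
      b'∈ = inside (pair b b') b' pair⊆N (pair-introʳ b b')
      walk : b ≡ b' ⊎ Adj G b b' → Walk G (D ∖ (λ u → not (pair b b' u))) b b'
      walk (inj₁ e) = subst (Walk G _ b) e (nil b∈)
      walk (inj₂ e) = cons b∈ e (nil b'∈)

    middle : ∀ z → z ∈ Free → Feas G D T B
    middle z p with ∧-elim (N z) p
    ... | z∈N , q with ∧-elim (adj G b z) q
    ...   | bz , r with ∧-elim (adj G b' z) r
    ...     | b'z , s = without X X⊆N dis (linked-pair cover
                (cons (inside X b X⊆N (∨-introˡ (pair-introˡ b b'))) bz (cons (inside X z X⊆N (∨-introʳ (pair b b' z) (==-refl z)))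
                  (Adj-sym G b'z) (nil (inside X b' X⊆N (∨-introˡ (pair-introʳ b b')))))))
      where
      X = pair b b' ∪ ⁅ z ⁆
      X⊆N : X ⊆ N
      X⊆N u t = [ pair⊆N u , (λ e → subst (_∈ N) (sym (==-elim u z e)) z∈N) ]′ (∨-elim (pair b b' u) t)
      dis : Disjoint A X
      dis u t = ∨-false (A∌pair u t) (==-false {i = u} λ { refl → true≢false t (not-elim (A z) s) })

    -- Here v joins b to b', and `A` must be linked in `N` without them; a component missing part of
    -- `A` provides the split.
    long : b ≢ b' → adj G b b' ≡ false → (∀ z → z ∉ Free) → Feas G D T B
    long b≢b' b≁b' noFree = R , (λ {a} {a'} p q → link (component G R a (A⊆R _ p)) p q)
        , linked-pair cover (cons (endpoint b∈B (pair-introˡ b b')) (Adj-sym G (B⊆N b b∈B))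
            (cons v∈ (B⊆N b' b'∈B) (nil (endpoint b'∈B (pair-introʳ b b')))))
      where
      R = N ∖ pair b b'
      A⊆R : A ⊆ R
      A⊆R u p = ∖-intro N (pair b b') (A⊆N u p) (A∌pair u p)
      endpoint : ∀ {x} → x ∈ B → x ∈ pair b b' → x ∈ D ∖ R
      endpoint p q = ∖-intro D R (N⊆D _ (B⊆N _ p)) (∉-intro λ r → true≢false q (proj₂ (∖-elim N (pair b b') r)))
      v∈ : v ∈ D ∖ R
      v∈ = ∖-intro D R v∈D (∉-intro λ r → N≢v (proj₁ (∖-elim N (pair b b') r)) refl)
      R⊆ : R ⊆ D ∩ R
      R⊆ u p = ∧-intro (N⊆D u (proj₁ (∖-elim N (pair b b') p))) p
      link : ∀ {a a'} → ∃ (Component G R a) → a ∈ A → a' ∈ A → Walk G (D ∩ R) a a'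
      link {a} {a'} (K , K⊆R , a∈K , walk , closedK) p q with bool (K a')
      ... | inj₁ r = walk-mono R⊆ (walk a' r)
      ... | inj₂ r = ⊥-elim (notStuck (b , b' , K , L , a , a' , b∈B , b'∈B , cover , sp , a∈K , p
              , ∖-intro R K (A⊆R a' q) r , q , common⊆A , size))
        where
        L = R ∖ K
        out : ∀ {x} → x ∈ pair b b' → x ∉ R
        out p = ∉-intro λ r → true≢false p (proj₂ (∖-elim N (pair b b') r))
        sp : Split G N K L b b'
        sp = split (B⊆N b b∈B) (B⊆N b' b'∈B) b≢b' b≁b'
          (λ u s → proj₁ (∖-elim N (pair b b') (K⊆R u s))) (λ u s → proj₁ (∖-elim N (pair b b') (proj₁ (∖-elim R K s))))
          cov (λ u s → ∉-intro λ t → true≢false s (proj₂ (∖-elim R K t)))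
          (∉-intro λ s → true≢false (K⊆R b s) (out (pair-introˡ b b')))
          (∉-intro λ s → true≢false (K⊆R b' s) (out (pair-introʳ b b')))
          (∉-intro λ s → true≢false (proj₁ (∖-elim R K s)) (out (pair-introˡ b b')))
          (∉-intro λ s → true≢false (proj₁ (∖-elim R K s)) (out (pair-introʳ b b')))
          (λ x∈K y∈L → ∉-intro λ e → let s , t = ∖-elim R K y∈L in true≢false (closedK x∈K s e) t)
          where
          cov : ∀ u → u ∈ N → (u ≡ b ⊎ u ≡ b') ⊎ (u ∈ K ⊎ u ∈ L)
          cov u s with bool (pair b b' u)
          ... | inj₁ t = inj₁ (pair-elim b b' u t)
          ... | inj₂ t with bool (K u)
          ...   | inj₁ x = inj₂ (inj₁ x)
          ...   | inj₂ x = inj₂ (inj₂ (∖-intro R K (∖-intro N (pair b b') s t) x))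
        common⊆A : (λ z → N z ∧ adj G b z ∧ adj G b' z) ⊆ A
        common⊆A z s with bool (A z)
        ... | inj₁ t = t
        ... | inj₂ t = absurd (let x , y = ∧-elim (N z) s ; w , w' = ∧-elim (adj G b z) y in
                         ∧-intro x (∧-intro w (∧-intro w' (not-intro t)))) (noFree z)
        size : 2 + # A ≤ # T
        size = ≤-trans (≤-trans (≤-reflexive (+-comm 2 (# A))) (+-monoʳ-≤ (# A)
                 (∈-count2 (pair b b') b b' (pair-introˡ b b') (pair-introʳ b b') b≢b')))
          (#-∪-≥ A (pair b b') T (λ u s → proj₁ (∖-elim T B s)) (⊆-trans pair⊆B B⊆T) A∌pair)

    two-roots : Feas G D T B
    two-roots with b ≟ b' | bool (adj G b b') | bool (anyᵇ Free)
    ... | yes e | _ | _ = short (inj₁ e)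
    ... | no _ | inj₁ e | _ = short (inj₂ e)
    ... | no _ | inj₂ _ | inj₁ p = let z , q = any-elim Free p in middle z q
    ... | no e | inj₂ f | inj₂ p = long e f (any-false Free p)

  go : _ → Feas G D T B
  go (inj₁ none) = without ∅ (λ _ ()) (λ _ _ → refl) (λ p _ → absurd p (none _))
  go (inj₂ (b , b' , p , q , r)) = two-roots b b' p q r

two-stars : ∀ {n} (G : Graph n) {U S B : VSet n} {p q} → Disjoint U S → B ⊆ S → p ∈ U → q ∈ U → p ≢ q →
  (∀ a → a ∈ S ∖ B → Adj G a p) → (∀ b → b ∈ B → Adj G b q) → Feas G (U ∪ S) S B
two-stars G {U} {S} {B} {p} {q} dis B⊆S p∈U q∈U p≢q pa qb = C
    , linked-star G p (∧-intro (∨-introˡ p∈U) (∧-intro (not-intro (U∉B p∈U)) (not-intro (==-false p≢q))))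
        (λ a x → let y , z = ∖-elim S B x in ∧-intro (∨-introʳ (U a) y) (∧-intro (not-intro z)
           (not-intro (==-false {i = a} λ { refl → true≢false y (dis a q∈U) })))) (λ a x → inj₂ (pa a x))
    , linked-star G q (∖-intro (U ∪ S) C (∨-introˡ q∈U) (∉-intro λ x →
           true≢false (==-refl q) (not-elim (q == q) (proj₂ (∧-elim (not (B q)) x)))))
        (λ b x → ∖-intro (U ∪ S) C (∨-introʳ (U b) (B⊆S b x)) (∉-intro λ y →
           true≢false x (not-elim (B b) (proj₁ (∧-elim (not (B b)) y))))) (λ b x → inj₂ (qb b x))
  where
  C : VSet _
  C u = not (B u) ∧ not (u == q)
  U∉B : ∀ {u} → u ∈ U → u ∉ B
  U∉B x = ∉-intro λ y → true≢false (B⊆S _ y) (dis _ x)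

-- Edges inside `U` are met from both ends, edges to `S` only from one; doubling the latter makes
-- the weights sum to 2ρ(U). In the count inside N(v) this is |M| + 2σ.
weight : ∀ {n} → Graph n → VSet n → Fin n → ℕ
weight G S v = # (adj G v ∖ S) + (# (adj G v ∩ S) + # (adj G v ∩ S))

handshake : ∀ {n} (G : Graph n) {U S : VSet n} → Disjoint U S → Nbd G U ⊆ S →
  sumFin (λ v → 𝟙 (U v) * weight G S v) ≡ ρ G U + ρ G U
handshake G {U} {S} dis N⊆S = trans (sym split-sum) (trans (ΣΣ-cong (λ u v → sym (pt u v))) (ΣΣ-touch G U))
  where
  t₁ t₂ : _ → _ → ℕ
  t₁ u v = 𝟙 (U u) * 𝟙 ((adj G u ∖ S) v)
  t₂ u v = 𝟙 (U u) * 𝟙 ((adj G u ∩ S) v)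
  split-sum : ΣΣ (λ u v → t₁ u v + (t₂ u v + t₂ v u)) ≡ sumFin (λ v → 𝟙 (U v) * weight G S v)
  split-sum = trans (ΣΣ-+ t₁ (λ u v → t₂ u v + t₂ v u)) (trans (cong (ΣΣ t₁ +_)
      (trans (ΣΣ-+ t₂ (λ u v → t₂ v u)) (cong (ΣΣ t₂ +_) (sym (Σ-swap t₂)))))
    (trans (cong (ΣΣ t₁ +_) (sym (Σ-+ (λ u → sumFin (t₂ u)) (λ u → sumFin (t₂ u)))))
    (trans (sym (Σ-+ (λ u → sumFin (t₁ u)) (λ u → sumFin (t₂ u) + sumFin (t₂ u)))) (Σ-cong λ u →
      trans (cong₂ _+_ (Σ-* (𝟙 (U u)) (𝟙 ∘ (adj G u ∖ S))) (cong₂ _+_ (Σ-* (𝟙 (U u)) (𝟙 ∘ (adj G u ∩ S))) (Σ-* (𝟙 (U u)) (𝟙 ∘ (adj G u ∩ S)))))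
        (dist (𝟙 (U u)) (# (adj G u ∖ S)) (# (adj G u ∩ S)))))))
    where
    dist : ∀ a b c → a * b + (a * c + a * c) ≡ a * (b + (c + c))
    dist = solve-∀
  logic : ∀ e u v s t → (u ≡ true → s ≡ false) → (v ≡ true → t ≡ false) →
    (e ≡ true → u ≡ true → v ≡ true ⊎ t ≡ true) → (e ≡ true → v ≡ true → u ≡ true ⊎ s ≡ true) →
    𝟙 (e ∧ (u ∨ v)) ≡ 𝟙 u * 𝟙 (e ∧ not t) + (𝟙 u * 𝟙 (e ∧ t) + 𝟙 v * 𝟙 (e ∧ s))
  logic false true  true  s t _ _ _ _ = refl
  logic false true  false s t _ _ _ _ = refl
  logic false false true  s t _ _ _ _ = refl
  logic false false false s t _ _ _ _ = refl
  logic true true true s t f g _ _ rewrite f refl | g refl = refl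
  logic true true false s t f g h _ rewrite f refl with h refl refl
  ... | inj₂ refl = refl
  logic true false true s t f g _ h rewrite g refl with h refl refl
  ... | inj₂ refl = refl
  logic true false false s t _ _ _ _ = refl
  pt : ∀ u v → 𝟙 (touch G U u v) ≡ t₁ u v + (t₂ u v + t₂ v u)
  pt u v = trans (logic (adj G u v) (U u) (U v) (S u) (S v) (dis u) (dis v)
      (λ e p → adj-∪ G N⊆S p e) (λ e p → adj-∪ G N⊆S p (Adj-sym G e)))
    (cong (λ b → t₁ u v + (t₂ u v + 𝟙 (U v) * 𝟙 (b ∧ S u))) (adj-sym G u v))

tri-M : ∀ {n} (G : Graph n) S v {y} → y ∉ S → tri G S v y ≤ # (adj G v ∩ adj G y)
tri-M G S v {y} y∉S = #-mono _ (adj G v ∩ adj G y) λ u p → let e , q = ∧-elim (adj G v u) p ; r , _ = ∧-elim _ q in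
  ∧-intro e ([ id , (λ s → absurd (proj₁ (∧-elim (S y) s)) y∉S) ]′ (∨-elim (adj G y u) r))

-- As `y` is a root, all other roots in N(v) count in `tri`. This turns the triangle bound into one
-- on neighbours outside `S`.
tri-S : ∀ {n} (G : Graph n) S v y → y ∈ adj G v ∩ S → tri G S v y + 1 ≤ # ((adj G v ∖ S) ∩ adj G y) + # (adj G v ∩ S)
tri-S {n} G S v y y∈ = ≤-trans (+-monoˡ-≤ 1 (#-∪-≤ ((adj G v ∖ S) ∩ adj G y) ((adj G v ∩ S) ∖ ⁅ y ⁆) _ cov))
  (≤-trans (≤-reflexive (trans (+-assoc (# ((adj G v ∖ S) ∩ adj G y)) _ 1) (cong (# ((adj G v ∖ S) ∩ adj G y) +_) (+-comm _ 1))))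
    (+-monoʳ-≤ (# ((adj G v ∖ S) ∩ adj G y)) (#-remove (adj G v ∩ S) y y∈)))
  where
  cov : ∀ u → adj G v u ∧ (adj G y u ∨ (S y ∧ S u)) ∧ not (u == y) ≡ true → u ∈ (adj G v ∖ S) ∩ adj G y ⊎ u ∈ (adj G v ∩ S) ∖ ⁅ y ⁆
  cov u p with ∧-elim (adj G v u) p
  ... | e , q with ∧-elim (adj G y u ∨ (S y ∧ S u)) q
  ...   | r , s with bool (S u)
  ...     | inj₁ t = inj₂ (∖-intro (adj G v ∩ S) (⁅ y ⁆) (∧-intro e t) (not-elim (u == y) s))
  ...     | inj₂ t = inj₁ (∧-intro (∖-intro (adj G v) S e t)
              ([ id , (λ x → absurd (proj₂ (∧-elim (S y) x)) t) ]′ (∨-elim (adj G y u) r)))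

scan : ∀ {n} (f : Fin n → Fin n → Bool) → (∃ λ u → ∃ λ v → f u v ≡ true) ⊎ (∀ u v → f u v ≡ false)
scan f with bool (anyᵇ λ u → anyᵇ (f u))
... | inj₁ p = let u , q = any-elim (λ u → anyᵇ (f u)) p ; v , r = any-elim (f u) q in inj₁ (u , v , r)
... | inj₂ p = inj₂ λ u v → any-false (f u) (any-false (λ u → anyᵇ (f u)) p u) v

average : ∀ {n} (U : VSet n) (f : Fin n → ℕ) c → (∀ v → v ∈ U → c ≤ f v) → c * # U ≤ sumFin (λ v → 𝟙 (U v) * f v)
average U f c h = ≤-trans (≤-reflexive (sym (Σ-* c (𝟙 ∘ U)))) (Σ-mono pt)
  where
  pt : ∀ v → c * 𝟙 (U v) ≤ 𝟙 (U v) * f v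
  pt v with bool (U v)
  ... | inj₁ p rewrite p = ≤-trans (≤-reflexive (*-comm c 1)) (*-monoʳ-≤ 1 (h v p))
  ... | inj₂ p rewrite p = ≤-reflexive (*-zeroʳ c)

-- For u = |U|: each vertex weighs at least 2(k+j) + e, and the weights sum to 2(ku+c+1+j). From u =
-- 3 on, 2ju + eu exceeds 2j + 2e, which is at least 2j + 2c + 2.
few-vertices : ∀ k j c e {u} → (k + j + (k + j) + e) * u ≤ (k * u + c + 1 + j) + (k * u + c + 1 + j) →
               1 ≤ e → c + c + 2 ≤ e + e → u ≤ 2
few-vertices k j c e {u} h e≥1 h' with u ≤? 2
... | yes p = p
... | no ¬p with m≤n⇒∃[o]m+o≡n (≰⇒> ¬p)
...   | t , refl = ⊥-elim (absurd-lin (4 * j + 2 * t * j + t) (h ⊕ h' ⊕ e≥1 ⊕ *-monoʳ-≤ t e≥1) (eq k j c e t))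
  where
  eq : ∀ k j c e t → (k * (3 + t) + c + 1 + j) + (k * (3 + t) + c + 1 + j) + (e + e + (e + t * e)) + suc (4 * j + 2 * t * j + t) ≡
                     (k + j + (k + j) + e) * (3 + t) + (c + c + 2 + (1 + t * 1))
  eq = solve-∀

module _ {n k u} (ih : MassedBelow n k u) (G : Graph n) (U S B : VSet n) (m : Massed k G U S B) (U≤u : # U ≤ u) where
  open Massed m

  private
    Σw : sumFin (λ v → 𝟙 (U v) * weight G S v) ≡ ρ G U + ρ G U
    Σw = handshake G disjoint nbd

    inU : ∀ {v y} → v ∈ U → y ∈ adj G v ∖ S → y ∈ U
    inU {v} v∈U p with ∖-elim (adj G v) S p
    ... | e , y∉S = [ id , (λ q → absurd q y∉S) ]′ (adj-∪ G nbd v∈U e)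

    inner : ∀ {v} → v ∈ U → suc (# (adj G v ∖ S)) ≤ # U
    inner {v} v∈U = #-< (adj G v ∖ S) U v (λ _ → inU v∈U) v∈U (∉-intro λ p → Adj-≢ G (proj₁ (∖-elim (adj G v) S p)) refl)

    -- The rigid set is {v}: unless stuck, its star solves every `T` that a linkage from `S` can
    -- produce, with the roots adjacent to v keeping their roles.
    low-vertex : ∀ v → v ∈ U →
      (∀ T B' → # T ≤ # S → adj G v ∩ (S ∖ B) ⊆ T ∖ B' → adj G v ∩ B ⊆ B' → ¬ Stuck G v T B') →
      Feas G (U ∪ S) S B
    low-vertex v v∈U h = rigid-set ih G U S B m U≤u ⁅ v ⁆ (λ x p → subst (_∈ U) (sym (==-elim x v p)) v∈U) v (==-refl v)
      λ T B' T⊆ T≤ B'⊆ two' a c → star-feas G v T B' (λ x p → from (T⊆ x p)) B'⊆ two'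
        (h T B' T≤ (λ x p → let q , r = ∧-elim (adj G v x) p in a x (∧-intro (to q) r))
                   (λ x p → let q , r = ∧-elim (adj G v x) p in c x (∧-intro (to q) r)))
      where
      from : ∀ {x} → x ∈ Nbd G ⁅ v ⁆ → Adj G v x
      from {x} p with Nbd-elim G ⁅ v ⁆ p
      ... | _ , w , q , e = subst (λ t → Adj G t x) (==-elim w v q) e
      to : ∀ {x} → Adj G v x → x ∈ Nbd G ⁅ v ⁆
      to {x} e = ∈-Nbd G ⁅ v ⁆ (==-false {i = x} (Adj-≢ G e ∘ sym)) (==-refl v) e

    A-small : ∀ {T A : VSet n} {j} → 2 + # A ≤ # T → # T ≤ # S → # A + 1 ≤ k + j
    A-small {T} {A} {j} p q = ≤-trans (s≤s⁻¹ (≤-trans (≤-reflexive (cong suc (+-comm (# A) 1))) (≤-trans p (≤-trans q order)))) (m≤m+n k j)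

    regular-vertex : ∀ j v → v ∈ U → (∀ y → Adj G v y → k + j ≤ tri G S v y) →
      weight G S v ≤ (k + j) + (k + j) + 1 → Feas G (U ∪ S) S B
    regular-vertex j v v∈U h w = low-vertex v v∈U λ T B' T≤ _ _
      (b , b' , K , L , a , a' , _ , _ , _ , sp , a∈K , a∈A , a'∈L , a'∈A , c , size) →
      Counting.Regular.regular G (adj G v) S (T ∖ B') (k + j) (A-small size T≤)
        (λ y p → ≤-trans (h y (proj₁ (∖-elim (adj G v) S p))) (tri-M G S v (proj₂ (∖-elim (adj G v) S p))))
        (λ s p → ≤-trans (+-monoˡ-≤ 1 (h s (proj₁ (∧-elim (adj G v s) p)))) (tri-S G S v s p))
        w sp c a∈K a∈A a'∈L a'∈A

    -- Contraction lowers ρ by at most `tri` + 1 and k|U| by k, so having fewer than k + j - t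
    -- triangles leaves an excess of c + 1 + t.
    contracted : ∀ {x y c j t} → x ∈ U → (xy : Adj G x y) → k * # U + c + 1 + j ≡ ρ G U → t + tri G S x y < k + j →
      k * # (U ∖ ⁅ x ⁆) + (c + 1 + t) ≤ ρ (contract G x y) (U ∖ ⁅ x ⁆)
    contracted {x} {y} {c} {j} {t} x∈U xy e h = lin (k * u' + (c + 1 + t)) ρ' 0
      (*-monoʳ-≤ k (#-remove U x x∈U) ⊕ (≤-trans (≤-reflexive e) (ρ-contract G xy U S x∈U nbd)) ⊕ h) (eq k u' c t (# U) ρ' (tri G S x y) j)
      where
      u' = # (U ∖ ⁅ x ⁆)
      ρ' = ρ (contract G x y) (U ∖ ⁅ x ⁆)
      eq : ∀ k u' c t u r s j → k * u' + (c + 1 + t) + (k * u + (r + s + 1 + (k + j))) + 0 ≡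
                                r + (k * suc u' + (k * u + c + 1 + j + suc (t + s)))
      eq = solve-∀

    heavy-or : ∀ f → (∃ λ v → v ∈ U × weight G S v ≤ f) ⊎ (∀ v → v ∈ U → suc f ≤ weight G S v)
    heavy-or f with bool (anyᵇ λ v → U v ∧ does (weight G S v ≤? f))
    ... | inj₁ p = let v , q = any-elim (λ v → U v ∧ does (weight G S v ≤? f)) p ; r , s = ∧-elim (U v) q in
                   inj₁ (v , r , does⇒ (weight G S v ≤? f) s)
    ... | inj₂ p = inj₂ λ v q → ≰⇒> λ r → true≢false (∧-intro q (dec-true (weight G S v ≤? f) r))
                     (any-false (λ v → U v ∧ does (weight G S v ≤? f)) p v)

    edge-bound : ∀ (t : Fin n → Fin n → ℕ) κ →
      (∃ λ x → ∃ λ y → x ∈ U × Adj G x y × t x y < κ) ⊎ (∀ x y → x ∈ U → Adj G x y → κ ≤ t x y)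
    edge-bound t κ with scan (λ x y → U x ∧ adj G x y ∧ does (t x y <? κ))
    ... | inj₁ (x , y , p) = let q , r = ∧-elim (U x) p ; e , s = ∧-elim (adj G x y) r in
                             inj₁ (x , y , q , e , does⇒ (t x y <? κ) s)
    ... | inj₂ none = inj₂ λ x y p e → ≮⇒≥ λ l → true≢false (∧-intro p (∧-intro e (dec-true (t x y <? κ) l))) (none x y)

    uniform : ∀ c → c ≤ 1 → # S ≤ k + c → k * # U + c + 1 ≤ ρ G U →
      (∀ x y → k * # (U ∖ ⁅ x ⁆) + (c + 1 + 0) ≤ ρ (contract G x y) (U ∖ ⁅ x ⁆) → Dense k (contract G x y) (U ∖ ⁅ x ⁆) S B) →
      Feas G (U ∪ S) S B
    -- The surplus `j` is not removed by deleting edges; it raises the number of triangles required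
    -- of each edge to k + j.
    uniform c c≤1 S≤ excess build with m≤n⇒∃[o]m+o≡n excess
    ... | j , e with edge-bound (tri G S) (k + j)
    ...   | inj₁ (x , y , x∈U , xy , l) = contract-massed-feas ih G U S B m U≤u x∈U xy (build x y (contracted {c = c} {t = 0} x∈U xy e l))
    ...   | inj₂ tri≥ with heavy-or ((k + j) + (k + j) + 1)
    ...     | inj₁ (v , v∈U , w) = regular-vertex j v v∈U (λ y → tri≥ v y v∈U) w
    -- All weights exceed 2(k+j) + 1, which leaves at most two vertices in `U`, each adjacent to all
    -- of `S`. Two of them form two stars; a single one touches too few edges.
    ...     | inj₂ big = tiny (ρ-∅ G (≤-trans (≤-trans (m≤n+m 1 (k * # U + c)) (m≤m+n _ j)) (≤-reflexive e)))
      where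
      Σ≥ : ((k + j) + (k + j) + 2) * # U ≤ (k * # U + c + 1 + j) + (k * # U + c + 1 + j)
      Σ≥ = ≤-trans (average U (weight G S) _ (λ v p → ≤-trans (≤-reflexive (+-suc _ 1)) (big v p)))
             (≤-reflexive (trans Σw (sym (cong₂ _+_ e e))))
      U≤2 : # U ≤ 2
      U≤2 = few-vertices k j c 2 Σ≥ (s≤s z≤n) (+-monoˡ-≤ 2 (c≤1 ⊕ c≤1))
      σ : Fin n → ℕ
      σ v = # (adj G v ∩ S)
      σ≥ : ∀ {v} → v ∈ U → k + 1 ≤ σ v
      σ≥ {v} p with k + 1 ≤? σ v
      ... | yes q = q
      ... | no ¬q = ⊥-elim (absurd-lin (j + j) (big v p ⊕ inner p ⊕ U≤2 ⊕ ≰⇒> ¬q ⊕ ≰⇒> ¬q) (eq k j (# (adj G v ∖ S)) (σ v) (# U)))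
        where
        eq : ∀ k j a s u → a + (s + s) + (u + (2 + (k + 1 + (k + 1)))) + suc (j + j) ≡
                           suc (k + j + (k + j) + 1) + (suc a + (u + (suc s + suc s)))
        eq = solve-∀
      complete : ∀ {v} → v ∈ U → ∀ s → s ∈ S → Adj G s v
      complete {v} p s q = Adj-sym G (proj₁ (∧-elim (adj G v s)
        (#-⊆-≡ (adj G v ∩ S) S (λ x r → proj₂ (∧-elim (adj G v x) r)) (≤-trans S≤ (≤-trans (+-monoʳ-≤ k c≤1) (σ≥ p))) s q)))
      tiny : (∃ λ v → v ∈ U) → Feas G (U ∪ S) S B
      tiny (v , v∈U) with find U ⁅ v ⁆
      ... | inj₂ (q , q∈U , q≢v) = two-stars G disjoint roles v∈U q∈U (λ { refl → true≢false (==-refl v) q≢v })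
                (λ a p → complete v∈U a (proj₁ (∖-elim S B p))) (λ b p → complete q∈U b (roles b p))
      ... | inj₁ U⊆v = ⊥-elim (absurd-lin (1 + (j + j)) (bound ⊕ inner v∈U ⊕ #U≤1 ⊕ σ≤ ⊕ σ≤ ⊕ S≤ ⊕ S≤ ⊕ (*-monoʳ-≤ k #U≥1) ⊕ (*-monoʳ-≤ k #U≥1))
            (eq k j c (# U) (# (adj G v ∖ S)) (σ v) (# S)))
        where
        #U≤1 : # U ≤ 1
        #U≤1 = ≤-trans (#-mono U ⁅ v ⁆ U⊆v) (≤-reflexive (#-single v))
        #U≥1 : 1 ≤ # U
        #U≥1 = #-∈ U v v∈U
        σ≤ : σ v ≤ # S
        σ≤ = #-mono (adj G v ∩ S) S λ x p → proj₂ (∧-elim (adj G v x) p)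
        bound : (k * # U + c + 1 + j) + (k * # U + c + 1 + j) ≤ weight G S v
        bound = ≤-trans (≤-reflexive (trans (cong₂ _+_ e e) (sym Σw)))
          (≤-trans (Σ-mono λ x → *-monoˡ-≤ (weight G S x) (𝟙-mono (U⊆v x))) (≤-reflexive (Σ-single v (weight G S))))
        eq : ∀ k j c u a s r → a + (s + s) + (u + (1 + (r + (r + (k + c + (k + c + (k * u + k * u))))))) + suc (1 + (j + j)) ≡
             (k * u + c + 1 + j) + (k * u + c + 1 + j) + (suc a + (u + (s + (s + (r + (r + (k * 1 + k * 1)))))))
        eq = solve-∀

    module Bonused (x₀ y₀ : Fin n) (x₀∈ : x₀ ∈ S ∖ B) (y₀∈B : y₀ ∈ B)
                   (apart : ∀ z → z ∈ U → Adj G x₀ z → Adj G y₀ z → ⊥) where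

      x₀∈S : x₀ ∈ S
      x₀∈S = proj₁ (∖-elim S B x₀∈)
      y₀∈S : y₀ ∈ S
      y₀∈S = roles y₀ y₀∈B

      lost : Fin n → Fin n → VSet n
      lost x y z = (U ∖ ⁅ x ⁆) z ∧ adj (contract G x y) x₀ z ∧ adj (contract G x y) y₀ z

      -- Equals 1 when contracting `xy` destroys the bonus. Two excess edges must then remain
      -- instead of one, so the contraction is allowed only with one triangle fewer.
      gain : Fin n → Fin n → ℕ
      gain x y = 𝟙 (anyᵇ (lost x y))

      -- The contractions of xy into y that create a common neighbour of x₀ and y₀.
      Losing : Fin n → Fin n → Set
      Losing x y = (y ≡ x₀ ⊎ y ≡ y₀) ⊎ (y ∈ U × Adj G y₀ x × Adj G x₀ y) ⊎ (y ∈ U × Adj G x₀ x × Adj G y₀ y)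

      losing : ∀ x y → x ∈ U → anyᵇ (lost x y) ≡ true → Losing x y
      losing x y x∈U p with any-elim (lost x y) p
      ... | z , q with ∧-elim ((U ∖ ⁅ x ⁆) z) q
      ...   | z∈ , r with ∧-elim (adj (contract G x y) x₀ z) r
      ...     | xz , yz with contract-elim G x y {x₀} {z} xz | contract-elim G x y {y₀} {z} yz
      ...       | _ , _ , _ , inj₁ e | _ , _ , _ , inj₁ f = ⊥-elim (apart z (proj₁ (∖-∉ U {z} {x} z∈)) e f)
      ...       | _ , _ , _ , inj₂ (inj₁ (e , _)) | _ = inj₁ (inj₁ (sym e))
      ...       | _ | _ , _ , _ , inj₂ (inj₁ (f , _)) = inj₁ (inj₂ (sym f))
      ...       | _ , _ , _ , inj₁ e | _ , _ , _ , inj₂ (inj₂ (refl , f)) = inj₂ (inj₁ (proj₁ (∖-∉ U {z} {x} z∈) , f , e))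
      ...       | _ , _ , _ , inj₂ (inj₂ (refl , e)) | _ , _ , _ , inj₁ f = inj₂ (inj₂ (proj₁ (∖-∉ U {z} {x} z∈) , e , f))
      ...       | _ , _ , _ , inj₂ (inj₂ (refl , e)) | _ , _ , _ , inj₂ (inj₂ (_ , f)) = ⊥-elim (apart x x∈U e f)

      module _ (j : ℕ) (e : k * # U + 0 + 1 + j ≡ ρ G U) where

        contract-edge : ∀ {x y} → x ∈ U → Adj G x y → gain x y + tri G S x y < k + j → Feas G (U ∪ S) S B
        contract-edge {x} {y} x∈U xy l = contract-massed-feas ih G U S B m U≤u x∈U xy (go (anyᵇ (lost x y)) refl)
          where
          bound = contracted {c = 0} {t = gain x y} x∈U xy e l
          go : ∀ b → anyᵇ (lost x y) ≡ b → Dense k (contract G x y) (U ∖ ⁅ x ⁆) S B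
          go true p = inj₁ (subst (λ t → k * # (U ∖ ⁅ x ⁆) + (1 + t) ≤ ρ (contract G x y) (U ∖ ⁅ x ⁆)) (cong 𝟙 p) bound)
          go false p = inj₂ (subst (λ t → k * # (U ∖ ⁅ x ⁆) + (1 + t) ≤ ρ (contract G x y) (U ∖ ⁅ x ⁆)) (cong 𝟙 p) bound
            , inj₂ (x₀ , y₀ , x₀∈ , y₀∈B , λ z z∈ f g → true≢false (∧-intro z∈ (∧-intro f g)) (any-false (lost x y) p z)))

        module _ (h : ∀ x y → x ∈ U → Adj G x y → k + j ≤ gain x y + tri G S x y) where

          kept-bound : ∀ {x y} → x ∈ U → Adj G x y → ¬ Losing x y → k + j ≤ tri G S x y
          kept-bound {x} {y} x∈U xy ¬l = subst (λ t → k + j ≤ t + tri G S x y)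
            (cong 𝟙 (∉-intro (λ p → ¬l (losing x y x∈U p)))) (h x y x∈U xy)

          any-bound : ∀ {x y} → x ∈ U → Adj G x y → k + j ≤ tri G S x y + 1
          any-bound {x} {y} x∈U xy = ≤-trans (h x y x∈U xy) (≤-trans (+-monoˡ-≤ _ (𝟙≤1 (anyᵇ (lost x y)))) (≤-reflexive (+-comm 1 _)))

          -- r is the root among x₀ and y₀ adjacent to v, and r' the other one.
          module Rooted (v r r' : Fin n) (v∈U : v ∈ U) (vr : Adj G v r) (r∈S : r ∈ S) (v≁r' : Adj G v r' → ⊥)
                        (away : ∀ z → z ∈ U → Adj G r z → Adj G r' z → ⊥)
                        (only : ∀ y → Losing v y → (y ≡ r ⊎ y ≡ r') ⊎ (y ∈ U × Adj G r' y))
                        (w : weight G S v ≤ (k + j) + (k + j)) where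
            N : VSet n
            N = adj G v

            Q : VSet n
            Q y = U y ∧ adj G r' y

            rQ : ∀ y → y ∈ Q → adj G y r ≡ false
            rQ y p = let q , s = ∧-elim (U y) p in ∉-intro λ f → away y q (Adj-sym G f) s

            hM : ∀ y → y ∈ N ∖ S → k + j ≤ # (N ∩ adj G y) + 𝟙 (Q y)
            hM y p = go (bool (Q y))
              where
              vy = proj₁ (∖-elim N S p)
              y∉S = proj₂ (∖-elim N S p)
              go : _ → k + j ≤ # (N ∩ adj G y) + 𝟙 (Q y)
              go (inj₁ q) rewrite q = ≤-trans (any-bound v∈U vy) (+-monoˡ-≤ 1 (tri-M G S v y∉S))
              go (inj₂ q) = ≤-trans (kept-bound v∈U vy ¬l) (≤-trans (tri-M G S v y∉S) (m≤m+n _ _))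
                where
                ¬l : ¬ Losing v y
                ¬l l with only y l
                ... | inj₁ (inj₁ refl) = true≢false r∈S y∉S
                ... | inj₁ (inj₂ refl) = v≁r' vy
                ... | inj₂ (y∈U , f) = true≢false (∧-intro y∈U f) q

            hS : ∀ s → s ∈ N ∩ S → s ≢ r → k + j + 1 ≤ # ((N ∖ S) ∩ adj G s) + # (N ∩ S)
            hS s p s≢r = ≤-trans (+-monoˡ-≤ 1 (kept-bound v∈U vs ¬l)) (tri-S G S v s p)
              where
              vs = proj₁ (∧-elim (N s) p)
              ¬l : ¬ Losing v s
              ¬l l with only s l
              ... | inj₁ (inj₁ q) = s≢r q
              ... | inj₁ (inj₂ refl) = v≁r' vs
              ... | inj₂ (s∈U , _) = true≢false (proj₂ (∧-elim (N s) p)) (disjoint s s∈U)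

            r∈ : r ∈ N ∩ S
            r∈ = ∧-intro vr r∈S

            hr : k + j ≤ # ((N ∖ S) ∩ adj G r) + # (N ∩ S)
            hr = ≤-trans (any-bound v∈U vr) (tri-S G S v r r∈)

            module Count {T B' : VSet n} (size : 2 + # (T ∖ B') ≤ # T) (T≤ : # T ≤ # S) =
              Counting.Deficient G N S (T ∖ B') (k + j) (A-small size T≤) Q r r∈ rQ hM hS hr w

          -- A vertex is adjacent to at most one of x₀ and y₀. If to one, that root is the r of the
          -- deficient count; if to neither, no contraction of an edge at v into its neighbour
          -- destroys the bonus, and the count is regular.
          low : ∀ v → v ∈ U → weight G S v ≤ (k + j) + (k + j) → Feas G (U ∪ S) S B
          low v v∈U w with bool (adj G v x₀) | bool (adj G v y₀)
          ... | inj₁ p | inj₁ q = ⊥-elim (apart v v∈U (Adj-sym G p) (Adj-sym G q))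
          ... | inj₁ p | inj₂ q = low-vertex v v∈U λ T B' T≤ PA _ (b , b' , K , L , a , a' , b∈ , b'∈ , _ , sp , a∈K , a∈A , a'∈L , a'∈A , c , size) →
                let x₀∈A = PA x₀ (∧-intro p x₀∈) ; x₀∉B' = proj₂ (∖-elim T B' x₀∈A) in
                Count.rooted-A size T≤ sp c (λ { refl → true≢false b∈ x₀∉B' }) (λ { refl → true≢false b'∈ x₀∉B' }) x₀∈A a∈K a∈A a'∈L a'∈A
            where
            only : ∀ y → Losing v y → (y ≡ x₀ ⊎ y ≡ y₀) ⊎ (y ∈ U × Adj G y₀ y)
            only y (inj₁ r) = inj₁ r
            only y (inj₂ (inj₁ (_ , r , _))) = absurd (Adj-sym G r) q
            only y (inj₂ (inj₂ (r , _ , s))) = inj₂ (r , s)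
            open Rooted v x₀ y₀ v∈U p x₀∈S (λ r → true≢false r q) apart only w
          ... | inj₂ p | inj₁ q = low-vertex v v∈U λ T B' T≤ _ PB (b , b' , K , L , a , a' , b∈ , b'∈ , cov , sp , a∈K , a∈A , a'∈L , a'∈A , c , size) →
                [ (λ { refl → Count.rooted-B size T≤ sp a∈K a'∈L })
                , (λ { refl → Count.rooted-B size T≤ (split-flip sp) a∈K a'∈L }) ]′ (cov y₀ (PB y₀ (∧-intro q y₀∈B)))
            where
            only : ∀ y → Losing v y → (y ≡ y₀ ⊎ y ≡ x₀) ⊎ (y ∈ U × Adj G x₀ y)
            only y (inj₁ r) = inj₁ ([ inj₂ , inj₁ ]′ r)
            only y (inj₂ (inj₁ (r , _ , s))) = inj₂ (r , s)
            only y (inj₂ (inj₂ (_ , r , _))) = absurd (Adj-sym G r) p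
            open Rooted v y₀ x₀ v∈U q y₀∈S (λ r → true≢false r p) (λ z r s t → apart z r t s) only w
          ... | inj₂ p | inj₂ q = regular-vertex j v v∈U (λ y vy → kept-bound v∈U vy (¬l vy)) (≤-trans w (m≤m+n _ 1))
            where
            ¬l : ∀ {y} → Adj G v y → ¬ Losing v y
            ¬l f (inj₁ (inj₁ refl)) = true≢false f p
            ¬l f (inj₁ (inj₂ refl)) = true≢false f q
            ¬l f (inj₂ (inj₁ (_ , r , _))) = true≢false (Adj-sym G r) q
            ¬l f (inj₂ (inj₂ (_ , r , _))) = true≢false (Adj-sym G r) p

        -- Now |U| ≤ 2, and a vertex of `U` misses at most one root. A neighbour p of x₀ misses
        -- exactly y₀, a neighbour q of y₀ exactly x₀; so p can link `S ∖ B` and q can link `B`.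
        tiny : (∀ v → v ∈ U → suc ((k + j) + (k + j)) ≤ weight G S v) → Feas G (U ∪ S) S B
        tiny big = two-stars G disjoint roles p∈U q∈U (λ r → apart p p∈U (Adj-sym G px) (subst (Adj G y₀) (sym r) (Adj-sym G qy)))
            (λ a r → let s , t = ∖-elim S B r in all-but p∈U (y₀∈S) p≁y a s (λ { refl → true≢false y₀∈B t }))
            (λ b r → all-but q∈U x₀∈S q≁x b (roles b r) (λ { refl → true≢false r (proj₂ (∖-elim S B x₀∈)) }))
          where
          -- Otherwise |N(U)| < |S|, and sparseness of `U` itself contradicts the excess.
          S⊆N : S ⊆ Nbd G U
          S⊆N = #-⊆-≡ (Nbd G U) S nbd (≮⇒≥ λ l → <⇒≱ (≤-trans (≤-reflexive (+-comm 1 (k * # U)))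
            (≤-trans (≤-trans (≤-reflexive (cong (_+ 1) (sym (+-identityʳ (k * # U))))) (m≤m+n _ j)) (≤-reflexive e))) (sparse U (λ _ p → p) l))
          p q : Fin n
          p = proj₁ (proj₂ (Nbd-elim G U (S⊆N x₀ x₀∈S)))
          q = proj₁ (proj₂ (Nbd-elim G U (S⊆N y₀ y₀∈S)))
          p∈U : p ∈ U
          p∈U = proj₁ (proj₂ (proj₂ (Nbd-elim G U (S⊆N x₀ x₀∈S))))
          q∈U : q ∈ U
          q∈U = proj₁ (proj₂ (proj₂ (Nbd-elim G U (S⊆N y₀ y₀∈S))))
          px : Adj G p x₀
          px = proj₂ (proj₂ (proj₂ (Nbd-elim G U (S⊆N x₀ x₀∈S))))
          qy : Adj G q y₀
          qy = proj₂ (proj₂ (proj₂ (Nbd-elim G U (S⊆N y₀ y₀∈S))))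
          p≁y : adj G p y₀ ≡ false
          p≁y = ∉-intro λ r → apart p p∈U (Adj-sym G px) (Adj-sym G r)
          q≁x : adj G q x₀ ≡ false
          q≁x = ∉-intro λ r → apart q q∈U (Adj-sym G r) (Adj-sym G qy)
          U≤2 : # U ≤ 2
          U≤2 = few-vertices k j 0 1 (≤-trans (average U (weight G S) _ (λ v p → ≤-trans (≤-reflexive (+-comm _ 1)) (big v p)))
                  (≤-reflexive (trans Σw (sym (cong₂ _+_ e e))))) ≤-refl ≤-refl
          all-but : ∀ {v r} → v ∈ U → r ∈ S → adj G v r ≡ false → ∀ s → s ∈ S → s ≢ r → Adj G s v
          all-but {v} {r} v∈U r∈S v≁r s s∈S s≢r with bool (adj G v s)
          ... | inj₁ f = Adj-sym G f
          ... | inj₂ f = ⊥-elim (absurd-lin (1 + (j + j)) (big v v∈U ⊕ inner v∈U ⊕ U≤2 ⊕ σ≤ ⊕ σ≤ ⊕ order ⊕ order)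
                  (eq k j (# (adj G v ∖ S)) (# (adj G v ∩ S)) (# U) (# S)))
            where
            σ≤ : 2 + # (adj G v ∩ S) ≤ # S
            σ≤ = ≤-trans (s≤s (#-< (adj G v ∩ S) (S ∖ ⁅ r ⁆) s
                   (λ x y → let z , t = ∧-elim (adj G v x) y in ∖-∈ S t λ { refl → true≢false z v≁r })
                   (∖-∈ S s∈S s≢r) (∉-intro λ y → true≢false (proj₁ (∧-elim (adj G v s) y)) f)))
                 (#-remove S r r∈S)
            eq : ∀ k j a s u t → a + (s + s) + (u + (2 + (t + (t + (suc k + suc k))))) + suc (1 + (j + j)) ≡
                                 suc (k + j + (k + j)) + (suc a + (u + (2 + s + (2 + s + (t + t)))))
            eq = solve-∀

      bonused : k * # U + 1 ≤ ρ G U → Feas G (U ∪ S) S B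
      bonused excess with m≤n⇒∃[o]m+o≡n excess
      ... | j , e = go (edge-bound (λ x y → gain x y + tri G S x y) (k + j))
        where
        e' : k * # U + 0 + 1 + j ≡ ρ G U
        e' = trans (cong (λ t → t + 1 + j) (+-identityʳ (k * # U))) e
        go : _ → Feas G (U ∪ S) S B
        go (inj₁ (x , y , x∈U , xy , l)) = contract-edge j e' x∈U xy l
        go (inj₂ h) with heavy-or ((k + j) + (k + j))
        ... | inj₁ (v , v∈U , w) = low j e' h v v∈U w
        ... | inj₂ big = tiny j e' big

  massed-step : Feas G (U ∪ S) S B
  massed-step with dense
  ... | inj₁ heavy = uniform 1 ≤-refl (≤-trans order (≤-reflexive (+-comm 1 k)))
          (≤-trans (≤-reflexive (+-assoc (k * # U) 1 1)) heavy) (λ _ _ → inj₁)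
  ... | inj₂ (light , inj₁ S≤k) = uniform 0 z≤n (≤-trans S≤k (m≤m+n k 0))
          (≤-trans (≤-reflexive (cong (_+ 1) (+-identityʳ (k * # U)))) light) (λ _ _ h → inj₂ (h , inj₁ S≤k))
  ... | inj₂ (light , inj₂ (x₀ , y₀ , x₀∈ , y₀∈ , apart)) = Bonused.bonused x₀ y₀ x₀∈ y₀∈ apart light

massed-feasible : ∀ {n k} u → MassedBelow n k u
massed-feasible (suc u) G U S B (s≤s U≤u) m = massed-step (massed-feasible u) G U S B m U≤u

-- From walks to paths

module _ {n} (G : Graph n) (D : VSet n) where

  record PathIn (s t : Fin n) : Set where
    constructor pathIn
    field
      {len'} : ℕ
      f      : Fin (suc len') → Fin n
      f-inj  : ∀ {i j} → f i ≡ f j → i ≡ j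
      f-zero : f zero ≡ s
      f-last : f (fromℕ len') ≡ t
      f-step : ∀ i → Adj G (f (inject₁ i)) (f (suc i))
      f-in   : ∀ i → f i ∈ D

  suffix : ∀ l (f : Fin (suc l) → Fin n) {t} → (∀ {i j} → f i ≡ f j → i ≡ j) → f (fromℕ l) ≡ t →
    (∀ i → Adj G (f (inject₁ i)) (f (suc i))) → (∀ i → f i ∈ D) → ∀ i → PathIn (f i) t
  suffix l f fi fl fs fd zero = pathIn f fi refl fl fs fd
  suffix (suc l) f fi fl fs fd (suc i) =
    suffix l (f ∘ suc) (λ e → suc-injective' (fi e)) fl (fs ∘ suc) (fd ∘ suc) i
    where
    suc-injective' : ∀ {k} {i j : Fin k} → Fin.suc i ≡ suc j → i ≡ j
    suc-injective' refl = refl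

  -- If the new first vertex already occurs on the path built for the rest, the path is cut to start
  -- at that occurrence.
  path-in : ∀ {u v} → Walk G D u v → PathIn u v
  path-in {u} (nil p) = pathIn {len' = 0} (λ _ → u) (λ { {zero} {zero} _ → refl }) refl refl (λ ()) (λ _ → p)
  path-in {u} {v} (cons {w = w} p e walk) with path-in walk
  ... | pathIn {l} f fi fz fl fs fd with bool (anyᵇ λ i → f i == u)
  ...   | inj₁ h = let i , q = any-elim (λ i → f i == u) h in
            subst (λ x → PathIn x v) (==-elim (f i) u q) (suffix l f fi fl fs fd i)
  ...   | inj₂ h = pathIn g gi refl fl gs gd
    where
    fresh : ∀ i → f i ≢ u
    fresh i q = true≢false (==-intro q) (any-false (λ i → f i == u) h i)
    g : Fin (suc (suc l)) → Fin n
    g zero    = u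
    g (suc i) = f i
    gi : ∀ {i j} → g i ≡ g j → i ≡ j
    gi {zero}  {zero}  _ = refl
    gi {zero}  {suc j} q = ⊥-elim (fresh j (sym q))
    gi {suc i} {zero}  q = ⊥-elim (fresh i q)
    gi {suc i} {suc j} q = cong suc (fi q)
    gs : ∀ i → Adj G (g (inject₁ i)) (g (suc i))
    gs zero    = subst (Adj G u) (sym fz) e
    gs (suc i) = fs i
    gd : ∀ i → g i ∈ D
    gd zero    = p
    gd (suc i) = fd i

walk-avoiding : ∀ {n} {G : Graph n} {D : VSet n} {P : Fin n → Set} → (∀ v → v ∈ D → ¬ P v) →
                ∀ {u v} → Walk G D u v → WalkAvoiding G P u v
walk-avoiding h (nil p)      = [ h _ p ]
walk-avoiding h (cons p e w) = h _ p ∷⟨ e ⟩ walk-avoiding h w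

-- Rooted graphs

all-vertices : ∀ {n} → VSet n
all-vertices _ = true

module _ {m} (R : RootedGraph m) where

  ends : VSet (RootedGraph.n R)
  ends = pair (b₁ R) (b₂ R)

  ends⊆Roots : ends ⊆ Roots R
  ends⊆Roots v = ∨-introʳ (anyᵇ (λ i → a R i == v))

  a∈ : ∀ i → a R i ∈ Roots R ∖ ends
  a∈ i = ∖-intro (Roots R) ends (∨-introˡ (any-intro (λ j → a R j == a R i) i (==-refl (a R i))))
    (∨-false (==-false (a≢b₁ R i)) (==-false (a≢b₂ R i)))

  feas⇒feasible : Feas (G R) all-vertices (Roots R) ends → Feasible R
  feas⇒feasible (C , la , lb) = P , λ i j → walk-avoiding off (la (a∈ i) (a∈ j))
    where
    open PathIn (path-in (G R) (all-vertices ∖ C) (lb {b₁ R} {b₂ R} (pair-introˡ (b₁ R) (b₂ R)) (pair-introʳ (b₁ R) (b₂ R))))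
    P : Path (G R) (b₁ R) (b₂ R)
    P = record { len = len' ; vtx = f ; inj = f-inj ; start = f-zero ; end = f-last ; step = f-step }
    off : ∀ v → v ∈ all-vertices ∩ C → ¬ OnPath P v
    off v p (i , refl) = true≢false p (proj₂ (∖-elim all-vertices C (f-in i)))

  #-Roots : # (Roots R) ≡ m + 2
  #-Roots = ≤-antisym
    (≤-trans (#-∪-≤ image ends (Roots R) (λ v p → ∨-elim (image v) p)) (≤-reflexive (cong₂ _+_ (#-image (a R) (a-inj R)) #-ends)))
    (≤-trans (≤-reflexive (sym (cong₂ _+_ (#-image (a R) (a-inj R)) #-ends)))
      (#-∪-≥ image ends (Roots R) (λ _ → ∨-introˡ) ends⊆Roots disj))
    where
    image : VSet (RootedGraph.n R)
    image v = anyᵇ (λ i → a R i == v)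
    ==-sym : ∀ {n} (u v : Fin n) → (u == v) ≡ (v == u)
    ==-sym u v with bool (u == v)
    ... | inj₁ p = trans p (sym (==-intro (sym (==-elim u v p))))
    ... | inj₂ p = trans p (sym (∉-intro λ q → true≢false (==-intro (sym (==-elim v u q))) p))
    #-image : ∀ {m n} (f : Fin m → Fin n) → (∀ {i j} → f i ≡ f j → i ≡ j) → # (λ v → anyᵇ (λ i → f i == v)) ≡ m
    #-image {zero} {n} f fi = Σ-0 n
    #-image {suc m} {n} f fi = ≤-antisym
      (≤-trans (#-∪-≤ ⁅ f zero ⁆ rest whole λ v p → [ (λ q → inj₁ (trans (==-sym v (f zero)) q)) , inj₂ ]′ (∨-elim (f zero == v) p)) (≤-reflexive count))
      (≤-trans (≤-reflexive (sym count)) (#-∪-≥ ⁅ f zero ⁆ rest whole (λ v p → ∨-introˡ (trans (==-sym (f zero) v) p)) (λ v p → ∨-introʳ (f zero == v) p)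
        λ v p → ∉-intro λ q → let i , r = any-elim (λ i → f (suc i) == v) q in
          zero≢suc (fi (sym (trans (==-elim (f (suc i)) v r) (==-elim v (f zero) p))))))
      where
      rest whole : VSet n
      rest v = anyᵇ (λ i → f (suc i) == v)
      whole v = anyᵇ (λ i → f i == v)
      count : # ⁅ f zero ⁆ + # rest ≡ suc m
      count = cong₂ _+_ (#-single (f zero)) (#-image (f ∘ suc) (λ e → suc-inj (fi e)))
        where
        suc-inj : ∀ {k} {i j : Fin k} → Fin.suc i ≡ suc j → i ≡ j
        suc-inj refl = refl
      zero≢suc : ∀ {k} {i : Fin k} → zero ≡ Fin.suc i → ⊥
      zero≢suc ()
    #-ends : # ends ≡ 2
    #-ends = ≤-antisym
      (≤-trans (#-∪-≤ ⁅ b₁ R ⁆ ⁅ b₂ R ⁆ ends (λ v → ∨-elim (v == b₁ R))) (≤-reflexive (cong₂ _+_ (#-single (b₁ R)) (#-single (b₂ R)))))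
      (∈-count2 ends (b₁ R) (b₂ R) (pair-introˡ (b₁ R) (b₂ R)) (pair-introʳ (b₁ R) (b₂ R)) (b₁≢b₂ R))
    disj : ∀ v → v ∈ image → v ∉ ends
    disj v p with any-elim (λ i → a R i == v) p
    ... | i , q with ==-elim (a R i) v q
    ...   | refl = proj₂ (∖-elim (Roots R) ends (a∈ i))

-- The graph G / 𝒳

module _ {n} (G : Graph n) {r} (𝒳 : Fin r → VSet n) where

  quot-elim : ∀ {u v} → quotAdj G 𝒳 u v ≡ true → Adj G u v ⊎ (∃ λ i → u ∈ Nbd G (𝒳 i) × v ∈ Nbd G (𝒳 i))
  quot-elim {u} {v} p with ∨-elim (adj G u v) p
  ... | inj₁ q = inj₁ q
  ... | inj₂ q = let i , s = any-elim (λ i → Nbd G (𝒳 i) u ∧ Nbd G (𝒳 i) v) q in inj₂ (i , ∧-elim (Nbd G (𝒳 i) u) s)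

  quot-intro : ∀ {u v} → Adj G u v ⊎ (∃ λ i → u ∈ Nbd G (𝒳 i) × v ∈ Nbd G (𝒳 i)) → quotAdj G 𝒳 u v ≡ true
  quot-intro (inj₁ e) = ∨-introˡ e
  quot-intro {u} {v} (inj₂ (i , p , q)) = ∨-introʳ (adj G u v) (any-intro (λ i → Nbd G (𝒳 i) u ∧ Nbd G (𝒳 i) v) i (∧-intro p q))

  Quot : Fin n → Fin n → Set
  Quot u v = u ∈ Kept 𝒳 × v ∈ Kept 𝒳 × u ≢ v × quotAdj G 𝒳 u v ≡ true

  quot? : ∀ u v → Dec (Quot u v)
  quot? u v = (Kept 𝒳 u ≟ᵇ true) ×-dec (Kept 𝒳 v ≟ᵇ true) ×-dec ¬? (u ≟ v) ×-dec (quotAdj G 𝒳 u v ≟ᵇ true)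

  quotient : Graph n
  quotient = mkGraph quot?
    (λ {u} {v} (p , q , r , s) → q , p , r ∘ sym , quot-intro {v} {u}
      ([ (λ e → inj₁ (Adj-sym G e)) , (λ (i , x , y) → inj₂ (i , y , x)) ]′ (quot-elim {u} {v} s)))
    (λ (_ , _ , r , _) → r refl)

  quotient-elim : ∀ {u v} → Adj quotient u v → Quot u v
  quotient-elim {u} {v} = does⇒ (quot? u v)

  quotient-intro : ∀ {u v} → Quot u v → Adj quotient u v
  quotient-intro {u} {v} = dec-true (quot? u v)

  kept-elim : ∀ {v} → v ∈ Kept 𝒳 → ∀ i → v ∉ 𝒳 i
  kept-elim {v} p = any-false (λ i → 𝒳 i v) (not-elim (anyᵇ λ i → 𝒳 i v) p)

  kept-intro : ∀ {v} → (∀ i → v ∉ 𝒳 i) → v ∈ Kept 𝒳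
  kept-intro {v} h = not-intro (∉-intro λ p → let i , q = any-elim (λ i → 𝒳 i v) p in true≢false q (h i))

-- Z absorbs the members of 𝒳 whose neighbourhood it meets; they are replaced by ∅, so that no reindexing is needed.
module Merge {n} (G : Graph n) {r} (𝒳 : Fin r → VSet n) {S : VSet n} (coll : IsCollection G S 𝒳)
             (Z : VSet n) (Z⊆ : Z ⊆ Kept 𝒳 ∖ S) where

  private
    H = quotient G 𝒳

  meets : Fin r → Bool
  meets i = anyᵇ λ z → Z z ∧ Nbd G (𝒳 i) z

  merged : Fin (suc r) → VSet n
  merged zero    v = Z v ∨ anyᵇ (λ i → meets i ∧ 𝒳 i v)
  merged (suc i) v = not (meets i) ∧ 𝒳 i v

  Z-kept : ∀ {v} → v ∈ Z → v ∈ Kept 𝒳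
  Z-kept p = proj₁ (∖-elim (Kept 𝒳) S (Z⊆ _ p))

  separate : ∀ {i j v} → i ≢ j → v ∈ 𝒳 i ⊎ v ∈ Nbd G (𝒳 i) → v ∉ 𝒳 j
  separate {i} {j} {v} p q = sep coll i j p v ([ ∨-introˡ , ∨-introʳ (𝒳 i v) ]′ q)

  zero-elim : ∀ {v} → v ∈ merged zero → v ∈ Z ⊎ (∃ λ i → meets i ≡ true × v ∈ 𝒳 i)
  zero-elim {v} p with ∨-elim (Z v) p
  ... | inj₁ q = inj₁ q
  ... | inj₂ q = let i , s = any-elim (λ i → meets i ∧ 𝒳 i v) q in inj₂ (i , ∧-elim (meets i) s)

  zero-introʳ : ∀ {v i} → meets i ≡ true → v ∈ 𝒳 i → v ∈ merged zero
  zero-introʳ {v} {i} p q = ∨-introʳ (Z v) (any-intro (λ i → meets i ∧ 𝒳 i v) i (∧-intro p q))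

  meets-intro : ∀ {i z} → z ∈ Z → z ∈ Nbd G (𝒳 i) → meets i ≡ true
  meets-intro {i} {z} p q = any-intro (λ z → Z z ∧ Nbd G (𝒳 i) z) z (∧-intro p q)

  -- A neighbour of an absorbed member lies in that member's neighbourhood, which is a clique of `H`
  -- containing a vertex of `Z`.
  nbd-zero : Nbd G (merged zero) ⊆ Nbd H Z
  nbd-zero v p with Nbd-elim G (merged zero) p
  ... | v∉ , u , u∈ , uv = go (zero-elim u∈)
    where
    v∉Z : v ∉ Z
    v∉Z = ∉-intro λ q → true≢false (∨-introˡ q) v∉
    v∉𝒳 : ∀ {i} → meets i ≡ true → v ∉ 𝒳 i
    v∉𝒳 q = ∉-intro λ s → true≢false (zero-introʳ q s) v∉
    go : _ → v ∈ Nbd H Z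
    go (inj₁ u∈Z) = ∈-Nbd H Z v∉Z u∈Z (quotient-intro G 𝒳 {u} {v} (Z-kept u∈Z , kept-intro G 𝒳 kept , Adj-≢ G uv , quot-intro G 𝒳 {u} {v} (inj₁ uv)))
      where
      kept : ∀ i → v ∉ 𝒳 i
      kept i = ∉-intro λ q → true≢false q
        (v∉𝒳 (meets-intro u∈Z (∈-Nbd G (𝒳 i) (kept-elim G 𝒳 (Z-kept u∈Z) i) q (Adj-sym G uv))))
    go (inj₂ (i , q , u∈𝒳)) with any-elim (λ z → Z z ∧ Nbd G (𝒳 i) z) q
    ... | z , s with ∧-elim (Z z) s
    ...   | z∈Z , z∈N = ∈-Nbd H Z v∉Z z∈Z (quotient-intro G 𝒳 {z} {v} (Z-kept z∈Z , kept-intro G 𝒳 kept , ∈∉⇒≢ Z z∈Z v∉Z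
              , quot-intro G 𝒳 {z} {v} (inj₂ (i , z∈N , v∈N))))
      where
      v∈N : v ∈ Nbd G (𝒳 i)
      v∈N = ∈-Nbd G (𝒳 i) (v∉𝒳 q) u∈𝒳 uv
      kept : ∀ j → v ∉ 𝒳 j
      kept j with i ≟ j
      ... | yes refl = v∉𝒳 q
      ... | no i≢j = separate i≢j (inj₂ v∈N)

  suc-elim : ∀ {v} i → v ∈ merged (suc i) → meets i ≡ false × v ∈ 𝒳 i
  suc-elim i p = let q , s = ∧-elim (not (meets i)) p in not-elim (meets i) q , s

  nbd-suc : ∀ {v} i → v ∈ Nbd G (merged (suc i)) → meets i ≡ false × v ∈ Nbd G (𝒳 i)
  nbd-suc {v} i p with Nbd-elim G (merged (suc i)) p
  ... | v∉ , u , u∈ , uv with suc-elim i u∈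
  ...   | q , u∈𝒳 = q , ∈-Nbd G (𝒳 i) (∉-intro λ s → true≢false (∧-intro (not-intro q) s) v∉) u∈𝒳 uv

  kept-merged : ∀ {v} → v ∈ Kept merged → v ∈ Kept 𝒳 × v ∉ Z
  kept-merged {v} p = kept-intro G 𝒳 kept , v∉Z
    where
    v∉Z : v ∉ Z
    v∉Z = ∉-intro λ q → true≢false (∨-introˡ q) (kept-elim G merged p zero)
    kept : ∀ i → v ∉ 𝒳 i
    kept i with bool (meets i)
    ... | inj₁ q = ∉-intro λ s → true≢false (zero-introʳ q s) (kept-elim G merged p zero)
    ... | inj₂ q = ∉-intro λ s → true≢false (∧-intro (not-intro q) s) (kept-elim G merged p (suc i))

  merged-collection : IsCollection G S merged
  merged-collection = record { avoid = avoid' ; sep = sep' }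
    where
    avoid' : ∀ i v → v ∈ merged i → v ∉ S
    avoid' zero v p = [ (λ q → proj₂ (∖-elim (Kept 𝒳) S (Z⊆ v q))) , (λ (i , _ , q) → avoid coll i v q) ]′ (zero-elim p)
    avoid' (suc i) v p = avoid coll i v (proj₂ (suc-elim i p))
    sep' : ∀ i j → i ≢ j → ∀ v → v ∈ CNbd G (merged i) → v ∉ merged j
    sep' zero zero i≢j = ⊥-elim (i≢j refl)
    sep' zero (suc j) _ v p = ∉-intro λ q → let s , v∈𝒳 = suc-elim j q in
      [ (λ t → [ (λ x → true≢false v∈𝒳 (kept-elim G 𝒳 (Z-kept x) j))
               , (λ (i , x , y) → true≢false v∈𝒳 (separate {i} {j} (λ { refl → true≢false x s }) (inj₁ y))) ]′ (zero-elim t))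
      , (λ t → true≢false v∈𝒳 (kept-elim G 𝒳 (kept (nbd-zero v t)) j)) ]′ (∨-elim (merged zero v) p)
      where
      kept : ∀ {v} → v ∈ Nbd H Z → v ∈ Kept 𝒳
      kept {v} p with Nbd-elim H Z p
      ... | _ , w , _ , e = proj₁ (proj₂ (quotient-elim G 𝒳 {w} {v} e))
    sep' (suc i) zero _ v p = ∉-intro λ q →
      [ (λ v∈Z → [ (λ (_ , x) → true≢false x (kept-elim G 𝒳 (Z-kept v∈Z) i))
                 , (λ (s , x) → true≢false (meets-intro v∈Z x) s) ]′ near)
      , (λ (j , x , y) → true≢false y (separate {i} {j} (λ { refl → true≢false x ([ proj₁ , proj₁ ]′ near) }) ([ (λ z → inj₁ (proj₂ z)) , (λ z → inj₂ (proj₂ z)) ]′ near))) ]′ (zero-elim q)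
      where
      near : (meets i ≡ false × v ∈ 𝒳 i) ⊎ (meets i ≡ false × v ∈ Nbd G (𝒳 i))
      near = [ (λ x → inj₁ (suc-elim i x)) , (λ x → inj₂ (nbd-suc i x)) ]′ (∨-elim (merged (suc i) v) p)
    sep' (suc i) (suc j) i≢j v p = ∉-intro λ q → true≢false (proj₂ (suc-elim j q))
      (separate {i} {j} (λ e → i≢j (cong suc e))
        ([ (λ x → inj₁ (proj₂ (suc-elim i x))) , (λ x → inj₂ (proj₂ (nbd-suc i x))) ]′ (∨-elim (merged (suc i) v) p)))

  -- Together with the equality of roles this inclusion is enough, because feasibility survives
  -- adding edges.
  merged-adj : ∀ {u v} → Adj (quotient G merged) u v → Adj (eliminate H Z) u v
  merged-adj {u} {v} e with quotient-elim G merged {u} {v} e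
  ... | u∈ , v∈ , u≢v , q = eliminate-intro H {Z} {u} {v} (proj₂ (kept-merged u∈) , proj₂ (kept-merged v∈) , u≢v , go (quot-elim G merged {u} {v} q))
    where
    old : Adj G u v ⊎ (∃ λ i → u ∈ Nbd G (𝒳 i) × v ∈ Nbd G (𝒳 i)) → Adj H u v
    old x = quotient-intro G 𝒳 {u} {v} (proj₁ (kept-merged u∈) , proj₁ (kept-merged v∈) , u≢v , quot-intro G 𝒳 {u} {v} x)
    go : _ → Adj H u v ⊎ (u ∈ Nbd H Z × v ∈ Nbd H Z)
    go (inj₁ x) = inj₁ (old (inj₁ x))
    go (inj₂ (zero , x , y)) = inj₂ (nbd-zero u x , nbd-zero v y)
    go (inj₂ (suc i , x , y)) = inj₁ (old (inj₂ (i , proj₂ (nbd-suc i x) , proj₂ (nbd-suc i y))))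

-- If b and b' are adjacent, then bb' counts in e(𝒢/𝒳), so one edge less than in `Dense` must suffice: a component
-- missing a root has a neighbourhood smaller than S, and so has the rest.
joined-feasible : ∀ {n} k (G : Graph n) {U S B : VSet n} {b b'} → Disjoint U S → Nbd G U ⊆ S → Sparse k G U S →
  k * # U + 1 ≤ ρ G U → B ⊆ S → b ∈ B → b' ∈ B → (∀ v → v ∈ B → v ≡ b ⊎ v ≡ b') → Adj G b b' → Feas G (U ∪ S) S B
joined-feasible {n} k G {U} {S} {B} {b} {b'} dis N⊆S sparse excess B⊆S b∈B b'∈B cover bb' =
  R , (λ {a} {a'} p q → link (component G R a (A⊆R p)) p q) , linked-pair cover (cons (end-in b∈B) bb' (nil (end-in b'∈B)))
  where
  R = (U ∪ S) ∖ B
  A⊆R : ∀ {v} → v ∈ S ∖ B → v ∈ R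
  A⊆R {v} p = let q , s = ∖-elim S B p in ∖-intro (U ∪ S) B (∨-introʳ (U v) q) s
  U⊆R : ∀ {v} → v ∈ U → v ∈ R
  U⊆R {v} p = ∖-intro (U ∪ S) B (∨-introˡ p) (∉-intro λ q → true≢false (B⊆S v q) (dis v p))
  end-in : ∀ {v} → v ∈ B → v ∈ (U ∪ S) ∖ R
  end-in {v} p = ∖-intro (U ∪ S) R (∨-introʳ (U v) (B⊆S v p)) (∉-intro λ q → true≢false p (proj₂ (∖-elim (U ∪ S) B q)))
  R⊆ : R ⊆ (U ∪ S) ∩ R
  R⊆ v p = ∧-intro (proj₁ (∖-elim (U ∪ S) B p)) p
  link : ∀ {a a'} → ∃ (Component G R a) → a ∈ S ∖ B → a' ∈ S ∖ B → Walk G ((U ∪ S) ∩ R) a a'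
  link {a} {a'} (K , K⊆R , a∈K , walk , closedK) a∈ a'∈ with bool (K a')
  ... | inj₁ p = walk-mono R⊆ (walk a' p)
  ... | inj₂ a'∉K = ⊥-elim (<⇒≱ (≤-trans (≤-reflexive (+-comm 1 (k * # U))) excess)
          (≤-trans (≤-trans cut (small U₁ U₁⊆U off₁ a' (proj₁ (∖-elim S B a'∈)) a'∉ ⊕ small U₂ U₂⊆U off₂ a (proj₁ (∖-elim S B a∈)) a∉))
            (≤-trans (≤-reflexive (sym (*-distribˡ-+ k (# U₁) (# U₂)))) (*-monoʳ-≤ k
              (#-∪-≥ U₁ U₂ U U₁⊆U U₂⊆U (λ v p → ∉-intro λ q → true≢false (proj₂ (∧-elim (U v) p)) (proj₂ (∖-elim U K q))))))))
    where
    U₁ U₂ : VSet n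
    U₁ = U ∩ K
    U₂ = U ∖ K
    U₁⊆U : U₁ ⊆ U
    U₁⊆U v p = proj₁ (∧-elim (U v) p)
    U₂⊆U : U₂ ⊆ U
    U₂⊆U v p = proj₁ (∖-elim U K p)
    a'∉ : a' ∉ Nbd G U₁
    a'∉ = ∉-intro λ p → let _ , w , q , e = Nbd-elim G U₁ p in
      true≢false (closedK (proj₂ (∧-elim (U w) q)) (A⊆R a'∈) e) a'∉K
    a∉ : a ∉ Nbd G U₂
    a∉ = ∉-intro λ p → let _ , w , q , e = Nbd-elim G U₂ p ; s , t = ∖-elim U K q in
      true≢false (closedK a∈K (U⊆R s) (Adj-sym G e)) t
    small : ∀ X → X ⊆ U → (∀ {v} → v ∈ U → v ∉ Nbd G X) → ∀ s → s ∈ S → s ∉ Nbd G X → ρ G X ≤ k * # X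
    small X X⊆U off s s∈S s∉ = sparse X X⊆U (#-< (Nbd G X) S s in-S s∈S s∉)
      where
      in-S : Nbd G X ⊆ S
      in-S v p with bool (U v)
      ... | inj₂ q = N⊆S v (Nbd-mono G X⊆U q p)
      ... | inj₁ q = absurd p (off q)
    off₁ : ∀ {v} → v ∈ U → v ∉ Nbd G U₁
    off₁ v∈U = ∉-intro λ p → let v∉ , w , q , e = Nbd-elim G U₁ p in
      true≢false (∧-intro v∈U (closedK (proj₂ (∧-elim (U w) q)) (U⊆R v∈U) e)) v∉
    off₂ : ∀ {v} → v ∈ U → v ∉ Nbd G U₂
    off₂ {v} v∈U = ∉-intro λ p → let v∉ , w , q , e = Nbd-elim G U₂ p ; s , t = ∖-elim U K q in
      [ (λ v∈K → true≢false (closedK v∈K (U⊆R s) (Adj-sym G e)) t)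
      , (λ v∉K → true≢false (∖-intro U K v∈U v∉K) v∉) ]′ (bool (K v))
    side : ∀ v → v ∈ U → v ∈ U₁ ⊎ v ∈ U₂
    side v p = [ (λ q → inj₁ (∧-intro p q)) , (λ q → inj₂ (∖-intro U K p q)) ]′ (bool (K v))
    cut : ρ G U ≤ ρ G U₁ + ρ G U₂
    cut = ≤-trans (Σ-mono λ u → #-∪-≤ (λ v → (toℕ u <ᵇ toℕ v) ∧ touch G U₁ u v) (λ v → (toℕ u <ᵇ toℕ v) ∧ touch G U₂ u v)
              (λ v → (toℕ u <ᵇ toℕ v) ∧ touch G U u v) λ v p → let l , q = ∧-elim (toℕ u <ᵇ toℕ v) p ; e , t = touch-elim G U {u} {v} q in
                [ (λ x → [ (λ y → inj₁ (∧-intro l (touch-intro G U₁ {u} {v} e (inj₁ y)))) , (λ y → inj₂ (∧-intro l (touch-intro G U₂ {u} {v} e (inj₁ y)))) ]′ (side u x))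
                , (λ x → [ (λ y → inj₁ (∧-intro l (touch-intro G U₁ {u} {v} e (inj₂ y)))) , (λ y → inj₂ (∧-intro l (touch-intro G U₂ {u} {v} e (inj₂ y)))) ]′ (side v x)) ]′ t)
      (≤-reflexive (Σ-+ (λ u → # λ v → (toℕ u <ᵇ toℕ v) ∧ touch G U₁ u v) (λ u → # λ v → (toℕ u <ᵇ toℕ v) ∧ touch G U₂ u v)))

-- Edges between roots

𝟙-∧ : ∀ a b → 𝟙 (a ∧ b) ≡ 𝟙 a * 𝟙 b
𝟙-∧ true  b = sym (+-identityʳ (𝟙 b))
𝟙-∧ false b = refl

exclusive : ∀ a b c d {t} → (a ∨ b ∨ c ∨ d ≡ true → t ≡ true) → (a ≡ true → b ∨ c ∨ d ≡ false) →
            (b ≡ true → c ∨ d ≡ false) → (c ≡ true → d ≡ false) → 𝟙 a + (𝟙 b + (𝟙 c + 𝟙 d)) ≤ 𝟙 t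
exclusive false false false false h _ _ _ = z≤n
exclusive false false false true  h _ _ _ = ≤-reflexive (sym (cong 𝟙 (h refl)))
exclusive false false true  d     h _ _ g with g refl
... | refl = ≤-reflexive (sym (cong 𝟙 (h refl)))
exclusive false true false false h _ _ _ = ≤-reflexive (sym (cong 𝟙 (h refl)))
exclusive false true false true  h _ g _ with g refl
... | ()
exclusive false true true d h _ g _ with g refl
... | ()
exclusive true false false false h _ _ _ = ≤-reflexive (sym (cong 𝟙 (h refl)))
exclusive true true c d h f _ _ with f refl
... | ()
exclusive true false true d h f _ _ with f refl
... | ()
exclusive true false false true h f _ _ with f refl
... | ()

module _ {n} (S : VSet n) (b b' : Fin n) (b∈S : b ∈ S) (b'∈S : b' ∈ S) (b≢b' : b ≢ b') (q : Bool) where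

  Ends : Fin n → Fin n → Set
  Ends u v = (u ≡ b × v ≡ b') ⊎ (u ≡ b' × v ≡ b)

  ends? : ∀ u v → Dec (Ends u v)
  ends? u v = ((u ≟ b) ×-dec (v ≟ b')) ⊎-dec ((u ≟ b') ×-dec (v ≟ b))

  RootEdge : Fin n → Fin n → Set
  RootEdge u v = u ∈ S × v ∈ S × u ≢ v × (q ≡ true ⊎ ¬ Ends u v)

  rootEdge? : ∀ u v → Dec (RootEdge u v)
  rootEdge? u v = (S u ≟ᵇ true) ×-dec (S v ≟ᵇ true) ×-dec ¬? (u ≟ v) ×-dec ((q ≟ᵇ true) ⊎-dec ¬? (ends? u v))

  -- q tells whether bb' is an edge of G/𝒳, in which case e(𝒢/𝒳) counts it.
  rootGraph : Graph n
  rootGraph = mkGraph rootEdge?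
    (λ (x , y , z , w) → y , x , z ∘ sym , [ inj₁ , (λ f → inj₂ λ e → f ([ (λ (g , h) → inj₂ (h , g)) , (λ (g , h) → inj₁ (h , g)) ]′ e)) ]′ w)
    (λ (_ , _ , z , _) → z refl)

  rootGraph-intro : ∀ {u v} → RootEdge u v → Adj rootGraph u v
  rootGraph-intro {u} {v} = dec-true (rootEdge? u v)

  -- Of the ordered pairs of roots, the diagonal takes |S|, and `bb'` takes two more when it is not
  -- counted as an edge.
  rootGraph-count : (half (adj rootGraph) + half (adj rootGraph)) + (𝟙 (not q) + (𝟙 (not q) + # S)) ≤ # S * # S
  rootGraph-count = ≤-trans (≤-reflexive (sym left)) (≤-trans (ΣΣ-mono point) (≤-reflexive right))
    where
    e₁ e₂ d : Fin n → Fin n → Bool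
    e₁ u v = (u == b) ∧ sing (not q) b' v
    e₂ u v = (u == b') ∧ sing (not q) b v
    d  u v = (u == v) ∧ S v

    ΣΣ-e : ∀ x y → ΣΣ (λ u v → 𝟙 ((u == x) ∧ sing (not q) y v)) ≡ 𝟙 (not q)
    ΣΣ-e x y = trans (ΣΣ-cong λ u v → 𝟙-∧ (u == x) (sing (not q) y v)) (trans (ΣΣ-row x (𝟙 ∘ sing (not q) y)) (#-sing (not q) y))
    ΣΣ-d : ΣΣ (λ u v → 𝟙 (d u v)) ≡ # S
    ΣΣ-d = trans (ΣΣ-cong λ u v → 𝟙-∧ (u == v) (S v)) (trans (Σ-swap (λ u v → 𝟙 (u == v) * 𝟙 (S v))) (Σ-cong λ v → Σ-single v (λ _ → 𝟙 (S v))))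
    left : ΣΣ (λ u v → 𝟙 (adj rootGraph u v) + (𝟙 (e₁ u v) + (𝟙 (e₂ u v) + 𝟙 (d u v)))) ≡
           (half (adj rootGraph) + half (adj rootGraph)) + (𝟙 (not q) + (𝟙 (not q) + # S))
    left = trans (ΣΣ-+ (λ u v → 𝟙 (adj rootGraph u v)) (λ u v → 𝟙 (e₁ u v) + (𝟙 (e₂ u v) + 𝟙 (d u v))))
      (cong₂ _+_ (ΣΣ-half (adj rootGraph) (adj-sym rootGraph) (adj-irrefl rootGraph))
        (trans (ΣΣ-+ (λ u v → 𝟙 (e₁ u v)) (λ u v → 𝟙 (e₂ u v) + 𝟙 (d u v)))
          (cong₂ _+_ (ΣΣ-e b b') (trans (ΣΣ-+ (λ u v → 𝟙 (e₂ u v)) (λ u v → 𝟙 (d u v))) (cong₂ _+_ (ΣΣ-e b' b) ΣΣ-d)))))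
    right : ΣΣ (λ u v → 𝟙 (S u ∧ S v)) ≡ # S * # S
    right = trans (Σ-cong λ u → trans (Σ-cong λ v → 𝟙-∧ (S u) (S v)) (trans (Σ-* (𝟙 (S u)) (𝟙 ∘ S)) (*-comm (𝟙 (S u)) (# S)))) (Σ-* (# S) (𝟙 ∘ S))
    e-elim : ∀ {u v x y} → (u == x) ∧ sing (not q) y v ≡ true → u ≡ x × v ≡ y × q ≡ false
    e-elim {u} {v} {x} {y} p = let r , s = ∧-elim (u == x) p ; t , w = sing-elim (not q) y v s in ==-elim u x r , t , not-elim q w
    d-elim : ∀ {u v} → d u v ≡ true → u ≡ v × v ∈ S
    d-elim {u} {v} p = let r , s = ∧-elim (u == v) p in ==-elim u v r , s
    point : ∀ u v → 𝟙 (adj rootGraph u v) + (𝟙 (e₁ u v) + (𝟙 (e₂ u v) + 𝟙 (d u v))) ≤ 𝟙 (S u ∧ S v)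
    point u v = exclusive (adj rootGraph u v) (e₁ u v) (e₂ u v) (d u v) inS x₁ x₂ x₃
      where
      inS : adj rootGraph u v ∨ e₁ u v ∨ e₂ u v ∨ d u v ≡ true → S u ∧ S v ≡ true
      inS p with ∨-elim (adj rootGraph u v) p
      ... | inj₁ r = let x , y , _ = does⇒ (rootEdge? u v) r in ∧-intro x y
      ... | inj₂ p with ∨-elim (e₁ u v) p
      ...   | inj₁ r with e-elim {u} {v} {b} {b'} r
      ...     | refl , refl , _ = ∧-intro b∈S b'∈S
      inS p | inj₂ p' | inj₂ p″ with ∨-elim (e₂ u v) p″
      ...   | inj₁ r with e-elim {u} {v} {b'} {b} r
      ...     | refl , refl , _ = ∧-intro b'∈S b∈S
      inS p | inj₂ p' | inj₂ p″ | inj₂ r with d-elim {u} {v} r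
      ...   | refl , v∈S = ∧-intro v∈S v∈S
      x₁ : adj rootGraph u v ≡ true → e₁ u v ∨ e₂ u v ∨ d u v ≡ false
      x₁ p with does⇒ (rootEdge? u v) p
      ... | _ , _ , u≢v , h = ∨-false (∉-intro λ r → let x , y , z = e-elim {u} {v} {b} {b'} r in [ (λ t → true≢false t z) , (λ f → f (inj₁ (x , y))) ]′ h)
        (∨-false (∉-intro λ r → let x , y , z = e-elim {u} {v} {b'} {b} r in [ (λ t → true≢false t z) , (λ f → f (inj₂ (x , y))) ]′ h)
          (∉-intro λ r → u≢v (proj₁ (d-elim {u} {v} r))))
      x₂ : e₁ u v ≡ true → e₂ u v ∨ d u v ≡ false
      x₂ p with e-elim {u} {v} {b} {b'} p
      ... | x , y , _ = ∨-false (∉-intro λ r → b≢b' (trans (sym x) (proj₁ (e-elim {u} {v} {b'} {b} r))))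
        (∉-intro λ r → b≢b' (trans (sym x) (trans (proj₁ (d-elim {u} {v} r)) y)))
      x₃ : e₂ u v ≡ true → d u v ≡ false
      x₃ p with e-elim {u} {v} {b'} {b} p
      ... | x , y , _ = ∉-intro λ r → b≢b' (trans (sym y) (trans (sym (proj₁ (d-elim {u} {v} r))) x))

-- Eliminating violators until the edge count holds

module _ {m} (R : RootedGraph m) where

  private
    nᵥ : ℕ
    nᵥ = RootedGraph.n R
    G₀ : Graph nᵥ
    G₀ = G R
    S B : VSet nᵥ
    S = Roots R
    B = ends R
    β₁ β₂ : Fin nᵥ
    β₁ = b₁ R
    β₂ = b₂ R
    β₁∈B : β₁ ∈ B
    β₁∈B = pair-introˡ β₁ β₂
    β₂∈B : β₂ ∈ B
    β₂∈B = pair-introʳ β₁ β₂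
    cover : ∀ v → v ∈ B → v ≡ β₁ ⊎ v ≡ β₂
    cover = pair-elim β₁ β₂

  Result : Set
  Result = Σ ℕ λ k → Σ (Fin k → VSet nᵥ) λ 𝒳 → IsCollection G₀ S 𝒳 × (∀ i → countᵇ (Nbd G₀ (𝒳 i)) ≤ suc m) ×
    (2 * eRootedQuot R 𝒳 + (m * m + 3 * m + 2) ≤ 2 * (suc m) * vQuot 𝒳)

  module _ {r} (𝒳 : Fin r → VSet nᵥ) (coll : IsCollection G₀ S 𝒳) where

    private
      H : Graph nᵥ
      H = quotient G₀ 𝒳
      U : VSet nᵥ
      U = Kept 𝒳 ∖ S
      q : Bool
      q = adj H β₁ β₂

    S⊆Kept : S ⊆ Kept 𝒳
    S⊆Kept v p = kept-intro G₀ 𝒳 λ i → ∉-intro λ x → true≢false p (avoid coll i v x)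

    ⊆Kept : U ∪ S ⊆ Kept 𝒳
    ⊆Kept v p = [ (λ x → proj₁ (∖-elim (Kept 𝒳) S x)) , S⊆Kept v ]′ (∨-elim (U v) p)

    U∩S : Disjoint U S
    U∩S v p = proj₂ (∖-elim (Kept 𝒳) S p)

    N⊆S : Nbd H U ⊆ S
    N⊆S v p with Nbd-elim H U p
    ... | v∉U , u , _ , uv with quotient-elim G₀ 𝒳 {u} {v} uv
    ...   | _ , v∈ , _ = [ id , (λ x → absurd (∖-intro (Kept 𝒳) S v∈ x) v∉U) ]′ (bool (S v))

    private
      Γ : Graph nᵥ
      Γ = rootGraph S β₁ β₂ (ends⊆Roots R β₁ β₁∈B) (ends⊆Roots R β₂ β₂∈B) (b₁≢b₂ R) q

    edge-count : eRootedQuot R 𝒳 ≤ ρ H U + half (adj Γ)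
    edge-count = ≤-trans (≤-reflexive (Σ-cong λ u → countᵇ≡# (edge u)))
      (≤-trans (Σ-mono λ u → #-∪-≤ (λ v → (toℕ u <ᵇ toℕ v) ∧ touch H U u v) (λ v → (toℕ u <ᵇ toℕ v) ∧ adj Γ u v) (edge u) (classify u))
        (≤-reflexive (Σ-+ (λ u → # λ v → (toℕ u <ᵇ toℕ v) ∧ touch H U u v) (λ u → # λ v → (toℕ u <ᵇ toℕ v) ∧ adj Γ u v))))
      where
      edge : Fin nᵥ → VSet nᵥ
      edge u v = (toℕ u <ᵇ toℕ v) ∧ Kept 𝒳 u ∧ Kept 𝒳 v ∧ rootedQuotAdj R 𝒳 u v
      roots : ∀ {u v} → u ∈ S → v ∈ S → u ≢ v → q ≡ true ⊎ ¬ Ends S β₁ β₂ (ends⊆Roots R β₁ β₁∈B) (ends⊆Roots R β₂ β₂∈B) (b₁≢b₂ R) q u v → Adj Γ u v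
      roots {u} {v} x y z w = rootGraph-intro S β₁ β₂ (ends⊆Roots R β₁ β₁∈B) (ends⊆Roots R β₂ β₂∈B) (b₁≢b₂ R) q {u} {v} (x , y , z , w)
      classify : ∀ u v → v ∈ edge u → (toℕ u <ᵇ toℕ v) ∧ touch H U u v ≡ true ⊎ (toℕ u <ᵇ toℕ v) ∧ adj Γ u v ≡ true
      classify u v p with ∧-elim (toℕ u <ᵇ toℕ v) p
      ... | l , p₁ with ∧-elim (Kept 𝒳 u) p₁
      ...   | u∈ , p₂ with ∧-elim (Kept 𝒳 v) p₂
      ...     | v∈ , p₃ = [ [ (λ x → inj₁ (∧-intro l x)) , (λ x → inj₂ (∧-intro l x)) ]′ ∘ old , (λ x → inj₂ (∧-intro l (new x))) ]′ (∨-elim (quotAdj G₀ 𝒳 u v) p₃)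
        where
        u≢v : u ≢ v
        u≢v refl = true≢false l (dec-false (toℕ u <? toℕ u) (<-irrefl refl))
        old : quotAdj G₀ 𝒳 u v ≡ true → touch H U u v ≡ true ⊎ Adj Γ u v
        old e with bool (S u) | bool (S v)
        ... | inj₂ x | _ = inj₁ (touch-intro H U {u} {v} (quotient-intro G₀ 𝒳 {u} {v} (u∈ , v∈ , u≢v , e)) (inj₁ (∖-intro (Kept 𝒳) S u∈ x)))
        ... | _ | inj₂ x = inj₁ (touch-intro H U {u} {v} (quotient-intro G₀ 𝒳 {u} {v} (u∈ , v∈ , u≢v , e)) (inj₂ (∖-intro (Kept 𝒳) S v∈ x)))
        ... | inj₁ x | inj₁ y = inj₂ (roots x y u≢v ([ inj₁ , (λ z → inj₂ (contra z)) ]′ (bool q)))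
          where
          uv : Adj H u v
          uv = quotient-intro G₀ 𝒳 {u} {v} (u∈ , v∈ , u≢v , e)
          contra : q ≡ false → ¬ Ends S β₁ β₂ (ends⊆Roots R β₁ β₁∈B) (ends⊆Roots R β₂ β₂∈B) (b₁≢b₂ R) q u v
          contra z (inj₁ (refl , refl)) = true≢false uv z
          contra z (inj₂ (refl , refl)) = true≢false (Adj-sym H {u} {v} uv) z
        new : Roots R u ∧ Roots R v ∧ not (u == v) ∧ not ((u == β₁ ∧ v == β₂) ∨ (u == β₂ ∧ v == β₁)) ≡ true → Adj Γ u v
        new x with ∧-elim (S u) x
        ... | x₁ , y with ∧-elim (S v) y
        ...   | x₂ , z with ∧-elim (not (u == v)) z
        ...     | _ , w = roots x₁ x₂ u≢v (inj₂ λ e → true≢false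
          ([ (λ { (refl , refl) → ∨-introˡ (∧-intro (==-refl β₁) (==-refl β₂)) })
           , (λ { (refl , refl) → ∨-introʳ ((β₂ == β₁) ∧ (β₁ == β₂)) (∧-intro (==-refl β₂) (==-refl β₁)) }) ]′ e)
          (not-elim ((u == β₁ ∧ v == β₂) ∨ (u == β₂ ∧ v == β₁)) w))

    -- The extra edge allowed at `U` is offset by the edge b₁b₂ missing among the roots. With |U| ≤
    -- v - (m+2) and at most (m+2)(m+1) ordered pairs of roots, twice the edge count is at most
    -- 2(m+1)v - (m+1)(m+2), and (m+1)(m+2) = m² + 3m + 2.
    output : (∀ i → # (Nbd G₀ (𝒳 i)) ≤ suc m) → ρ H U ≤ suc m * # U + 𝟙 (not q) → Result
    output orders few = r , 𝒳 , coll , (λ i → ≤-trans (≤-reflexive (countᵇ≡# (Nbd G₀ (𝒳 i)))) (orders i)) ,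
      lin (2 * eRootedQuot R 𝒳 + (m * m + 3 * m + 2)) (2 * suc m * vQuot 𝒳) 0
        (edge-count ⊕ edge-count ⊕ few ⊕ few
          ⊕ subst (λ s → (half (adj Γ) + half (adj Γ)) + (𝟙 (not q) + (𝟙 (not q) + s)) ≤ s * s) (#-Roots R)
              (rootGraph-count S β₁ β₂ (ends⊆Roots R β₁ β₁∈B) (ends⊆Roots R β₂ β₂∈B) (b₁≢b₂ R) q)
          ⊕ *-monoʳ-≤ (2 * suc m) vertices)
        (eq m (eRootedQuot R 𝒳) (ρ H U) (half (adj Γ)) (# U) (𝟙 (not q)) (vQuot 𝒳))
      where
      vertices : # U + (m + 2) ≤ vQuot 𝒳
      vertices = ≤-trans (≤-reflexive (cong (# U +_) (sym (#-Roots R))))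
        (≤-trans (#-∪-≥ U S (Kept 𝒳) (λ v p → ⊆Kept v (∨-introˡ p)) S⊆Kept U∩S) (≤-reflexive (sym (countᵇ≡# (Kept 𝒳)))))
      eq : ∀ m e p h u c v → 2 * e + (m * m + 3 * m + 2) +
             (p + h + (p + h + (suc m * u + c + (suc m * u + c + ((m + 2) * (m + 2) + 2 * suc m * v))))) + 0 ≡
           2 * suc m * v + (e + (e + (p + (p + ((h + h) + (c + (c + (m + 2))) + 2 * suc m * (u + (m + 2)))))))
      eq = solve-∀

    -- Failure of the count leaves an excess of one edge if b₁b₂ is an edge of the quotient and of
    -- two otherwise, just what `joined-feasible` and `massed-feasible` ask for.
    dense-feasible : Sparse (suc m) H U S → suc m * # U + 𝟙 (not q) < ρ H U → Feas H (U ∪ S) S B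
    dense-feasible sparse h with bool q
    ... | inj₁ p = joined-feasible (suc m) H U∩S N⊆S sparse
          (≤-trans (≤-trans (+-monoʳ-≤ (suc m * # U) (s≤s z≤n)) (≤-reflexive (+-suc (suc m * # U) (𝟙 (not q))))) h)
          (ends⊆Roots R) β₁∈B β₂∈B cover p
    ... | inj₂ p = massed-feasible (suc (# U)) H U S B ≤-refl (massed U∩S N⊆S (ends⊆Roots R) (β₁ , β₂ , cover)
          (≤-reflexive (trans (#-Roots R) (+-comm m 2))) sparse
          (inj₁ (≤-trans (≤-reflexive (trans (+-suc (suc m * # U) 1) (cong (λ t → suc (suc m * # U + t)) (sym (cong (λ b → 𝟙 (not b)) p))))) h)))

  -- The last argument carries a solution in the current quotient back to the given graph. The
  -- number of remaining non-roots drops, since a violator touches an edge and so is nonempty.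
  search : ∀ fuel {r} (𝒳 : Fin r → VSet nᵥ) → # (Kept 𝒳 ∖ S) < fuel → IsCollection G₀ S 𝒳 →
    (∀ i → # (Nbd G₀ (𝒳 i)) ≤ suc m) →
    (Feas (quotient G₀ 𝒳) (Kept 𝒳) S B → Feas G₀ all-vertices S B) → Feas G₀ all-vertices S B ⊎ Result
  search (suc fuel) {r} 𝒳 (s≤s le) coll orders lift with ρ H U ≤? suc m * # U + 𝟙 (not (adj H β₁ β₂))
    where
    H = quotient G₀ 𝒳
    U = Kept 𝒳 ∖ S
  ... | yes few = inj₂ (output 𝒳 coll orders few)
  ... | no ¬few = go (violator? (suc m) H U (# S))
    where
    H = quotient G₀ 𝒳
    U = Kept 𝒳 ∖ S
    go : _ → Feas G₀ all-vertices S B ⊎ Result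
    go (inj₂ none) = inj₁ (lift (feas-mono {G = H} {G' = H} (λ _ _ e → e) (⊆Kept 𝒳 coll) (λ _ p → p) (λ _ p → p)
      (dense-feasible 𝒳 coll (λ X s l → ≮⇒≥ λ x → none X (s , l , x)) (≰⇒> ¬few))))
    go (inj₁ (X , X⊆U , X< , ex)) with rigid-violator (massed-feasible (suc (# X))) (suc (# (Nbd H X))) H X ≤-refl ≤-refl
           (s≤s⁻¹ (≤-trans X< (≤-reflexive (trans (#-Roots R) (+-comm m 2))))) ex
    ... | Z , Z⊆X , Z≤ , exZ , rigid = search fuel merged
            (≤-trans (#-< (Kept merged ∖ S) U z (λ v p → let x , y = ∖-elim (Kept merged) S p in ∖-intro (Kept 𝒳) S (proj₁ (kept-merged x)) y)
               (Z⊆U z z∈Z) (∉-intro λ p → true≢false z∈Z (proj₂ (kept-merged (proj₁ (∖-elim (Kept merged) S p)))))) le)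
            merged-collection orders' lift'
      where
      Z⊆U : Z ⊆ U
      Z⊆U = ⊆-trans Z⊆X X⊆U
      open Merge G₀ 𝒳 coll Z Z⊆U
      z : Fin nᵥ
      z = proj₁ (ρ-∅ H {Z} (≤-trans (s≤s z≤n) exZ))
      z∈Z : z ∈ Z
      z∈Z = proj₂ (ρ-∅ H {Z} (≤-trans (s≤s z≤n) exZ))
      orders' : ∀ i → # (Nbd G₀ (merged i)) ≤ suc m
      orders' zero = ≤-trans (#-mono (Nbd G₀ (merged zero)) (Nbd H Z) nbd-zero)
        (≤-trans Z≤ (s≤s⁻¹ (≤-trans X< (≤-reflexive (trans (#-Roots R) (+-comm m 2))))))
      orders' (suc i) = ≤-trans (#-mono (Nbd G₀ (merged (suc i))) (Nbd G₀ (𝒳 i)) (λ v p → proj₂ (nbd-suc i p))) (orders i)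
      lift' : Feas (quotient G₀ merged) (Kept merged) S B → Feas G₀ all-vertices S B
      lift' f = lift (feas-mono {G = H} {G' = H} (λ _ _ e → e)
        (λ v p → [ (λ x → proj₁ (∖-elim (Kept 𝒳) Z x)) , Z-kept ]′ (∨-elim ((Kept 𝒳 ∖ Z) v) p)) (λ _ p → p) (λ _ p → p)
        (eliminate-feas H {Z} {Kept 𝒳 ∖ Z} {S} {B}
          (λ v p → let x , y , _ , e = Nbd-elim H Z p in ∖-intro (Kept 𝒳) Z (proj₁ (proj₂ (quotient-elim G₀ 𝒳 {y} {v} e))) x)
          (λ v p → proj₂ (∖-elim (Kept 𝒳) Z p)) (β₁ , β₂ , cover) (ends⊆Roots R) (rigid⇒with H rigid)
          (feas-mono {G = quotient G₀ merged} {G' = eliminate H Z} (λ _ _ e → merged-adj e)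
            (λ v p → let x , y = kept-merged p in ∖-intro (Kept 𝒳) Z x y) (λ _ p → p) (λ _ p → p) f)))

theorem1p2 : ∀ {m} (R : RootedGraph m) →
    Feasible R ⊎
    (Σ ℕ λ k → Σ (Fin k → VSet (RootedGraph.n R)) λ 𝒳 →
    IsCollection (RootedGraph.G R) (Roots R) 𝒳 ×
    (∀ i → countᵇ (Nbd (RootedGraph.G R) (𝒳 i)) ≤ suc m) ×
    (2 * eRootedQuot R 𝒳 + (m * m + 3 * m + 2) ≤ 2 * (suc m) * vQuot 𝒳))
theorem1p2 R = [ inj₁ ∘ feas⇒feasible R , inj₂ ]′
  -- The search starts from the empty family, whose quotient adds no edge.
  (search R (suc (# (Kept none ∖ Roots R))) none ≤-refl (record { avoid = λ () ; sep = λ () }) (λ ())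
    (feas-mono {G = quotient (G R) none} {G' = G R} (λ {u} {v} _ _ e → real u v e) (λ _ _ → refl) (λ _ p → p) (λ _ p → p)))
  where
  none : Fin 0 → VSet (RootedGraph.n R)
  none ()
  real : ∀ u v → Adj (quotient (G R) none) u v → Adj (G R) u v
  real u v e with quot-elim (G R) none {u} {v} (proj₂ (proj₂ (proj₂ (quotient-elim (G R) none {u} {v} e))))
  ... | inj₁ x = x
  ... | inj₂ (() , _)
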